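{- Let $a,b$ be coprime positive integers with $c:=a+b>2$ (i.e. $(a,b)\neq(1,1)$). Then the $\mathbb{Z}$-module $\mathscr{T}(a,b)$ has rank $r:=\omega(abc)-1\ge 1$, and there are $\mathbb{Z}$-linearly independent derivations $\psi_1,\dots,\psi_r\in\mathscr{T}(a,b)$ satisfying $$\prod_{i=1}^r\|\psi_i\|\le \frac{\omega(abc)}{2\log 2}\cdot c\log c.$$
   Context: For a prime $p$, $v_p$ is the $p$-adic valuation. For a non-zero integer $n$, $\mathrm{supp}(n)$ is the set of primes dividing $n$ and $\omega(n)=\#\mathrm{supp}(n)$. Let $\Omega$ be the free $\mathbb{Z}$-module on symbols $\xi_p$, one for each prime $p$. Define $\mathrm{d}:\mathbb{Z}\to\Omega$ by $\mathrm{d}0=0$ and $\mathrm{d}n=\sum_{p\mid n}\frac{n\,v_p(n)}{p}\,\xi_p$ for $n\ne 0$ (the coefficients are integers). For a $\mathbb{Z}$-linear map $\psi:\Omega\to\mathbb{Z}$ put $\|\psi\|=\sup_p|\psi(\xi_p)|$. Let $\mathscr{T}$ be the $\mathbb{Z}$-module of all $\mathbb{Z}$-linear $\psi:\Omega\to\mathbb{Z}$ with $\|\psi\|<\infty$; its elements are called derivations. For $\psi\in\mathscr{T}$ let $\mathrm{d}^\psi=\psi\circ\mathrm{d}:\mathbb{Z}\to\mathbb{Z}$ and $\mathrm{supp}(\psi)=\{p:\psi(\xi_p)\neq0\}$. For positive integers $a,b$, $$\mathscr{T}(a,b)=\{\psi\in\mathscr{T}:\ \mathrm{supp}(\psi)\subseteq\mathrm{supp}(ab(a+b))\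 \text{and}\ \mathrm{d}^\psi(a+b)=\mathrm{d}^\psi a+\mathrm{d}^\psi b\}.$$ -}

module Defs where

open import Algebra.Bundles using (Ring)
open import Algebra.Definitions.RawMonoid using (sum)
open import Algebra.Module.Bundles using (LeftModule)
open import Algebra.Module.Construct.TensorUnit using (leftModule)
open import Algebra.Module.Morphism.Structures using (module LeftModuleMorphisms)
open import Data.Fin.Base using (Fin)
open import Data.Integer.Base as ℤ using (ℤ; +_; -[1+_]; +[1+_]; 0ℤ; 1ℤ; -1ℤ; ∣_∣; _/ℕ_)
import Data.Integer.Properties as ℤ
open import Data.Integer.Tactic.RingSolver using (solve-∀)
open import Data.List.Base using (List; []; _∷_; _++_; map; filter; foldr; length; upTo)
open import Data.List.Relation.Unary.All using (toList)
open import Data.List.Relation.Unary.All.Properties using (all-filter)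
open import Data.Nat.Base as ℕ using (ℕ; zero; suc; _∸_)
open import Data.Nat.Coprimality using (1-coprimeTo) renaming (sym to sym-coprime)
open import Data.Nat.Divisibility using (_∣_; _∣?_)
open import Data.Nat.Primality using (Prime; prime?; prime⇒nonZero)
import Data.Nat.Properties as ℕ
open import Data.Product.Base using (Σ; ∃; _×_; _,_; proj₁; proj₂; map₁; ∃-syntax)
open import Data.Rational.Base as ℚ using (ℚ; 0ℚ; 1ℚ; mkℚ)
import Data.Rational.Properties as ℚ
open import Data.Rational.Solver using (module +-*-Solver)
import Data.Rational.Unnormalised.Base as ℚᵘ
import Data.Rational.Unnormalised.Properties as ℚᵘ
open import Data.Sum.Base using (inj₁; inj₂)
import Data.Vec.Functional as Vector
open import Function.Base using (_∘_; const)
open import Level using (Level; 0ℓ)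
open import Relation.Binary.PropositionalEquality
open import Relation.Nullary.Decidable using (yes; no; decidable-stable)
open import Relation.Nullary.Negation using (¬_; contradiction)

private
  variable
    r ℓr m ℓm p : Level

module _ {R : Ring r ℓr} (M : LeftModule R m ℓm) where
  open Ring R using (Carrier; _≈_; 0#)
  open LeftModule M

  LinearlyIndependent : ∀ {n} → (Fin n → Carrierᴹ) → Set _
  LinearlyIndependent {n} v =
    (k : Fin n → Carrier) → sum +ᴹ-rawMonoid (λ i → k i *ₗ v i) ≈ᴹ 0ᴹ → ∀ i → k i ≈ 0#

  -- The rank is the largest size of a linearly independent family.
  HasRank : ℕ → Set _
  HasRank n =
    (∃[ v ] LinearlyIndependent {n} v) ×
    (∀ {k} (v : Fin k → Carrierᴹ) → LinearlyIndependent v → k ℕ.≤ n)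

  record IsSubmodule (P : Carrierᴹ → Set p) : Set (r Level.⊔ m Level.⊔ p) where
    field
      0-closed : P 0ᴹ
      +-closed : ∀ {x y} → P x → P y → P (x +ᴹ y)
      *-closed : ∀ k {x} → P x → P (k *ₗ x)
      neg-closed : ∀ {x} → P x → P (-ᴹ x)

  submodule : {P : Carrierᴹ → Set p} → IsSubmodule P → LeftModule R (m Level.⊔ p) ℓm
  submodule {P = P} isSub = record
    { Carrierᴹ = Σ Carrierᴹ P
    ; _≈ᴹ_ = λ x y → proj₁ x ≈ᴹ proj₁ y
    ; _+ᴹ_ = λ x y → proj₁ x +ᴹ proj₁ y , +-closed (proj₂ x) (proj₂ y)
    ; _*ₗ_ = λ k x → k *ₗ proj₁ x , *-closed k (proj₂ x)
    ; 0ᴹ = 0ᴹ , 0-closed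
    ; -ᴹ_ = λ x → -ᴹ proj₁ x , neg-closed (proj₂ x)
    ; isLeftModule = record
      { isLeftSemimodule = record
        { +ᴹ-isCommutativeMonoid = record
          { isMonoid = record
            { isSemigroup = record
              { isMagma = record
                { isEquivalence = record { refl = ≈ᴹ-refl ; sym = ≈ᴹ-sym ; trans = ≈ᴹ-trans }
                ; ∙-cong = +ᴹ-cong
                }
              ; assoc = λ x y z → +ᴹ-assoc (proj₁ x) (proj₁ y) (proj₁ z)
              }
            ; identity = (λ x → +ᴹ-identityˡ (proj₁ x)) , (λ x → +ᴹ-identityʳ (proj₁ x))
            }
          ; comm = λ x y → +ᴹ-comm (proj₁ x) (proj₁ y)
          }
        ; isPreleftSemimodule = record
          { *ₗ-cong = *ₗ-cong
          ; *ₗ-zeroˡ = λ x → *ₗ-zeroˡ (proj₁ x)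
          ; *ₗ-distribʳ = λ x k l → *ₗ-distribʳ (proj₁ x) k l
          ; *ₗ-identityˡ = λ x → *ₗ-identityˡ (proj₁ x)
          ; *ₗ-assoc = λ k l x → *ₗ-assoc k l (proj₁ x)
          ; *ₗ-zeroʳ = *ₗ-zeroʳ
          ; *ₗ-distribˡ = λ k x y → *ₗ-distribˡ k (proj₁ x) (proj₁ y)
          }
        }
      ; -ᴹ‿cong = -ᴹ‿cong
      ; -ᴹ‿inverse = (λ x → -ᴹ‿inverseˡ (proj₁ x)) , (λ x → -ᴹ‿inverseʳ (proj₁ x))
      }
    }
    where open IsSubmodule isSub

ℤ-Module : (m ℓm : Level) → Set _
ℤ-Module = LeftModule ℤ.+-*-ring

ℤ¹ : ℤ-Module 0ℓ 0ℓ
ℤ¹ = leftModule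

Functions : Set → ℤ-Module 0ℓ 0ℓ
Functions A = record
  { Carrierᴹ = A → ℤ
  ; _≈ᴹ_ = _≗_
  ; _+ᴹ_ = λ f g x → f x ℤ.+ g x
  ; _*ₗ_ = λ k f x → k ℤ.* f x
  ; 0ᴹ = const 0ℤ
  ; -ᴹ_ = λ f x → ℤ.- f x
  ; isLeftModule = record
    { isLeftSemimodule = record
      { +ᴹ-isCommutativeMonoid = record
        { isMonoid = record
          { isSemigroup = record
            { isMagma = record
              { isEquivalence = record
                { refl = λ _ → refl ; sym = λ e x → sym (e x) ; trans = λ d e x → trans (d x) (e x) }
              ; ∙-cong = λ d e x → cong₂ ℤ._+_ (d x) (e x)
              }
            ; assoc = λ f g h x → ℤ.+-assoc (f x) (g x) (h x)
            }
          ; identity = (λ f x → ℤ.+-identityˡ (f x)) , (λ f x → ℤ.+-identityʳ (f x))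
          }
        ; comm = λ f g x → ℤ.+-comm (f x) (g x)
        }
      ; isPreleftSemimodule = record
        { *ₗ-cong = λ d e x → cong₂ ℤ._*_ d (e x)
        ; *ₗ-zeroˡ = λ f x → ℤ.*-zeroˡ (f x)
        ; *ₗ-distribʳ = λ f k l x → ℤ.*-distribʳ-+ (f x) k l
        ; *ₗ-identityˡ = λ f x → ℤ.*-identityˡ (f x)
        ; *ₗ-assoc = λ k l f x → ℤ.*-assoc k l (f x)
        ; *ₗ-zeroʳ = λ k x → ℤ.*-zeroʳ k
        ; *ₗ-distribˡ = λ k f g x → ℤ.*-distribˡ-+ k (f x) (g x)
        }
      }
    ; -ᴹ‿cong = λ e x → cong ℤ.-_ (e x)
    ; -ᴹ‿inverse = (λ f x → ℤ.+-inverseˡ (f x)) , (λ f x → ℤ.+-inverseʳ (f x))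
    }
  }

module _ (M : ℤ-Module 0ℓ 0ℓ) where
  open LeftModule M
  open LeftModuleMorphisms rawLeftModule (LeftModule.rawLeftModule ℤ¹)

  Linear : (Carrierᴹ → ℤ) → Set
  Linear = IsLeftModuleHomomorphism

  linear : ∀ {f} → (∀ {x y} → x ≈ᴹ y → f x ≡ f y) → (∀ x y → f (x +ᴹ y) ≡ f x ℤ.+ f y) →
    f 0ᴹ ≡ 0ℤ → (∀ x → f (-ᴹ x) ≡ ℤ.- f x) → (∀ k x → f (k *ₗ x) ≡ k ℤ.* f x) → Linear f
  linear c a z n s = record
    { +ᴹ-isGroupHomomorphism = record
      { isMonoidHomomorphism = record
        { isMagmaHomomorphism = record
          { isRelHomomorphism = record { cong = c } ; homo = a }
        ; ε-homo = z
        }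
      ; ⁻¹-homo = n
      }
    ; *ₗ-homo = s
    }

  Dual : ℤ-Module 0ℓ 0ℓ
  Dual = submodule (Functions Carrierᴹ) {P = Linear} record
    { 0-closed = linear (λ _ → refl) (λ _ _ → refl) refl (λ _ → refl)
        (λ k _ → sym (ℤ.*-zeroʳ k))
    ; +-closed = λ {f} {g} F G → linear
        (λ e → cong₂ ℤ._+_ (H.⟦⟧-cong F e) (H.⟦⟧-cong G e))
        (λ x y → trans (cong₂ ℤ._+_ (H.+ᴹ-homo F x y) (H.+ᴹ-homo G x y))
                       (interchange (f x) (f y) (g x) (g y)))
        (cong₂ ℤ._+_ (H.0ᴹ-homo F) (H.0ᴹ-homo G))
        (λ x → trans (cong₂ ℤ._+_ (H.-ᴹ-homo F x) (H.-ᴹ-homo G x))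
                     (sym (ℤ.neg-distrib-+ (f x) (g x))))
        (λ k x → trans (cong₂ ℤ._+_ (H.*ₗ-homo F k x) (H.*ₗ-homo G k x))
                       (sym (ℤ.*-distribˡ-+ k (f x) (g x))))
    ; *-closed = λ k {f} F → linear
        (cong (k ℤ.*_) ∘ H.⟦⟧-cong F)
        (λ x y → trans (cong (k ℤ.*_) (H.+ᴹ-homo F x y)) (ℤ.*-distribˡ-+ k (f x) (f y)))
        (trans (cong (k ℤ.*_) (H.0ᴹ-homo F)) (ℤ.*-zeroʳ k))
        (λ x → trans (cong (k ℤ.*_) (H.-ᴹ-homo F x)) (sym (ℤ.neg-distribʳ-* k (f x))))
        (λ l x → trans (cong (k ℤ.*_) (H.*ₗ-homo F l x)) (swap k l (f x)))
    ; neg-closed = λ {f} F → linear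
        (cong ℤ.-_ ∘ H.⟦⟧-cong F)
        (λ x y → trans (cong ℤ.-_ (H.+ᴹ-homo F x y)) (ℤ.neg-distrib-+ (f x) (f y)))
        (cong ℤ.-_ (H.0ᴹ-homo F))
        (λ x → cong ℤ.-_ (H.-ᴹ-homo F x))
        (λ k x → trans (cong ℤ.-_ (H.*ₗ-homo F k x)) (ℤ.neg-distribʳ-* k (f x)))
    }
    where
    module H = IsLeftModuleHomomorphism
    open import Algebra.Properties.CommutativeSemigroup ℤ.+-commutativeSemigroup using (interchange)
    open import Algebra.Properties.CommutativeSemigroup ℤ.*-commutativeSemigroup
      renaming (x∙yz≈y∙xz to swap) using ()

ℙ : Set
ℙ = ∃ Prime

primesUpTo : ℕ → List ℙ
primesUpTo n = toList (all-filter prime? (upTo (suc n)))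

-- For n ≠ 0 the bound p ≤ n loses no prime divisor; for n = 0 this is not supp(n).
supp : ℕ → List ℙ
supp n = filter (λ (p , _) → p ∣? n) (primesUpTo n)

ω : ℕ → ℕ
ω n = length (supp n)

-- The largest k with p ^ k ∣ n; meaningful for p ≥ 2 and n ≥ 1, when such k satisfy k ≤ n.
v : ℕ → ℕ → ℕ
v p n = foldr ℕ._⊔_ 0 (filter (λ k → p ℕ.^ k ∣? n) (upTo (suc n)))

-- Elements of Ω are formal sums ∑ mᵢ ξ_{pᵢ}, identified when all their coefficients agree.
coeff : ℕ → List (ℤ × ℙ) → ℤ
coeff q [] = 0ℤ
coeff q ((k , p , _) ∷ xs) with q ℕ.≟ p
... | yes _ = k ℤ.+ coeff q xs
... | no  _ = coeff q xs

scale : ℤ → List (ℤ × ℙ) → List (ℤ × ℙ)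
scale k = map (map₁ (k ℤ.*_))

coeff-++ : ∀ q xs ys → coeff q (xs ++ ys) ≡ coeff q xs ℤ.+ coeff q ys
coeff-++ q [] ys = sym (ℤ.+-identityˡ _)
coeff-++ q ((k , p , _) ∷ xs) ys with q ℕ.≟ p
... | yes _ = trans (cong (λ z → k ℤ.+ z) (coeff-++ q xs ys)) (sym (ℤ.+-assoc k _ _))
... | no  _ = coeff-++ q xs ys

coeff-scale : ∀ q k xs → coeff q (scale k xs) ≡ k ℤ.* coeff q xs
coeff-scale q k [] = sym (ℤ.*-zeroʳ k)
coeff-scale q k ((l , p , _) ∷ xs) with q ℕ.≟ p
... | yes _ = trans (cong (λ z → k ℤ.* l ℤ.+ z) (coeff-scale q k xs)) (sym (ℤ.*-distribˡ-+ k l _))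
... | no  _ = coeff-scale q k xs

Ω : ℤ-Module 0ℓ 0ℓ
Ω = record
  { Carrierᴹ = List (ℤ × ℙ)
  ; _≈ᴹ_ = _≈_
  ; _+ᴹ_ = _++_
  ; _*ₗ_ = scale
  ; 0ᴹ = []
  ; -ᴹ_ = scale -1ℤ
  ; isLeftModule = record
    { isLeftSemimodule = record
      { +ᴹ-isCommutativeMonoid = record
        { isMonoid = record
          { isSemigroup = record
            { isMagma = record
              { isEquivalence = record
                { refl = λ _ → refl ; sym = λ e q → sym (e q) ; trans = λ d e q → trans (d q) (e q) }
              ; ∙-cong = λ {x} {y} {u} {w} d e q →
                  via (x ++ u) (y ++ w) (coeff-++ q x u) (coeff-++ q y w)
                    (cong₂ ℤ._+_ (d q) (e q))
              }
            ; assoc = λ x y z q → trans (coeff-++ q (x ++ y) z)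
                (trans (cong (λ t → t ℤ.+ coeff q z) (coeff-++ q x y))
                (trans (ℤ.+-assoc (coeff q x) _ _)
                (sym (trans (coeff-++ q x (y ++ z))
                            (cong (λ t → coeff q x ℤ.+ t) (coeff-++ q y z))))))
            }
          ; identity = (λ x q → refl) ,
              (λ x q → trans (coeff-++ q x []) (ℤ.+-identityʳ _))
          }
        ; comm = λ x y q → via (x ++ y) (y ++ x) (coeff-++ q x y) (coeff-++ q y x)
            (ℤ.+-comm (coeff q x) (coeff q y))
        }
      ; isPreleftSemimodule = record
        { *ₗ-cong = λ {k} {l} {x} {y} d e q →
            via (scale k x) (scale l y) (coeff-scale q k x) (coeff-scale q l y)
              (cong₂ ℤ._*_ d (e q))
        ; *ₗ-zeroˡ = λ x q → trans (coeff-scale q 0ℤ x) (ℤ.*-zeroˡ (coeff q x))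
        ; *ₗ-distribʳ = λ x k l q →
            via (scale (k ℤ.+ l) x) (scale k x ++ scale l x) (coeff-scale q (k ℤ.+ l) x)
              (trans (coeff-++ q (scale k x) (scale l x))
                     (cong₂ ℤ._+_ (coeff-scale q k x) (coeff-scale q l x)))
              (ℤ.*-distribʳ-+ (coeff q x) k l)
        ; *ₗ-identityˡ = λ x q → trans (coeff-scale q 1ℤ x) (ℤ.*-identityˡ (coeff q x))
        ; *ₗ-assoc = λ k l x q →
            via (scale (k ℤ.* l) x) (scale k (scale l x)) (coeff-scale q (k ℤ.* l) x)
              (trans (coeff-scale q k (scale l x)) (cong (k ℤ.*_) (coeff-scale q l x)))
              (ℤ.*-assoc k l (coeff q x))
        ; *ₗ-zeroʳ = λ k q → refl
        ; *ₗ-distribˡ = λ k x y q →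
            via (scale k (x ++ y)) (scale k x ++ scale k y)
              (trans (coeff-scale q k (x ++ y)) (cong (k ℤ.*_) (coeff-++ q x y)))
              (trans (coeff-++ q (scale k x) (scale k y))
                     (cong₂ ℤ._+_ (coeff-scale q k x) (coeff-scale q k y)))
              (ℤ.*-distribˡ-+ k (coeff q x) (coeff q y))
        }
      }
    ; -ᴹ‿cong = λ {x} {y} e q →
        via (scale -1ℤ x) (scale -1ℤ y) (coeff-scale q -1ℤ x) (coeff-scale q -1ℤ y)
          (cong (-1ℤ ℤ.*_) (e q))
    ; -ᴹ‿inverse =
        (λ x q → trans (coeff-++ q (scale -1ℤ x) x)
                 (trans (cong (λ t → t ℤ.+ coeff q x) (neg q x)) (ℤ.+-inverseˡ (coeff q x)))) ,
        (λ x q → trans (coeff-++ q x (scale -1ℤ x))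
                 (trans (cong (λ t → coeff q x ℤ.+ t) (neg q x)) (ℤ.+-inverseʳ (coeff q x))))
    }
  }
  where
  _≈_ : List (ℤ × ℙ) → List (ℤ × ℙ) → Set
  x ≈ y = ∀ q → coeff q x ≡ coeff q y

  via : ∀ {q k l} x y → coeff q x ≡ k → coeff q y ≡ l → k ≡ l → coeff q x ≡ coeff q y
  via _ _ d e eq = trans d (trans eq (sym e))

  neg : ∀ q x → coeff q (scale -1ℤ x) ≡ ℤ.- coeff q x
  neg q x = trans (coeff-scale q -1ℤ x) (ℤ.-1*i≡-i (coeff q x))

open LeftModule Ω using () renaming (Carrierᴹ to ∣Ω∣; _+ᴹ_ to _+Ω_; 0ᴹ to 0Ω; _*ₗ_ to _*Ω_)

ξ : ℙ → ∣Ω∣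
ξ p = (1ℤ , p) ∷ []

∂/∂ξ : ℤ → ℙ → ℤ
∂/∂ξ n (p , p-prime) = (n ℤ.* + v p ∣ n ∣) /ℕ p
  where instance _ = prime⇒nonZero p-prime

-- The division by p is exact, since p ∣ n.
d : ℤ → ∣Ω∣
d (+ 0) = 0Ω
d n     = foldr _+Ω_ 0Ω (map (λ p → ∂/∂ξ n p *Ω ξ p) (supp ∣ n ∣))

Bounded : LeftModule.Carrierᴹ (Dual Ω) → Set
Bounded (ψ , _) = ∃[ B ] ∀ p → ∣ ψ (ξ p) ∣ ℕ.≤ B

𝒯 : ℤ-Module 0ℓ 0ℓ
𝒯 = submodule (Dual Ω) {P = Bounded} record
  { 0-closed = 0 , λ _ → ℕ.z≤n
  ; +-closed = λ {(f , _)} {(g , _)} (A , A≥) (B , B≥) → A ℕ.+ B , λ p →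
      ℕ.≤-trans (ℤ.∣i+j∣≤∣i∣+∣j∣ (f (ξ p)) (g (ξ p))) (ℕ.+-mono-≤ (A≥ p) (B≥ p))
  ; *-closed = λ k {(f , _)} (B , B≥) → ∣ k ∣ ℕ.* B , λ p →
      ℕ.≤-trans (ℕ.≤-reflexive (ℤ.abs-* k (f (ξ p)))) (ℕ.*-monoʳ-≤ ∣ k ∣ (B≥ p))
  ; neg-closed = λ {(f , _)} (B , B≥) → B , λ p →
      ℕ.≤-trans (ℕ.≤-reflexive (ℤ.∣-i∣≡∣i∣ (f (ξ p)))) (B≥ p)
  }

Derivation : Set
Derivation = LeftModule.Carrierᴹ 𝒯

infix 9 _·_

_·_ : Derivation → ∣Ω∣ → ℤ
((ψ , _) , _) · x = ψ x

-- ‖ ψ ‖≡ s: the supremum ‖ψ‖ is s. This is a relation because the supremum of a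
-- bounded sequence of naturals is not constructively a function of the sequence.
‖_‖≡_ : Derivation → ℕ → Set
‖ ψ ‖≡ s = (∀ p → ∣ ψ · ξ p ∣ ℕ.≤ s) × (∀ u → (∀ p → ∣ ψ · ξ p ∣ ℕ.≤ u) → s ℕ.≤ u)

d^ : Derivation → ℤ → ℤ
d^ ψ n = ψ · d n

record In𝒯⟨_,_⟩ (a b : ℕ) (ψ : Derivation) : Set where
  field
    supp⊆  : ∀ p → ψ · ξ p ≢ 0ℤ → proj₁ p ∣ a ℕ.* b ℕ.* (a ℕ.+ b)
    d^-add : d^ ψ (+ (a ℕ.+ b)) ≡ d^ ψ (+ a) ℤ.+ d^ ψ (+ b)

𝒯⟨_,_⟩ : ℕ → ℕ → ℤ-Module 0ℓ 0ℓ
𝒯⟨ a , b ⟩ = submodule 𝒯 {P = In𝒯⟨ a , b ⟩} record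
  { 0-closed = record { supp⊆ = λ p 0≢0 → contradiction refl 0≢0 ; d^-add = refl }
  ; +-closed = λ {ψ} {φ} Ψ Φ → record
      { supp⊆ = λ p → supported p λ p∤ → cong₂ ℤ._+_ (vanish ψ Ψ p p∤) (vanish φ Φ p p∤)
      ; d^-add = trans (cong₂ ℤ._+_ (D.d^-add Ψ) (D.d^-add Φ))
          (interchange (d^ ψ (+ a)) (d^ ψ (+ b)) (d^ φ (+ a)) (d^ φ (+ b)))
      }
  ; *-closed = λ k {ψ} Ψ → record
      { supp⊆ = λ p → supported p λ p∤ → trans (cong (k ℤ.*_) (vanish ψ Ψ p p∤)) (ℤ.*-zeroʳ k)
      ; d^-add = trans (cong (k ℤ.*_) (D.d^-add Ψ)) (ℤ.*-distribˡ-+ k (d^ ψ (+ a)) (d^ ψ (+ b)))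
      }
  ; neg-closed = λ {ψ} Ψ → record
      { supp⊆ = λ p → supported p λ p∤ → cong ℤ.-_ (vanish ψ Ψ p p∤)
      ; d^-add = trans (cong ℤ.-_ (D.d^-add Ψ)) (ℤ.neg-distrib-+ (d^ ψ (+ a)) (d^ ψ (+ b)))
      }
  }
  where
  open import Algebra.Properties.CommutativeSemigroup ℤ.+-commutativeSemigroup using (interchange)

  module D = In𝒯⟨_,_⟩

  abc : ℕ
  abc = a ℕ.* b ℕ.* (a ℕ.+ b)

  vanish : ∀ ψ → In𝒯⟨ a , b ⟩ ψ → ∀ p → ¬ (proj₁ p ∣ abc) → ψ · ξ p ≡ 0ℤ
  vanish ψ Ψ p p∤ = decidable-stable (ψ · ξ p ℤ.≟ 0ℤ) (p∤ ∘ D.supp⊆ Ψ p)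

  supported : ∀ {z} (p : ℙ) → (¬ (proj₁ p ∣ abc) → z ≡ 0ℤ) → z ≢ 0ℤ → proj₁ p ∣ abc
  supported (p , _) f z≢0 = decidable-stable (p ∣? abc) (z≢0 ∘ f)

∏ : ∀ {n} → (Fin n → ℕ) → ℕ
∏ = Vector.foldr ℕ._*_ 1

-- Real numbers as Cauchy sequences of rationals; _≤ℝ_ compares limits.
record ℝ : Set where
  field
    seq    : ℕ → ℚ
    cauchy : ∀ ε → 0ℚ ℚ.< ε →
      ∃[ N ] ∀ m n → N ℕ.≤ m → N ℕ.≤ n → ℚ.∣ seq m ℚ.- seq n ∣ ℚ.≤ ε

open ℝ public

infix 4 _≤ℝ_

_≤ℝ_ : ℝ → ℝ → Set
x ≤ℝ y = ∀ ε → 0ℚ ℚ.< ε → ∃[ N ] ∀ n → N ℕ.≤ n → seq x n ℚ.≤ seq y n ℚ.+ ε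

fromℕ : ℕ → ℚ
fromℕ m = mkℚ (+ m) 0 (sym-coprime (1-coprimeTo m))

infixr 7 _·ℝ_

_·ℝ_ : ℕ → ℝ → ℝ
m ·ℝ x = record
  { seq = λ k → fromℕ m ℚ.* seq x k
  ; cauchy = λ ε 0<ε → let (N , close) = cauchy x (ℚ.1/ fromℕ (suc m) ℚ.* ε) (shrink ε 0<ε) in
      N , λ i j N≤i N≤j → bound ε 0<ε (seq x i) (seq x j) (close i j N≤i N≤j)
  }
  where
  open ℚ.≤-Reasoning
  open +-*-Solver

  shrink : ∀ ε → 0ℚ ℚ.< ε → 0ℚ ℚ.< ℚ.1/ fromℕ (suc m) ℚ.* ε
  shrink ε 0<ε = begin-strict
    0ℚ                          ≡⟨ ℚ.*-zeroʳ (ℚ.1/ fromℕ (suc m)) ⟨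
    ℚ.1/ fromℕ (suc m) ℚ.* 0ℚ     <⟨ ℚ.*-monoʳ-<-pos (ℚ.1/ fromℕ (suc m)) 0<ε ⟩
    ℚ.1/ fromℕ (suc m) ℚ.* ε      ∎

  bound : ∀ ε → 0ℚ ℚ.< ε → ∀ p q → ℚ.∣ p ℚ.- q ∣ ℚ.≤ ℚ.1/ fromℕ (suc m) ℚ.* ε →
    ℚ.∣ fromℕ m ℚ.* p ℚ.- fromℕ m ℚ.* q ∣ ℚ.≤ ε
  bound ε 0<ε p q close = begin
    ℚ.∣ fromℕ m ℚ.* p ℚ.- fromℕ m ℚ.* q ∣
      ≡⟨ cong ℚ.∣_∣ (solve 3 (λ m p q → m :* p :- m :* q := m :* (p :- q)) refl (fromℕ m) p q) ⟩
    ℚ.∣ fromℕ m ℚ.* (p ℚ.- q) ∣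
      ≡⟨ ℚ.∣p*q∣≡∣p∣*∣q∣ (fromℕ m) (p ℚ.- q) ⟩
    fromℕ m ℚ.* ℚ.∣ p ℚ.- q ∣
      ≤⟨ ℚ.*-monoʳ-≤-nonNeg ℚ.∣ p ℚ.- q ∣ {{ℚ.∣-∣-nonNeg (p ℚ.- q)}} m≤1+m ⟩
    fromℕ (suc m) ℚ.* ℚ.∣ p ℚ.- q ∣
      ≤⟨ ℚ.*-monoˡ-≤-nonNeg (fromℕ (suc m)) close ⟩
    fromℕ (suc m) ℚ.* (ℚ.1/ fromℕ (suc m) ℚ.* ε)
      ≡⟨ ℚ.*-assoc (fromℕ (suc m)) (ℚ.1/ fromℕ (suc m)) ε ⟨
    fromℕ (suc m) ℚ.* ℚ.1/ fromℕ (suc m) ℚ.* ε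
      ≡⟨ cong (ℚ._* ε) (ℚ.*-inverseʳ (fromℕ (suc m))) ⟩
    1ℚ ℚ.* ε
      ≡⟨ ℚ.*-identityˡ ε ⟩
    ε ∎
    where
    m≤1+m : fromℕ m ℚ.≤ fromℕ (suc m)
    m≤1+m = ℚ.*≤* (ℤ.*-monoʳ-≤-nonNeg 1ℤ (ℤ.+≤+ (ℕ.n≤1+n m)))

∑< : ℕ → (ℕ → ℚ) → ℚ
∑< zero    f = 0ℚ
∑< (suc n) f = ∑< n f ℚ.+ f n

-- 1/(j + 1), already in lowest terms
recip : ℕ → ℚ
recip j = mkℚ (+ 1) j (1-coprimeTo (suc j))

-- The k-th Riemann sum of ∫₁ⁿ dt/t (n ≥ 1) with mesh 1/K, where K = k + 1, evaluated at the
-- right endpoints tᵢ = 1 + (i + 1)/K for i < (n − 1)K: each term is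
-- (1/K) · (1/tᵢ) = 1/(K + i + 1).
log-riemann : ℕ → ℕ → ℚ
log-riemann n k = ∑< ((n ∸ 1) ℕ.* suc k) (λ i → recip (suc k ℕ.+ i))

recip-antitone : ∀ {i j} → i ℕ.≤ j → recip j ℚ.≤ recip i
recip-antitone i≤j = ℚ.*≤* (ℤ.*-monoˡ-≤-nonNeg 1ℤ (ℤ.+≤+ (ℕ.s≤s i≤j)))

∑<-mono : ∀ n {f g} → (∀ i → i ℕ.< n → f i ℚ.≤ g i) → ∑< n f ℚ.≤ ∑< n g
∑<-mono zero    f≤g = ℚ.≤-refl
∑<-mono (suc n) f≤g =
  ℚ.+-mono-≤ (∑<-mono n (λ i i<n → f≤g i (ℕ.m≤n⇒m≤1+n i<n))) (f≤g n ℕ.≤-refl)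

∑<-cong : ∀ n {f g} → f ≗ g → ∑< n f ≡ ∑< n g
∑<-cong zero    f≗g = refl
∑<-cong (suc n) f≗g = cong₂ ℚ._+_ (∑<-cong n f≗g) (f≗g n)

∑<-+ : ∀ m n f → ∑< (m ℕ.+ n) f ≡ ∑< m f ℚ.+ ∑< n (f ∘ (m ℕ.+_))
∑<-+ m zero f = trans (cong (λ t → ∑< t f) (ℕ.+-identityʳ m)) (sym (ℚ.+-identityʳ _))
∑<-+ m (suc n) f = trans (cong (λ t → ∑< t f) (ℕ.+-suc m n))
  (trans (cong (λ t → t ℚ.+ f (m ℕ.+ n)) (∑<-+ m n f)) (ℚ.+-assoc (∑< m f) _ _))

∑<-const-recip : ∀ j n → ℚ.toℚᵘ (∑< n (const (recip j))) ℚᵘ.≃ ℚᵘ.mkℚᵘ (+ n) j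
∑<-const-recip j zero = ℚᵘ.*≡* refl
∑<-const-recip j (suc n) = begin
  ℚ.toℚᵘ (S ℚ.+ recip j)                 ≈⟨ ℚ.toℚᵘ-homo-+ S (recip j) ⟩
  ℚ.toℚᵘ S ℚᵘ.+ ℚᵘ.mkℚᵘ (+ 1) j          ≈⟨ ℚᵘ.+-congˡ (ℚᵘ.mkℚᵘ (+ 1) j) (∑<-const-recip j n) ⟩
  ℚᵘ.mkℚᵘ (+ n) j ℚᵘ.+ ℚᵘ.mkℚᵘ (+ 1) j   ≈⟨ ℚᵘ.*≡* eq ⟩
  ℚᵘ.mkℚᵘ (+ suc n) j                    ∎
  where
  open import Relation.Binary.Reasoning.Setoid ℚᵘ.≃-setoid
  S = ∑< n (const (recip j))
  rearrange : ∀ a b → (a ℤ.* b ℤ.+ 1ℤ ℤ.* b) ℤ.* b ≡ (1ℤ ℤ.+ a) ℤ.* (b ℤ.* b)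
  rearrange = solve-∀
  eq : (+ n ℤ.* + suc j ℤ.+ 1ℤ ℤ.* + suc j) ℤ.* + suc j ≡ + suc n ℤ.* + (suc j ℕ.* suc j)
  eq = trans (rearrange (+ n) (+ suc j)) (cong (+ suc n ℤ.*_) (sym (ℤ.pos-* (suc j) (suc j))))

-- M′ · 1/((q + 1) M′) = 1/(q + 1), for M′ = M + 1
∑<-const-block : ∀ q M → ∑< (suc M) (const (recip (M ℕ.+ q ℕ.* suc M))) ≡ recip q
∑<-const-block q M = ℚ.toℚᵘ-injective (ℚᵘ.≃-trans (∑<-const-recip (M ℕ.+ q ℕ.* suc M) (suc M))
  (ℚᵘ.*≡* (trans (sym (ℤ.pos-* (suc M) (suc q)))
          (trans (cong +_ (ℕ.*-comm (suc M) (suc q))) (sym (ℤ.*-identityˡ _))))))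

block-≥ : ∀ q M → recip q ℚ.≤ ∑< (suc M) (λ i → recip (q ℕ.* suc M ℕ.+ i))
block-≥ q M = ℚ.≤-trans (ℚ.≤-reflexive (sym (∑<-const-block q M)))
  (∑<-mono (suc M) λ i i<M → recip-antitone
    (ℕ.≤-trans (ℕ.+-monoʳ-≤ (q ℕ.* suc M) (ℕ.s≤s⁻¹ i<M)) (ℕ.≤-reflexive (ℕ.+-comm (q ℕ.* suc M) M))))

block-≤ : ∀ q M → ∑< (suc M) (λ i → recip (suc q ℕ.* suc M ℕ.+ i)) ℚ.≤ recip q
block-≤ q M = ℚ.≤-trans
  (∑<-mono (suc M) λ i i<M → recip-antitone (ℕ.≤-trans (ℕ.n≤1+n _) (ℕ.m≤m+n _ i)))
  (ℚ.≤-reflexive (∑<-const-block q M))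

blocks : ∀ K M l → ∑< (suc l ℕ.* suc M) (λ i → recip (suc K ℕ.* suc M ℕ.+ i)) ≡
  ∑< (l ℕ.* suc M) (λ i → recip (suc K ℕ.* suc M ℕ.+ i)) ℚ.+
  ∑< (suc M) (λ i → recip ((suc K ℕ.+ l) ℕ.* suc M ℕ.+ i))
blocks K M l = trans (cong (λ t → ∑< t F) (ℕ.+-comm (suc M) (l ℕ.* suc M)))
  (trans (∑<-+ (l ℕ.* suc M) (suc M) F)
         (cong (∑< (l ℕ.* suc M) F ℚ.+_) (∑<-cong (suc M) λ i → cong recip (eq i))))
  where
  F = λ i → recip (suc K ℕ.* suc M ℕ.+ i)
  eq : ∀ i → suc K ℕ.* suc M ℕ.+ (l ℕ.* suc M ℕ.+ i) ≡ (suc K ℕ.+ l) ℕ.* suc M ℕ.+ i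
  eq i = trans (sym (ℕ.+-assoc (suc K ℕ.* suc M) (l ℕ.* suc M) i))
               (cong (ℕ._+ i) (sym (ℕ.*-distribʳ-+ (suc M) (suc K) l)))

refine-≥ : ∀ K M l → ∑< l (λ i → recip (suc K ℕ.+ i)) ℚ.≤
  ∑< (l ℕ.* suc M) (λ i → recip (suc K ℕ.* suc M ℕ.+ i))
refine-≥ K M zero = ℚ.≤-refl
refine-≥ K M (suc l) = ℚ.≤-trans (ℚ.+-mono-≤ (refine-≥ K M l) (block-≥ (suc K ℕ.+ l) M))
  (ℚ.≤-reflexive (sym (blocks K M l)))

refine-≤ : ∀ K M l → ∑< (l ℕ.* suc M) (λ i → recip (suc K ℕ.* suc M ℕ.+ i)) ℚ.≤
  ∑< l (λ i → recip (K ℕ.+ i))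
refine-≤ K M zero = ℚ.≤-refl
refine-≤ K M (suc l) = ℚ.≤-trans (ℚ.≤-reflexive (blocks K M l))
  (ℚ.+-mono-≤ (refine-≤ K M l) (block-≤ (K ℕ.+ l) M))

telescope : ∀ K l → ∑< l (λ i → recip (K ℕ.+ i)) ℚ.+ recip (K ℕ.+ l) ≡
  recip K ℚ.+ ∑< l (λ i → recip (suc K ℕ.+ i))
telescope K zero = trans (cong (λ t → 0ℚ ℚ.+ recip t) (ℕ.+-identityʳ K)) (ℚ.+-comm 0ℚ (recip K))
telescope K (suc l) = trans
  (cong₂ ℚ._+_ (telescope K l) (cong recip (ℕ.+-suc K l)))
  (ℚ.+-assoc (recip K) (∑< l (λ i → recip (suc K ℕ.+ i))) (recip (suc K ℕ.+ l)))

telescope-≤ : ∀ K l → ∑< l (λ i → recip (K ℕ.+ i)) ℚ.≤ recip K ℚ.+ ∑< l (λ i → recip (suc K ℕ.+ i))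
telescope-≤ K l = begin
  S                      ≡⟨ ℚ.+-identityʳ S ⟨
  S ℚ.+ 0ℚ               ≤⟨ ℚ.+-monoʳ-≤ S (ℚ.nonNegative⁻¹ (recip (K ℕ.+ l))) ⟩
  S ℚ.+ recip (K ℕ.+ l)  ≡⟨ telescope K l ⟩
  recip K ℚ.+ ∑< l (λ i → recip (suc K ℕ.+ i)) ∎
  where
  open ℚ.≤-Reasoning
  S = ∑< l (λ i → recip (K ℕ.+ i))

-- With S(K) the Riemann sum of mesh 1/K: S(K) ≤ S(KM) ≤ 1/M + S(M).
log-close : ∀ n K M → log-riemann n K ℚ.≤ recip M ℚ.+ log-riemann n M
log-close n K M = begin
  log-riemann n K                                                          ≤⟨ refine-≥ K M l ⟩
  ∑< (l ℕ.* suc M) (λ i → recip (suc K ℕ.* suc M ℕ.+ i))                   ≡⟨ cong (λ t → ∑< t (λ i → recip (suc K ℕ.* suc M ℕ.+ i))) eq ⟩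
  ∑< (l′ ℕ.* suc K) (λ i → recip (suc K ℕ.* suc M ℕ.+ i))                  ≡⟨ ∑<-cong (l′ ℕ.* suc K) (λ i → cong (λ t → recip (t ℕ.+ i)) (ℕ.*-comm (suc K) (suc M))) ⟩
  ∑< (l′ ℕ.* suc K) (λ i → recip (suc M ℕ.* suc K ℕ.+ i))                  ≤⟨ refine-≤ M K l′ ⟩
  ∑< l′ (λ i → recip (M ℕ.+ i))                                            ≤⟨ telescope-≤ M l′ ⟩
  recip M ℚ.+ log-riemann n M                                              ∎
  where
  open ℚ.≤-Reasoning
  l = (n ∸ 1) ℕ.* suc K
  l′ = (n ∸ 1) ℕ.* suc M
  eq : l ℕ.* suc M ≡ l′ ℕ.* suc K
  eq = trans (ℕ.*-assoc (n ∸ 1) (suc K) (suc M))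
    (trans (cong ((n ∸ 1) ℕ.*_) (ℕ.*-comm (suc K) (suc M))) (sym (ℕ.*-assoc (n ∸ 1) (suc M) (suc K))))

∣p-q∣≤ε : ∀ {p q ε} → p ℚ.≤ ε ℚ.+ q → q ℚ.≤ ε ℚ.+ p → ℚ.∣ p ℚ.- q ∣ ℚ.≤ ε
∣p-q∣≤ε {p} {q} {ε} p≤ q≤ with ℚ.∣p∣≡p∨∣p∣≡-p (p ℚ.- q)
... | inj₁ e = ℚ.≤-trans (ℚ.≤-reflexive e)
    (ℚ.≤-trans (ℚ.+-monoˡ-≤ (ℚ.- q) p≤) (ℚ.≤-reflexive (cancel ε q)))
  where
  open +-*-Solver
  cancel : ∀ ε q → (ε ℚ.+ q) ℚ.- q ≡ ε
  cancel = solve 2 (λ ε q → (ε :+ q) :- q := ε) refl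
... | inj₂ e = ℚ.≤-trans (ℚ.≤-reflexive (trans e (flip p q)))
    (ℚ.≤-trans (ℚ.+-monoˡ-≤ (ℚ.- p) q≤) (ℚ.≤-reflexive (cancel ε p)))
  where
  open +-*-Solver
  cancel : ∀ ε q → (ε ℚ.+ q) ℚ.- q ≡ ε
  cancel = solve 2 (λ ε q → (ε :+ q) :- q := ε) refl
  flip : ∀ p q → ℚ.- (p ℚ.- q) ≡ q ℚ.- p
  flip = solve 2 (λ p q → :- (p :- q) := q :- p) refl

archimedean : ∀ ε → 0ℚ ℚ.< ε → ∃[ N ] recip N ℚ.≤ ε
archimedean (mkℚ (+ suc k) N _) _ =
  N , ℚ.*≤* (ℤ.*-monoʳ-≤-nonNeg (+ suc N) {1ℤ} {+ suc k} (ℤ.+≤+ (ℕ.s≤s ℕ.z≤n)))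
archimedean (mkℚ (+ 0) _ _)      (ℚ.*<* (ℤ.+<+ ()))
archimedean (mkℚ (-[1+ _ ]) _ _) (ℚ.*<* ())

-- log n = ∫₁ⁿ dt/t for n ≥ 1 (log 0 is a junk value).
log : ℕ → ℝ
log n = record
  { seq = log-riemann n
  ; cauchy = λ ε 0<ε → let (N , 1/N≤ε) = archimedean ε 0<ε in N , λ K M N≤K N≤M →
      ∣p-q∣≤ε (close K M N≤M 1/N≤ε) (close M K N≤K 1/N≤ε)
  }
  where
  close : ∀ K M {N ε} → N ℕ.≤ M → recip N ℚ.≤ ε → log-riemann n K ℚ.≤ ε ℚ.+ log-riemann n M
  close K M N≤M 1/N≤ε = ℚ.≤-trans (log-close n K M)
    (ℚ.+-monoˡ-≤ (log-riemann n M) (ℚ.≤-trans (recip-antitone N≤M) 1/N≤ε))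

{-# OPTIONS --safe #-}

-- Write a + b = c. A derivation supported on the primes pⱼ dividing abc is an integer vector, and
-- the condition d(a + b) = da + db is a single linear equation ∑ ± wⱼ xⱼ = 0, where wⱼ is the
-- coefficient of ξ_{pⱼ} in that one of da, db, dc in which it is nonzero; changing signs of
-- coordinates makes it ∑ wⱼ xⱼ = 0. Minkowski's second theorem for the sup norm gives independent
-- solutions with ∏ ‖xᵢ‖ ≤ ∑ wⱼ. Finally 4^(∂ₚ m) ≤ (p^p)^(∂ₚ m) = (p^{vₚ(m)})^m, hence
-- 4^(∑ wⱼ) ≤ a^a b^b c^c ≤ c^(2c), and ω(abc) ≥ 2.
--
-- The required case of Minkowski's theorem is proved by counting. Let λ₁ ≤ … ≤ λᵣ be the successive
-- minima of Λ = w^⊥ ⊂ ℤⁿ (n = r + 1), and Sᵢ the saturated span of the first i of them. Choosing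
-- for x in the box B = [0, k)ⁿ representatives cᵢ(x) ∈ B of x modulo Sᵢ₋₁, the map
-- x ↦ ∑ (λᵢ − λᵢ₋₁) cᵢ(x) multiplies by λᵢ in the i-th direction of the flag, so that adding
-- λ₁ ⋯ λᵣ λᵣ fixed vectors to its values yields points that are distinct modulo K Λ, where
-- K = k + O(1). They lie in a box of side K λᵣ, which meets at most Kⁿ ((λᵣ − 1) ∑ wⱼ + 1) classes modulo K Λ.
-- Now let k → ∞.
module Submission where

open import Defs
open import Algebra.Module.Bundles using (module LeftModule)
open import Data.Fin.Base using (Fin)
open import Data.Nat.Base using (ℕ; _+_; _*_; _∸_; _≤_; _<_)
open import Data.Nat.Coprimality using (Coprime)
open import Data.Product.Base using (Σ-syntax; _×_; proj₁)

open import Algebra.Definitions.RawMonoid using () renaming (sum to ∑)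
open import Algebra.Module.Morphism.Structures using (module LeftModuleMorphisms)
import Algebra.Properties.AbelianGroup as AbelianGroup
open import Data.Fin.Base as Fin using (zero; suc; toℕ; fromℕ<; combine; remQuot)
import Data.Fin.Properties as Fin
open import Data.Integer.Base as ℤ using (ℤ; +_; 0ℤ; 1ℤ; -1ℤ; ∣_∣; _/ℕ_; _%ℕ_)
import Data.Integer.DivMod as ℤ
import Data.Integer.Properties as ℤ
open import Data.Integer.Tactic.RingSolver using (solve-∀)
open import Data.List.Base as List using (List; []; _∷_; length; upTo; filter; foldr)
open import Data.List.Membership.Propositional using (_∈_; _∉_)
import Data.List.Membership.Propositional.Properties as ∈
open import Data.List.Relation.Unary.All as All using (All; []; _∷_)
import Data.List.Relation.Unary.All.Properties as All
open import Data.List.Relation.Unary.AllPairs using (AllPairs; []; _∷_)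
import Data.List.Relation.Unary.AllPairs.Properties as AllPairs
open import Data.List.Relation.Unary.Any as Any using (here; there)
import Data.List.Relation.Unary.Unique.Propositional.Properties as Unique
open import Data.Nat.Base as ℕ using (zero; suc; _^_; _⊔_; s≤s; z≤n; s≤s⁻¹; NonZero)
open import Data.Nat.Divisibility
import Data.Nat.DivMod as ℕ
open import Data.Nat.Induction using (<-wellFounded)
open import Data.Nat.Primality
  using (Prime; prime?; prime⇒nonZero; prime⇒nonTrivial; prime⇒irreducible; euclidsLemma; ¬prime[1])
open import Data.Nat.Primality.Factorisation using (factorise)
import Data.Nat.Properties as ℕ
import Data.Nat.Tactic.RingSolver as ℕSolver
open import Data.Product.Base using (∃; ∃-syntax; _,_; proj₂)
open import Data.Rational.Base as ℚ using (ℚ; 0ℚ; 1ℚ)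
import Data.Rational.Properties as ℚ
import Data.Rational.Unnormalised.Base as ℚᵘ
import Data.Rational.Unnormalised.Properties as ℚᵘ
open import Data.Sum.Base using (_⊎_; inj₁; inj₂)
open import Data.Vec.Base as Vec
  using (Vec; []; _∷_; head; tail; zipWith; map; replicate; sum; foldr′; lookup; tabulate; fromList)
import Data.Vec.Properties as Vec
open import Data.Vec.Relation.Unary.All as VecAll using ([]; _∷_)
open import Function.Base using (_∘_; _on_; const; id)
open import Induction.WellFounded using (Acc; acc)
open import Relation.Binary.PropositionalEquality
open import Relation.Nullary.Decidable
  using (Dec; yes; no; map′; _×-dec_; _⊎-dec_; ¬?; decidable-stable)
open import Relation.Nullary.Negation using (¬_; contradiction)
open import Relation.Unary using (Decidable)

-- Linear maps between free ℤ-modules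

-- The lattice Λ has rank n - 1 inside ℤⁿ. Minkowski's theorem within the hyperplane would involve
-- the volume of a section of the cube and the determinant of Λ; counting in all of ℤⁿ replaces both
-- by the values that w takes on a cube of integer points. The price is one direction too many: ℤⁿ
-- modulo Λ has no minimum of its own. It is stretched by λᵣ too, hence the repeated λᵣ in the
-- number of fixed vectors, and this factor cancels against the λᵣ in the number of classes. The
-- fixed vectors depend on the flag but not on k, so K - k stays bounded and the limit loses
-- nothing. The constant 2 log 2 comes from the prime 2: ∂ₚ m is m vₚ(m)/p, the sum of vₚ(m) log p
-- is log m, and p log p is least at p = 2, so that ∑ ∂ₚ m ≤ m log m / (2 log 2). The estimate is
-- carried out with powers of natural numbers; logarithms enter only through `log-compare`.

infixl 6 _⊕_ _⊖_
infixr 7 _∙_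

_⊕_ : ∀ {n} → Vec ℤ n → Vec ℤ n → Vec ℤ n
_⊕_ = zipWith ℤ._+_

_∙_ : ∀ {n} → ℤ → Vec ℤ n → Vec ℤ n
k ∙ x = map (k ℤ.*_) x

𝟘 : ∀ {n} → Vec ℤ n
𝟘 = replicate _ 0ℤ

_⊖_ : ∀ {n} → Vec ℤ n → Vec ℤ n → Vec ℤ n
x ⊖ y = x ⊕ -1ℤ ∙ y

⊕-assoc : ∀ {n} (x y z : Vec ℤ n) → (x ⊕ y) ⊕ z ≡ x ⊕ (y ⊕ z)
⊕-assoc = Vec.zipWith-assoc ℤ.+-assoc

⊕-identityˡ : ∀ {n} (x : Vec ℤ n) → 𝟘 ⊕ x ≡ x
⊕-identityˡ = Vec.zipWith-identityˡ ℤ.+-identityˡ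

⊕-identityʳ : ∀ {n} (x : Vec ℤ n) → x ⊕ 𝟘 ≡ x
⊕-identityʳ = Vec.zipWith-identityʳ ℤ.+-identityʳ

∙-zeroˡ : ∀ {n} (x : Vec ℤ n) → 0ℤ ∙ x ≡ 𝟘
∙-zeroˡ []      = refl
∙-zeroˡ (a ∷ x) = cong₂ _∷_ (ℤ.*-zeroˡ a) (∙-zeroˡ x)

∙-zeroʳ : ∀ {n} (k : ℤ) → k ∙ 𝟘 {n} ≡ 𝟘
∙-zeroʳ {zero}  k = refl
∙-zeroʳ {suc n} k = cong₂ _∷_ (ℤ.*-zeroʳ k) (∙-zeroʳ k)

∙-identityˡ : ∀ {n} (x : Vec ℤ n) → 1ℤ ∙ x ≡ x
∙-identityˡ []      = refl
∙-identityˡ (a ∷ x) = cong₂ _∷_ (ℤ.*-identityˡ a) (∙-identityˡ x)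

∙-assoc : ∀ {n} k l (x : Vec ℤ n) → (k ℤ.* l) ∙ x ≡ k ∙ l ∙ x
∙-assoc k l []      = refl
∙-assoc k l (a ∷ x) = cong₂ _∷_ (ℤ.*-assoc k l a) (∙-assoc k l x)

∙-distribˡ-⊕ : ∀ {n} k (x y : Vec ℤ n) → k ∙ (x ⊕ y) ≡ k ∙ x ⊕ k ∙ y
∙-distribˡ-⊕ k []      []      = refl
∙-distribˡ-⊕ k (a ∷ x) (b ∷ y) = cong₂ _∷_ (ℤ.*-distribˡ-+ k a b) (∙-distribˡ-⊕ k x y)

∙-distribʳ-⊕ : ∀ {n} k l (x : Vec ℤ n) → (k ℤ.+ l) ∙ x ≡ k ∙ x ⊕ l ∙ x
∙-distribʳ-⊕ k l []      = refl
∙-distribʳ-⊕ k l (a ∷ x) = cong₂ _∷_ (ℤ.*-distribʳ-+ a k l) (∙-distribʳ-⊕ k l x)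

⊖-inverse : ∀ {n} (x : Vec ℤ n) → x ⊖ x ≡ 𝟘
⊖-inverse []      = refl
⊖-inverse (a ∷ x) = cong₂ _∷_ (lemma a) (⊖-inverse x)
  where
  lemma : ∀ a → a ℤ.+ -1ℤ ℤ.* a ≡ 0ℤ
  lemma = solve-∀

_≟ⱽ_ : ∀ {n} (x y : Vec ℤ n) → Dec (x ≡ y)
_≟ⱽ_ = Vec.≡-dec ℤ._≟_

record IsLinear {m n} (f : Vec ℤ m → Vec ℤ n) : Set where
  field
    +-homo : ∀ x y → f (x ⊕ y) ≡ f x ⊕ f y
    *-homo : ∀ k x → f (k ∙ x) ≡ k ∙ f x

  0-homo : f 𝟘 ≡ 𝟘
  0-homo = begin
    f 𝟘         ≡⟨ cong f (∙-zeroˡ 𝟘) ⟨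
    f (0ℤ ∙ 𝟘)  ≡⟨ *-homo 0ℤ 𝟘 ⟩
    0ℤ ∙ f 𝟘    ≡⟨ ∙-zeroˡ (f 𝟘) ⟩
    𝟘           ∎
    where open ≡-Reasoning

  ⊖-homo : ∀ x y → f (x ⊖ y) ≡ f x ⊖ f y
  ⊖-homo x y = trans (+-homo x (-1ℤ ∙ y)) (cong (f x ⊕_) (*-homo -1ℤ y))

open IsLinear

id-linear : ∀ {n} → IsLinear {n} id
id-linear = record { +-homo = λ _ _ → refl ; *-homo = λ _ _ → refl }

infixr 9 _∘ˡ_

_∘ˡ_ : ∀ {l m n} {f : Vec ℤ m → Vec ℤ n} {g : Vec ℤ l → Vec ℤ m} →
  IsLinear f → IsLinear g → IsLinear (f ∘ g)
_∘ˡ_ {f = f} {g} F G = record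
  { +-homo = λ x y → trans (cong f (+-homo G x y)) (+-homo F (g x) (g y))
  ; *-homo = λ k x → trans (cong f (*-homo G k x)) (*-homo F k (g x))
  }

𝟘-linear : ∀ {m n} → IsLinear {m} {n} (λ _ → 𝟘)
𝟘-linear = record { +-homo = λ _ _ → sym (⊕-identityˡ 𝟘) ; *-homo = λ k _ → sym (∙-zeroʳ k) }

tail-linear : ∀ {n} → IsLinear {suc n} tail
tail-linear = record
  { +-homo = λ { (_ ∷ _) (_ ∷ _) → refl }
  ; *-homo = λ { _ (_ ∷ _) → refl }
  }

pad : ∀ {n} → Vec ℤ n → Vec ℤ (suc n)
pad x = 0ℤ ∷ x

pad-linear : ∀ {n} → IsLinear {n} pad
pad-linear = record
  { +-homo = λ _ _ → refl
  ; *-homo = λ k x → cong (_∷ k ∙ x) (sym (ℤ.*-zeroʳ k))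
  }

e₀ : ∀ {n} → Vec ℤ (suc n)
e₀ = 1ℤ ∷ 𝟘

∷-split : ∀ {n} a (x : Vec ℤ n) → a ∷ x ≡ a ∙ e₀ ⊕ pad x
∷-split a x = cong₂ _∷_ (lemma a) (sym (trans (cong (_⊕ x) (∙-zeroʳ a)) (⊕-identityˡ x)))
  where
  lemma : ∀ a → a ≡ a ℤ.* 1ℤ ℤ.+ 0ℤ
  lemma = solve-∀

linear-∷ : ∀ {m n} {f : Vec ℤ (suc m) → Vec ℤ n} → IsLinear f →
  ∀ a x → f (a ∷ x) ≡ a ∙ f e₀ ⊕ f (pad x)
linear-∷ {f = f} F a x = trans (cong f (∷-split a x))
  (trans (+-homo F (a ∙ e₀) (pad x)) (cong (_⊕ f (pad x)) (*-homo F a e₀)))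

private
  pivotal : ∀ {n} c → c ≢ 0ℤ → (h : Vec ℤ (suc n) → Vec ℤ 1) → IsLinear h → h e₀ ≡ c ∷ [] →
    ∃[ ι ] IsLinear {n} {suc n} ι × (∀ y → ι y ≡ 𝟘 → y ≡ 𝟘) × (∀ y → h (ι y) ≡ 𝟘)
  pivotal {n} c c≢0 h H he₀ = ι , ι-linear , (λ y e → cancel y (cong tail e)) , h∘ι
    where
    h₁ = h ∘ pad
    H₁ = H ∘ˡ pad-linear
    -- The pivot `c` cannot be divided by over ℤ, so `y` is multiplied by it instead. The result is
    -- injective, though its image may be smaller than the kernel.
    ι : Vec ℤ n → Vec ℤ (suc n)
    ι y = ℤ.- head (h₁ y) ∷ c ∙ y
    ι-linear : IsLinear ι
    ι-linear = record
      { +-homo = λ x y → cong₂ _∷_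
          (trans (cong (ℤ.-_ ∘ head) (+-homo H₁ x y)) (neg-+ (h₁ x) (h₁ y))) (∙-distribˡ-⊕ c x y)
      ; *-homo = λ k x → cong₂ _∷_
          (trans (cong (ℤ.-_ ∘ head) (*-homo H₁ k x)) (neg-* k (h₁ x)))
          (trans (sym (∙-assoc c k x)) (trans (cong (_∙ x) (ℤ.*-comm c k)) (∙-assoc k c x)))
      }
      where
      neg-+ : ∀ (u w : Vec ℤ 1) → ℤ.- head (u ⊕ w) ≡ ℤ.- head u ℤ.+ ℤ.- head w
      neg-+ (a ∷ []) (b ∷ []) = ℤ.neg-distrib-+ a b
      neg-* : ∀ k (u : Vec ℤ 1) → ℤ.- head (k ∙ u) ≡ k ℤ.* ℤ.- head u
      neg-* k (a ∷ []) = ℤ.neg-distribʳ-* k a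
    cancel : ∀ {m} (y : Vec ℤ m) → c ∙ y ≡ 𝟘 → y ≡ 𝟘
    cancel []      _ = refl
    cancel (a ∷ y) e = cong₂ _∷_
      (ℤ.*-cancelˡ-≡ c a 0ℤ {{ℤ.≢-nonZero c≢0}} (trans (cong head e) (sym (ℤ.*-zeroʳ c))))
      (cancel y (cong tail e))
    h∘ι : ∀ y → h (ι y) ≡ 𝟘
    h∘ι y = trans (linear-∷ H _ (c ∙ y))
      (trans (cong₂ _⊕_ (cong (ℤ.- head (h₁ y) ∙_) he₀) (*-homo H₁ c y)) (swap (h₁ y)))
      where
      comm : ∀ a c → ℤ.- a ℤ.* c ℤ.+ c ℤ.* a ≡ 0ℤ
      comm = solve-∀
      swap : ∀ (u : Vec ℤ 1) → ℤ.- head u ∙ (c ∷ []) ⊕ c ∙ u ≡ 𝟘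
      swap (a ∷ []) = cong (_∷ []) (comm a c)

-- A nonzero `h e₀` serves as pivot. If it is 0, then `e₀` itself lies in the kernel: its coordinate
-- stays free and the search for a pivot goes on among the others.
kernel-embedding : ∀ {n} (h : Vec ℤ (suc n) → Vec ℤ 1) → IsLinear h →
  ∃[ ι ] IsLinear {n} {suc n} ι × (∀ y → ι y ≡ 𝟘 → y ≡ 𝟘) × (∀ y → h (ι y) ≡ 𝟘)
kernel-embedding {zero}  h H =
  (λ _ → 𝟘) , 𝟘-linear , (λ { [] _ → refl }) , λ _ → 0-homo H
kernel-embedding {suc n} h H with h e₀ in he₀
... | c ∷ [] with c ℤ.≟ 0ℤ
...   | no  c≢0  = pivotal c c≢0 h H he₀
...   | yes refl = ι , ι-linear , ι-injective , h∘ι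
  where
  rec = kernel-embedding (h ∘ pad) (H ∘ˡ pad-linear)
  ι′ = proj₁ rec
  ι′-linear = proj₁ (proj₂ rec)
  ι : Vec ℤ (suc n) → Vec ℤ (suc (suc n))
  ι (a ∷ y) = a ∷ ι′ y
  ι-linear : IsLinear ι
  ι-linear = record
    { +-homo = λ { (a ∷ x) (b ∷ y) → cong (a ℤ.+ b ∷_) (+-homo ι′-linear x y) }
    ; *-homo = λ { k (a ∷ x) → cong (k ℤ.* a ∷_) (*-homo ι′-linear k x) }
    }
  ι-injective : ∀ y → ι y ≡ 𝟘 → y ≡ 𝟘
  ι-injective (a ∷ y) e =
    cong₂ _∷_ (cong head e) (proj₁ (proj₂ (proj₂ rec)) y (cong tail e))
  h∘ι : ∀ y → h (ι y) ≡ 𝟘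
  h∘ι (a ∷ y) = trans (linear-∷ H a (ι′ y))
    (cong₂ _⊕_ (trans (cong (a ∙_) he₀) (∙-zeroʳ a)) (proj₂ (proj₂ (proj₂ rec)) y))

head-linear : ∀ {n} → IsLinear {suc n} {1} (λ x → head x ∷ [])
head-linear = record
  { +-homo = λ { (_ ∷ _) (_ ∷ _) → refl }
  ; *-homo = λ { _ (_ ∷ _) → refl }
  }

e₀≢𝟘 : ∀ {n} → e₀ {n} ≢ 𝟘
e₀≢𝟘 ()

-- Each recursive call makes one output coordinate vanish at the cost of one variable, so a variable
-- is left when the outputs are exhausted.
kernel-nontrivial : ∀ {m k} → m < k → (f : Vec ℤ k → Vec ℤ m) → IsLinear f →
  ∃[ y ] y ≢ 𝟘 × f y ≡ 𝟘
kernel-nontrivial {zero}  {suc k} _   f F = e₀ , e₀≢𝟘 , []-unique (f e₀)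
  where
  []-unique : (x : Vec ℤ 0) → x ≡ 𝟘
  []-unique [] = refl
kernel-nontrivial {suc m} {suc k} m<k f F =
  let (ι , ι-linear , ι-injective , head∘f∘ι) =
        kernel-embedding (λ x → head (f x) ∷ []) (head-linear ∘ˡ F)
      (y , y≢𝟘 , e) = kernel-nontrivial (s≤s⁻¹ m<k) (tail ∘ f ∘ ι) (tail-linear ∘ˡ F ∘ˡ ι-linear)
  in ι y , (λ ιy≡𝟘 → y≢𝟘 (ι-injective y ιy≡𝟘)) , ∷-𝟘 (f (ι y)) (cong head (head∘f∘ι y)) e
  where
  ∷-𝟘 : ∀ {n} (x : Vec ℤ (suc n)) → head x ≡ 0ℤ → tail x ≡ 𝟘 → x ≡ 𝟘
  ∷-𝟘 (a ∷ x) = cong₂ _∷_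

-- Unimodular changes of coordinates

record Automorphism (n : ℕ) : Set where
  field
    to          : Vec ℤ n → Vec ℤ n
    from        : Vec ℤ n → Vec ℤ n
    to-linear   : IsLinear to
    from-linear : IsLinear from
    to∘from     : ∀ x → to (from x) ≡ x
    from∘to     : ∀ x → from (to x) ≡ x

open Automorphism

-- Phrased through the cofactors `a`, `b` and not as g = sx + ty: `identity` is then the determinant
-- of a unimodular matrix, and it makes sense for x = y = 0 as well.
record Bézout (x y : ℤ) : Set where
  field
    g a b s t : ℤ
    x≡        : x ≡ g ℤ.* a
    y≡        : y ≡ g ℤ.* b
    identity  : s ℤ.* a ℤ.+ t ℤ.* b ≡ 1ℤ

bézout : ∀ x y → Bézout x y
bézout x y = go x y (<-wellFounded ∣ y ∣)
  where
  open Bézout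
  go : ∀ x y → Acc _<_ ∣ y ∣ → Bézout x y
  go x y (acc rs) with y ℤ.≟ 0ℤ
  ... | yes refl = record
    { g = x ; a = 1ℤ ; b = 0ℤ ; s = 1ℤ ; t = 0ℤ
    ; x≡ = sym (ℤ.*-identityʳ x) ; y≡ = sym (ℤ.*-zeroʳ x) ; identity = refl
    }
  ... | no y≢0 = record
    { g = g B ; a = b B ℤ.+ q ℤ.* a B ; b = a B ; s = t B ; t = s B ℤ.- t B ℤ.* q
    ; x≡ = trans (ℤ.a≡a%n+[a/n]*n x y)
        (trans (cong₂ (λ u w → u ℤ.+ q ℤ.* w) (y≡ B) (x≡ B)) (factor (g B) (b B) q (a B)))
    ; y≡ = x≡ B
    ; identity = trans (rearrange (t B) (b B) q (a B) (s B)) (identity B)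
    }
    where
    instance _ = ℤ.≢-nonZero y≢0
    q = x ℤ./ y
    B = go y (+ (x ℤ.% y)) (rs (ℤ.n%d<d x y))
    factor : ∀ g b q a → g ℤ.* b ℤ.+ q ℤ.* (g ℤ.* a) ≡ g ℤ.* (b ℤ.+ q ℤ.* a)
    factor = solve-∀
    rearrange : ∀ t b q a s →
      t ℤ.* (b ℤ.+ q ℤ.* a) ℤ.+ (s ℤ.- t ℤ.* q) ℤ.* a ≡ s ℤ.* a ℤ.+ t ℤ.* b
    rearrange = solve-∀

-- The matrix with rows (s, t) and (-b, a) has determinant 1 and sends (ga, gb) to (g, 0).
rotate : ∀ {n} (a b s t : ℤ) → s ℤ.* a ℤ.+ t ℤ.* b ≡ 1ℤ → Automorphism (suc (suc n))
rotate {n} a b s t identity = record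
  { to          = act s t (ℤ.- b) a
  ; from        = act a (ℤ.- t) b s
  ; to-linear   = act-linear s t (ℤ.- b) a
  ; from-linear = act-linear a (ℤ.- t) b s
  ; to∘from     = λ { (x ∷ y ∷ z) →
      cong₂ (λ u w → u ∷ w ∷ z) (scale-1 (r₁ a b s t x y)) (scale-1 (r₂ a b s t x y)) }
  ; from∘to     = λ { (x ∷ y ∷ z) →
      cong₂ (λ u w → u ∷ w ∷ z) (scale-1 (r₃ a b s t x y)) (scale-1 (r₄ a b s t x y)) }
  }
  where
  act : (p q r s : ℤ) → Vec ℤ (suc (suc n)) → Vec ℤ (suc (suc n))
  act p q r s (x ∷ y ∷ z) = p ℤ.* x ℤ.+ q ℤ.* y ∷ r ℤ.* x ℤ.+ s ℤ.* y ∷ z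
  act-linear : ∀ p q r s → IsLinear (act p q r s)
  act-linear p q r s = record
    { +-homo = λ { (x ∷ y ∷ z) (x′ ∷ y′ ∷ z′) →
        cong₂ (λ u w → u ∷ w ∷ z ⊕ z′) (add p q x y x′ y′) (add r s x y x′ y′) }
    ; *-homo = λ { k (x ∷ y ∷ z) → cong₂ (λ u w → u ∷ w ∷ k ∙ z) (mul p q k x y) (mul r s k x y) }
    }
    where
    add : ∀ p q x y x′ y′ →
      p ℤ.* (x ℤ.+ x′) ℤ.+ q ℤ.* (y ℤ.+ y′) ≡ (p ℤ.* x ℤ.+ q ℤ.* y) ℤ.+ (p ℤ.* x′ ℤ.+ q ℤ.* y′)
    add = solve-∀
    mul : ∀ p q k x y → p ℤ.* (k ℤ.* x) ℤ.+ q ℤ.* (k ℤ.* y) ≡ k ℤ.* (p ℤ.* x ℤ.+ q ℤ.* y)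
    mul = solve-∀
  scale-1 : ∀ {u x} → u ≡ (s ℤ.* a ℤ.+ t ℤ.* b) ℤ.* x → u ≡ x
  scale-1 {x = x} e = trans e (trans (cong (ℤ._* x) identity) (ℤ.*-identityˡ x))
  r₁ : ∀ a b s t x y → s ℤ.* (a ℤ.* x ℤ.+ ℤ.- t ℤ.* y) ℤ.+ t ℤ.* (b ℤ.* x ℤ.+ s ℤ.* y) ≡
    (s ℤ.* a ℤ.+ t ℤ.* b) ℤ.* x
  r₁ = solve-∀
  r₂ : ∀ a b s t x y → ℤ.- b ℤ.* (a ℤ.* x ℤ.+ ℤ.- t ℤ.* y) ℤ.+ a ℤ.* (b ℤ.* x ℤ.+ s ℤ.* y) ≡
    (s ℤ.* a ℤ.+ t ℤ.* b) ℤ.* y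
  r₂ = solve-∀
  r₃ : ∀ a b s t x y → a ℤ.* (s ℤ.* x ℤ.+ t ℤ.* y) ℤ.+ ℤ.- t ℤ.* (ℤ.- b ℤ.* x ℤ.+ a ℤ.* y) ≡
    (s ℤ.* a ℤ.+ t ℤ.* b) ℤ.* x
  r₃ = solve-∀
  r₄ : ∀ a b s t x y → b ℤ.* (s ℤ.* x ℤ.+ t ℤ.* y) ℤ.+ s ℤ.* (ℤ.- b ℤ.* x ℤ.+ a ℤ.* y) ≡
    (s ℤ.* a ℤ.+ t ℤ.* b) ℤ.* y
  r₄ = solve-∀

keep-head : ∀ {n} → (Vec ℤ n → Vec ℤ n) → Vec ℤ (suc n) → Vec ℤ (suc n)
keep-head f (x ∷ y) = x ∷ f y

keep-head-linear : ∀ {n} {f : Vec ℤ n → Vec ℤ n} → IsLinear f → IsLinear (keep-head f)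
keep-head-linear F = record
  { +-homo = λ { (a ∷ x) (b ∷ y) → cong (a ℤ.+ b ∷_) (+-homo F x y) }
  ; *-homo = λ { k (a ∷ x) → cong (k ℤ.* a ∷_) (*-homo F k x) }
  }

fix-head : ∀ {n} → Automorphism n → Automorphism (suc n)
fix-head β = record
  { to          = keep-head (to β)
  ; from        = keep-head (from β)
  ; to-linear   = keep-head-linear (to-linear β)
  ; from-linear = keep-head-linear (from-linear β)
  ; to∘from     = λ { (x ∷ y) → cong (x ∷_) (to∘from β y) }
  ; from∘to     = λ { (x ∷ y) → cong (x ∷_) (from∘to β y) }
  }

infixr 9 _∘ᵃ_

_∘ᵃ_ : ∀ {n} → Automorphism n → Automorphism n → Automorphism n
β ∘ᵃ γ = record
  { to          = to β ∘ to γ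
  ; from        = from γ ∘ from β
  ; to-linear   = to-linear β ∘ˡ to-linear γ
  ; from-linear = from-linear γ ∘ˡ from-linear β
  ; to∘from     = λ x → trans (cong (to β) (to∘from γ (from β x))) (to∘from β x)
  ; from∘to     = λ x → trans (cong (from γ) (from∘to β (to γ x))) (from∘to γ x)
  }

id-automorphism : ∀ {n} → Automorphism n
id-automorphism = record
  { to = id ; from = id ; to-linear = id-linear ; from-linear = id-linear
  ; to∘from = λ _ → refl ; from∘to = λ _ → refl
  }

-- Integral elimination from the last coordinate upwards. For nonzero `y`, dropping the first
-- coordinate after `β` is the quotient by the saturation of ℤy.
straighten : ∀ {n} (y : Vec ℤ (suc n)) → ∃[ β ] ∃[ g ] to {suc n} β y ≡ g ∷ 𝟘
straighten {zero}  (g ∷ [])  = id-automorphism , g , refl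
straighten {suc n} (y₀ ∷ y) =
  let (β , g′ , e) = straighten y
      B = bézout y₀ g′
      open Bézout B
      ρ = rotate a b s t identity
  in ρ ∘ᵃ fix-head β , g , trans (cong (λ z → to ρ (y₀ ∷ z)) e)
       (cong₂ (λ u w → u ∷ w ∷ 𝟘)
         (trans (cong₂ (λ u w → s ℤ.* u ℤ.+ t ℤ.* w) x≡ y≡)
           (trans (factor g a b s t) (trans (cong (g ℤ.*_) identity) (ℤ.*-identityʳ g))))
         (trans (cong₂ (λ u w → ℤ.- b ℤ.* u ℤ.+ a ℤ.* w) x≡ y≡) (cancel g a b)))
  where
  factor : ∀ g a b s t → s ℤ.* (g ℤ.* a) ℤ.+ t ℤ.* (g ℤ.* b) ≡ g ℤ.* (s ℤ.* a ℤ.+ t ℤ.* b)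
  factor = solve-∀
  cancel : ∀ g a b → ℤ.- b ℤ.* (g ℤ.* a) ℤ.+ a ℤ.* (g ℤ.* b) ≡ 0ℤ
  cancel = solve-∀

-- Successive minima

norm : ∀ {n} → Vec ℤ n → ℕ
norm []      = 0
norm (a ∷ x) = ∣ a ∣ ⊔ norm x

norm≡0 : ∀ {n} (x : Vec ℤ n) → norm x ≡ 0 → x ≡ 𝟘
norm≡0 []      _ = refl
norm≡0 (a ∷ x) e = cong₂ _∷_
  (ℤ.∣i∣≡0⇒i≡0 (ℕ.n≤0⇒n≡0 (ℕ.≤-trans (ℕ.m≤m⊔n _ _) (ℕ.≤-reflexive e))))
  (norm≡0 x (ℕ.n≤0⇒n≡0 (ℕ.≤-trans (ℕ.m≤n⊔m _ _) (ℕ.≤-reflexive e))))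

any-in-interval? : ∀ k {P : ℤ → Set} → Decidable P → Dec (∃[ z ] ∣ z ∣ ≤ k × P z)
any-in-interval? k {P} P? = map′
  (λ { (i , i≤k , inj₁ p) → + i , s≤s⁻¹ i≤k , p
     ; (i , i≤k , inj₂ p) → ℤ.- + i , ℕ.≤-trans (ℕ.≤-reflexive (ℤ.∣-i∣≡∣i∣ (+ i))) (s≤s⁻¹ i≤k) , p })
  (λ { (+ i , i≤k , p) → i , s≤s i≤k , inj₁ p
     ; (ℤ.-[1+ i ] , i≤k , p) → suc i , s≤s i≤k , inj₂ p })
  (ℕ.anyUpTo? (λ i → P? (+ i) ⊎-dec P? (ℤ.- + i)) (suc k))

any-in-ball? : ∀ {n} k {P : Vec ℤ n → Set} → Decidable P → Dec (∃[ x ] norm x ≤ k × P x)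
any-in-ball? {zero}  k P? = map′ (λ p → [] , z≤n , p) (λ { ([] , _ , p) → p }) (P? [])
any-in-ball? {suc n} k P? = map′
  (λ { (a , a≤k , x , x≤k , p) → a ∷ x , ℕ.⊔-lub a≤k x≤k , p })
  (λ { (a ∷ x , ≤k , p) →
         a , ℕ.m⊔n≤o⇒m≤o _ _ ≤k , x , ℕ.m⊔n≤o⇒n≤o _ _ ≤k , p })
  (any-in-interval? k (λ a → any-in-ball? k (P? ∘ (a ∷_))))

-- Balls of the sup norm are finite, so an improvement can be searched for, and each one lowers the
-- norm.
shortest : ∀ {n} {P : Vec ℤ n → Set} → Decidable P → ∃ P →
  ∃[ x ] P x × (∀ y → norm y < norm x → ¬ P y)
shortest {n} {P} P? (x , p) = go x p (<-wellFounded (norm x))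
  where
  go : ∀ x → P x → Acc _<_ (norm x) → ∃[ x ] P x × (∀ y → norm y < norm x → ¬ P y)
  go x p (acc rs) with norm x in eq
  ... | zero = x , p , λ y y<x _ → contradiction (ℕ.≤-trans y<x (ℕ.≤-reflexive eq)) λ ()
  ... | suc k with any-in-ball? k P?
  ...   | yes (y , y≤k , q) = go y q (rs (s≤s y≤k))
  ...   | no  none = x , p , λ y y<x q →
            none (y , s≤s⁻¹ (ℕ.≤-trans y<x (ℕ.≤-reflexive eq)) , q)

module _ {n : ℕ} (φ : Vec ℤ n → Vec ℤ 1) where

  projection : ∀ {r} → Automorphism (suc (suc r)) → (Vec ℤ n → Vec ℤ (suc (suc r))) →
    Vec ℤ n → Vec ℤ (suc r)
  projection β τ x = tail (to β (τ x))

  -- A flag of successive minima of ker φ: τ is the projection from ℤⁿ to its quotient by the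
  -- (saturated) span of the minima found so far, and s is the norm of the last one.
  data Flag : (r : ℕ) → (Vec ℤ n → Vec ℤ (suc r)) → ℕ → Set where
    last : ∀ {τ s} → (∀ η → φ η ≡ 𝟘 → τ η ≡ 𝟘) → Flag 0 τ s
    step : ∀ {r τ s} (x : Vec ℤ n) → s ≤ norm x → φ x ≡ 𝟘 →
      (∀ η → φ η ≡ 𝟘 → norm η < norm x → τ η ≡ 𝟘) →
      (β : Automorphism (suc (suc r))) (g : ℤ) → g ≢ 0ℤ → to β (τ x) ≡ g ∷ 𝟘 →
      Flag r (projection β τ) (norm x) → Flag (suc r) τ s

  -- The invariant: `φ` factors through `τ` as a nonzero `ψ`, and `τ` has the section `σ`. As long
  -- as two coordinates are left, `ψ` has a nonzero kernel vector, and `σ` lifts it to a vector of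
  -- ker φ that `τ` does not kill, so a next minimum exists. With one coordinate left, `ψ` is
  -- injective, so `τ` kills ker φ.
  flag : ∀ {r} τ s (ψ : Vec ℤ (suc r) → Vec ℤ 1) (σ : Vec ℤ (suc r) → Vec ℤ n) →
    IsLinear τ → IsLinear ψ → (∀ x → φ x ≡ ψ (τ x)) → (∀ y → τ (σ y) ≡ y) →
    (∃[ y ] ψ y ≢ 𝟘) → (∀ η → φ η ≡ 𝟘 → norm η < s → τ η ≡ 𝟘) → Flag r τ s
  flag {zero} τ s ψ σ T Ψ φ≡ τσ (y₀ , ψy₀≢0) _ = last λ η φη →
    kill (τ η) (trans (sym (φ≡ η)) φη)
    where
    homothety : ∀ a → ψ (a ∷ []) ≡ a ∙ ψ e₀
    homothety a = trans (cong (λ b → ψ (b ∷ [])) (sym (ℤ.*-identityʳ a))) (*-homo Ψ a e₀)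
    kill : ∀ y → ψ y ≡ 𝟘 → y ≡ 𝟘
    kill (a ∷ []) ψy≡0 with ψ e₀ in ψe₀ | homothety a
    ... | b ∷ [] | ψa with ℤ.i*j≡0⇒i≡0∨j≡0 a (cong head (trans (sym ψa) ψy≡0))
    ...   | inj₁ a≡0 = cong (_∷ []) a≡0
    ...   | inj₂ refl = contradiction (all-zero y₀) ψy₀≢0
      where
      all-zero : ∀ y → ψ y ≡ 𝟘
      all-zero (c ∷ []) = trans (homothety c) (trans (cong (c ∙_) ψe₀) (∙-zeroʳ c))
  flag {suc r} τ s ψ σ T Ψ φ≡ τσ ψ≢0 s-min =
    let (y , y≢0 , ψy≡0) = kernel-nontrivial (s≤s (s≤s z≤n)) ψ Ψ
        (x , (φx≡0 , τx≢0) , x-min) = shortest (λ x → (φ x ≟ⱽ 𝟘) ×-dec ¬? (τ x ≟ⱽ 𝟘))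
          (σ y , trans (φ≡ (σ y)) (trans (cong ψ (τσ y)) ψy≡0) , λ e → y≢0 (trans (sym (τσ y)) e))
        (β , g , βτx) = straighten (τ x)
    in extend x φx≡0 τx≢0
         (λ η φη η<x → decidable-stable (τ η ≟ⱽ 𝟘) λ τη≢0 → x-min η η<x (φη , τη≢0)) β g βτx
    where
    extend : ∀ x → φ x ≡ 𝟘 → τ x ≢ 𝟘 → (∀ η → φ η ≡ 𝟘 → norm η < norm x → τ η ≡ 𝟘) →
      ∀ β g → to β (τ x) ≡ g ∷ 𝟘 → Flag (suc r) τ s
    extend x φx≡0 τx≢0 x-min β g βτx =
      -- The minima do not decrease: vectors of ker φ of norm below `s` are killed by `τ`, and `x`
      -- is not.
      step x (ℕ.≮⇒≥ λ x<s → τx≢0 (s-min x φx≡0 x<s)) φx≡0 x-min β g g≢0 βτx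
        (flag (projection β τ) (norm x) (ψ₁ ∘ pad) (σ ∘ from β ∘ pad)
          (tail-linear ∘ˡ to-linear β ∘ˡ T) (Ψ₁ ∘ˡ pad-linear)
          φ≡′ (λ z → cong tail (trans (cong (to β) (τσ _)) (to∘from β (pad z))))
          (tail (to β (proj₁ ψ≢0)) , λ e → proj₂ ψ≢0
             (trans (sym (cong ψ (from∘to β (proj₁ ψ≢0)))) (trans (ψ₁-pad (to β (proj₁ ψ≢0))) e)))
          (λ η φη η<x → trans (cong (tail ∘ to β) (x-min η φη η<x)) (cong tail (0-homo (to-linear β)))))
      where
      ψ₁ = ψ ∘ from β
      Ψ₁ = Ψ ∘ˡ from-linear β
      g≢0 : g ≢ 0ℤ
      g≢0 refl = τx≢0 (trans (sym (from∘to β (τ x)))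
        (trans (cong (from β) βτx) (0-homo (from-linear β))))
      -- In the new coordinates `x` becomes g e₀, and φ x = 0 with g ≠ 0. So `ψ₁` ignores the
      -- coordinate that is dropped, and `φ` still factors through the new projection.
      ψ₁e₀ : ψ₁ e₀ ≡ 𝟘
      ψ₁e₀ = cancel (ψ₁ e₀) (begin
        g ∙ ψ₁ e₀          ≡⟨ *-homo Ψ₁ g e₀ ⟨
        ψ₁ (g ∙ e₀)        ≡⟨ cong ψ₁ (cong₂ _∷_ (ℤ.*-identityʳ g) (∙-zeroʳ g)) ⟩
        ψ₁ (g ∷ 𝟘)         ≡⟨ cong ψ₁ βτx ⟨
        ψ₁ (to β (τ x))    ≡⟨ cong ψ (from∘to β (τ x)) ⟩
        ψ (τ x)            ≡⟨ φ≡ x ⟨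
        φ x                ≡⟨ φx≡0 ⟩
        𝟘                  ∎)
        where
        open ≡-Reasoning
        cancel : ∀ (u : Vec ℤ 1) → g ∙ u ≡ 𝟘 → u ≡ 𝟘
        cancel (a ∷ []) e with ℤ.i*j≡0⇒i≡0∨j≡0 g (cong head e)
        ... | inj₁ g≡0 = contradiction g≡0 g≢0
        ... | inj₂ a≡0 = cong (_∷ []) a≡0
      ψ₁-pad : ∀ y → ψ₁ y ≡ ψ₁ (pad (tail y))
      ψ₁-pad (a ∷ y) = trans (linear-∷ Ψ₁ a y)
        (trans (cong (_⊕ ψ₁ (pad y)) (trans (cong (a ∙_) ψ₁e₀) (∙-zeroʳ a))) (⊕-identityˡ _))
      φ≡′ : ∀ x → φ x ≡ ψ₁ (pad (tail (to β (τ x))))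
      φ≡′ x = trans (φ≡ x) (trans (sym (cong ψ (from∘to β (τ x)))) (ψ₁-pad (to β (τ x))))

  minima : ∀ {r τ s} → Flag r τ s → Vec (Vec ℤ n) r
  minima (last _)                   = []
  minima (step x _ _ _ _ _ _ _ F)   = x ∷ minima F

combination : ∀ {n r} → Vec ℤ r → Vec (Vec ℤ n) r → Vec ℤ n
combination []      []       = 𝟘
combination (k ∷ c) (x ∷ xs) = k ∙ x ⊕ combination c xs

module _ {n : ℕ} (φ : Vec ℤ n → Vec ℤ 1) where

  -- The next projection kills `x`, so the later coefficients vanish by induction; the first
  -- coordinate then reads k g = 0.
  minima-independent : ∀ {r τ s} (F : Flag φ r τ s) → IsLinear τ →
    ∀ c → τ (combination c (minima φ F)) ≡ 𝟘 → c ≡ 𝟘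
  minima-independent (last _) T [] _ = refl
  minima-independent {τ = τ} (step x _ _ _ β g g≢0 βτx F) T (k ∷ c) e = cong₂ _∷_ k≡0 c≡0
    where
    L = to-linear β ∘ˡ T
    y = combination c (minima φ F)
    split : k ∙ (g ∷ 𝟘) ⊕ to β (τ y) ≡ 𝟘
    split = begin
      k ∙ (g ∷ 𝟘) ⊕ to β (τ y)     ≡⟨ cong (λ u → k ∙ u ⊕ to β (τ y)) βτx ⟨
      k ∙ to β (τ x) ⊕ to β (τ y)  ≡⟨ cong (_⊕ to β (τ y)) (*-homo L k x) ⟨
      to β (τ (k ∙ x)) ⊕ to β (τ y) ≡⟨ +-homo L (k ∙ x) y ⟨
      to β (τ (k ∙ x ⊕ y))         ≡⟨ cong (to β) e ⟩
      to β 𝟘                       ≡⟨ 0-homo (to-linear β) ⟩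
      𝟘                            ∎
      where open ≡-Reasoning
    tail-part : ∀ {m} (w : Vec ℤ (suc m)) → k ∙ (g ∷ 𝟘) ⊕ w ≡ 𝟘 → tail w ≡ 𝟘
    tail-part (a ∷ w) e = trans (sym (⊕-identityˡ w))
      (trans (cong (_⊕ w) (sym (∙-zeroʳ k))) (cong tail e))
    c≡0 : c ≡ 𝟘
    c≡0 = minima-independent F (tail-linear ∘ˡ L) c (tail-part (to β (τ y)) split)
    comb-0 : ∀ {m} (xs : Vec (Vec ℤ n) m) → combination 𝟘 xs ≡ 𝟘
    comb-0 []       = refl
    comb-0 (x ∷ xs) = trans (cong₂ _⊕_ (∙-zeroˡ x) (comb-0 xs)) (⊕-identityˡ 𝟘)
    βτy≡0 : to β (τ y) ≡ 𝟘
    βτy≡0 = trans (cong (λ u → to β (τ (combination u (minima φ F)))) c≡0)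
      (trans (cong (to β ∘ τ) (comb-0 (minima φ F))) (0-homo L))
    k≡0 : k ≡ 0ℤ
    k≡0 with ℤ.i*j≡0⇒i≡0∨j≡0 k (trans (sym (ℤ.+-identityʳ (k ℤ.* g)))
          (cong head (trans (cong (k ∙ (g ∷ 𝟘) ⊕_) (sym βτy≡0)) split)))
    ... | inj₁ k≡0 = k≡0
    ... | inj₂ g≡0 = contradiction g≡0 g≢0

-- Counting modulo K Λ

module ℤ+ = AbelianGroup ℤ.+-0-abelianGroup

digits : ∀ n {k} → Fin (k ^ n) → Vec (Fin k) n
digits zero        _ = []
digits (suc n) {k} q = proj₁ (remQuot (k ^ n) q) ∷ digits n (proj₂ (remQuot {k} (k ^ n) q))

number : ∀ {n k} → Vec (Fin k) n → Fin (k ^ n)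
number []       = zero
number (i ∷ is) = combine i (number is)

remQuot-injective : ∀ m {n} {i j : Fin (m * n)} → remQuot {m} n i ≡ remQuot n j → i ≡ j
remQuot-injective m {n} {i} {j} e = trans (sym (Fin.combine-remQuot {m} n i))
  (trans (cong (λ p → combine (proj₁ p) (proj₂ p)) e) (Fin.combine-remQuot {m} n j))

digits-injective : ∀ n {k} {p q : Fin (k ^ n)} → digits n p ≡ digits n q → p ≡ q
digits-injective zero {p = zero} {zero} _ = refl
digits-injective (suc n) {k} e = remQuot-injective k
  (cong₂ _,_ (cong head e) (digits-injective n (cong tail e)))

number-injective : ∀ {n k} (x y : Vec (Fin k) n) → number x ≡ number y → x ≡ y
number-injective []       []       _ = refl
number-injective (i ∷ is) (j ∷ js) e =
  let (i≡j , is≡js) = Fin.combine-injective i (number is) j (number js) e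
  in cong₂ _∷_ i≡j (number-injective is js is≡js)

map-injective : ∀ {A B : Set} {f : A → B} → (∀ {x y} → f x ≡ f y → x ≡ y) →
  ∀ {n} {xs ys : Vec A n} → map f xs ≡ map f ys → xs ≡ ys
map-injective f-inj {xs = []}     {[]}     _ = refl
map-injective f-inj {xs = _ ∷ _} {_ ∷ _} e =
  cong₂ _∷_ (f-inj (cong head e)) (map-injective f-inj (cong tail e))

bounded : ∀ {m} (f : Fin m → ℕ) → ∃[ C ] ∀ i → f i ≤ C
bounded {zero}  f = 0 , λ ()
bounded {suc m} f =
  let (C , f≤C) = bounded (f ∘ suc)
  in f zero ⊔ C , λ { zero → ℕ.m≤m⊔n _ _ ; (suc i) → ℕ.≤-trans (f≤C i) (ℕ.m≤n⊔m _ _) }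

digit-unique : ∀ {m} (i j : Fin m) a b →
  + m ℤ.* a ℤ.+ + toℕ i ≡ + m ℤ.* b ℤ.+ + toℕ j → a ≡ b × i ≡ j
digit-unique {m} i j a b e = a≡b , Fin.toℕ-injective (ℤ.+-injective
  (ℤ+.∙-cancelˡ (+ m ℤ.* b) _ _ (trans (cong (λ c → + m ℤ.* c ℤ.+ + toℕ i) (sym a≡b)) e)))
  where
  move : ∀ m a b i j → m ℤ.* a ℤ.+ i ≡ m ℤ.* b ℤ.+ j → m ℤ.* (a ℤ.- b) ≡ j ℤ.- i
  move m a b i j e = trans (lhs m a b i) (trans (cong (λ u → u ℤ.- (m ℤ.* b ℤ.+ i)) e) (rhs m b i j))
    where
    lhs : ∀ m a b i → m ℤ.* (a ℤ.- b) ≡ (m ℤ.* a ℤ.+ i) ℤ.- (m ℤ.* b ℤ.+ i)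
    lhs = solve-∀
    rhs : ∀ m b i j → (m ℤ.* b ℤ.+ j) ℤ.- (m ℤ.* b ℤ.+ i) ≡ j ℤ.- i
    rhs = solve-∀
  small : m * ∣ a ℤ.- b ∣ < m * 1
  small = begin-strict
    m * ∣ a ℤ.- b ∣          ≡⟨ ℤ.abs-* (+ m) (a ℤ.- b) ⟨
    ∣ + m ℤ.* (a ℤ.- b) ∣    ≡⟨ cong ∣_∣ (move (+ m) a b (+ toℕ i) (+ toℕ j) e) ⟩
    ∣ + toℕ j ℤ.- + toℕ i ∣  ≡⟨ cong ∣_∣ (ℤ.[+m]-[+n]≡m⊖n (toℕ j) (toℕ i)) ⟩
    ∣ toℕ j ℤ.⊖ toℕ i ∣      ≤⟨ ℤ.∣m⊝n∣≤m⊔n (toℕ j) (toℕ i) ⟩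
    toℕ j ⊔ toℕ i            <⟨ ℕ.⊔-lub (Fin.toℕ<n j) (Fin.toℕ<n i) ⟩
    m                        ≡⟨ ℕ.*-identityʳ m ⟨
    m * 1                    ∎
    where open ℕ.≤-Reasoning
  a≡b : a ≡ b
  a≡b = ℤ.i-j≡0⇒i≡j a b (ℤ.∣i∣≡0⇒i≡0 (ℕ.n<1⇒n≡0 (ℕ.*-cancelˡ-< m _ _ small)))

InBox : ∀ {n} → ℕ → Vec ℤ n → Set
InBox M = VecAll.All (λ z → ∃[ m ] z ≡ + m × m ≤ M)

InBox-resp : ∀ {n M N} {x : Vec ℤ n} → M ≡ N → InBox M x → InBox N x
InBox-resp refl X = X

InBox-𝟘 : ∀ {n M} → InBox M (𝟘 {n})
InBox-𝟘 {zero}  = []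
InBox-𝟘 {suc n} = (0 , refl , z≤n) ∷ InBox-𝟘

InBox-⊕ : ∀ {n M N} {x y : Vec ℤ n} → InBox M x → InBox N y → InBox (M + N) (x ⊕ y)
InBox-⊕ []                      []                      = []
InBox-⊕ ((a , refl , a≤) ∷ xs) ((b , refl , b≤) ∷ ys) =
  (a + b , refl , ℕ.+-mono-≤ a≤ b≤) ∷ InBox-⊕ xs ys

InBox-∙ : ∀ {n M} k {x : Vec ℤ n} → InBox M x → InBox (k * M) (+ k ∙ x)
InBox-∙ k []                     = []
InBox-∙ k ((a , refl , a≤) ∷ xs) = (k * a , sym (ℤ.pos-* k a) , ℕ.*-monoʳ-≤ k a≤) ∷ InBox-∙ k xs

⊕-cancel-middle : ∀ {n} (p p′ t ρ ρ′ y : Vec ℤ n) →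
  (p ⊕ t) ⊕ ρ ≡ ((p′ ⊕ t) ⊕ ρ′) ⊕ y → p ⊕ ρ ≡ (p′ ⊕ ρ′) ⊕ y
⊕-cancel-middle []      []        []      []      []        []      _ = refl
⊕-cancel-middle (a ∷ p) (a′ ∷ p′) (b ∷ t) (c ∷ ρ) (c′ ∷ ρ′) (d ∷ y) e = cong₂ _∷_
  (trans (lhs a b c) (trans (cong (λ u → head u ℤ.- b) e) (rhs a′ b c′ d)))
  (⊕-cancel-middle p p′ t ρ ρ′ y (cong tail e))
  where
  lhs : ∀ a b c → a ℤ.+ c ≡ a ℤ.+ b ℤ.+ c ℤ.- b
  lhs = solve-∀
  rhs : ∀ a b c d → a ℤ.+ b ℤ.+ c ℤ.+ d ℤ.- b ≡ a ℤ.+ c ℤ.+ d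
  rhs = solve-∀

-- Two numbers in [0, M] differ by at most M, not 2M; this is why boxes are taken in the nonnegative
-- orthant. The errors `ρ`, `ρ′` add at most 2C, so K |h| ≤ M + 2C for every coordinate `h` of `η`.
norm-small : ∀ {n M C l} K (p p′ ρ ρ′ η : Vec ℤ n) → InBox M p → InBox M p′ → norm ρ ≤ C → norm ρ′ ≤ C →
  p ⊕ ρ ≡ (p′ ⊕ ρ′) ⊕ + K ∙ η → M + (C + C) < K * l → norm η < l
norm-small {l = zero}  K [] [] [] [] [] _ _ _ _ _ M< =
  contradiction (ℕ.≤-trans M< (ℕ.≤-reflexive (ℕ.*-zeroʳ K))) λ ()
norm-small {l = suc l} K [] [] [] [] [] _ _ _ _ _ _ = s≤s z≤n
norm-small {M = M} {C} {l} K (_ ∷ p) (_ ∷ p′) (c ∷ ρ) (c′ ∷ ρ′) (h ∷ η)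
  ((a , refl , a≤) ∷ ps) ((a′ , refl , a′≤) ∷ ps′) c≤ c′≤ e M< =
  ℕ.⊔-lub (ℕ.*-cancelˡ-< K _ _ coordinate)
    (norm-small K p p′ ρ ρ′ η ps ps′ (ℕ.m⊔n≤o⇒n≤o ∣ c ∣ _ c≤) (ℕ.m⊔n≤o⇒n≤o ∣ c′ ∣ _ c′≤) (cong tail e) M<)
  where
  open ℕ.≤-Reasoning
  lhs : ∀ a c y → y ≡ (a ℤ.+ c ℤ.+ y) ℤ.- (a ℤ.+ c)
  lhs = solve-∀
  rhs : ∀ a c a′ c′ → a ℤ.+ c ℤ.- (a′ ℤ.+ c′) ≡ (a ℤ.- a′) ℤ.+ (c ℤ.- c′)
  rhs = solve-∀
  Kh : + K ℤ.* h ≡ (+ a ℤ.- + a′) ℤ.+ (c ℤ.- c′)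
  Kh = trans (lhs (+ a′) c′ _) (trans (cong (λ u → head u ℤ.- (+ a′ ℤ.+ c′)) (sym e)) (rhs (+ a) c (+ a′) c′))
  coordinate : K * ∣ h ∣ < K * l
  coordinate = begin-strict
    K * ∣ h ∣                                  ≡⟨ ℤ.abs-* (+ K) h ⟨
    ∣ + K ℤ.* h ∣                              ≡⟨ cong ∣_∣ Kh ⟩
    ∣ (+ a ℤ.- + a′) ℤ.+ (c ℤ.- c′) ∣          ≤⟨ ℤ.∣i+j∣≤∣i∣+∣j∣ (+ a ℤ.- + a′) (c ℤ.- c′) ⟩
    ∣ + a ℤ.- + a′ ∣ + ∣ c ℤ.- c′ ∣            ≤⟨ ℕ.+-mono-≤
      (ℕ.≤-trans (ℕ.≤-reflexive (cong ∣_∣ (ℤ.[+m]-[+n]≡m⊖n a a′)))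
        (ℕ.≤-trans (ℤ.∣m⊝n∣≤m⊔n a a′) (ℕ.⊔-lub a≤ a′≤)))
      (ℕ.≤-trans (ℤ.∣i-j∣≤∣i∣+∣j∣ c c′)
        (ℕ.+-mono-≤ (ℕ.m⊔n≤o⇒m≤o ∣ c ∣ (norm ρ) c≤) (ℕ.m⊔n≤o⇒m≤o ∣ c′ ∣ (norm ρ′) c′≤))) ⟩
    M + (C + C)                                <⟨ M< ⟩
    K * l                                      ∎

dot : ∀ {n} → Vec ℤ n → Vec ℤ n → ℤ
dot []      []      = 0ℤ
dot (a ∷ x) (b ∷ y) = a ℤ.* b ℤ.+ dot x y

dot-⊕ʳ : ∀ {n} (w x y : Vec ℤ n) → dot w (x ⊕ y) ≡ dot w x ℤ.+ dot w y
dot-⊕ʳ []      []      []      = refl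
dot-⊕ʳ (a ∷ w) (b ∷ x) (c ∷ y) =
  trans (cong (λ u → a ℤ.* (b ℤ.+ c) ℤ.+ u) (dot-⊕ʳ w x y)) (lemma a b c (dot w x) (dot w y))
  where
  lemma : ∀ a b c u w → a ℤ.* (b ℤ.+ c) ℤ.+ (u ℤ.+ w) ≡ a ℤ.* b ℤ.+ u ℤ.+ (a ℤ.* c ℤ.+ w)
  lemma = solve-∀

dot-∙ʳ : ∀ {n} k (w x : Vec ℤ n) → dot w (k ∙ x) ≡ k ℤ.* dot w x
dot-∙ʳ k []      []      = sym (ℤ.*-zeroʳ k)
dot-∙ʳ k (a ∷ w) (b ∷ x) = trans (cong (λ u → a ℤ.* (k ℤ.* b) ℤ.+ u) (dot-∙ʳ k w x)) (lemma k a b (dot w x))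
  where
  lemma : ∀ k a b u → a ℤ.* (k ℤ.* b) ℤ.+ k ℤ.* u ≡ k ℤ.* (a ℤ.* b ℤ.+ u)
  lemma = solve-∀

dot-linear : ∀ {n} (w : Vec ℤ n) → IsLinear (λ x → dot w x ∷ [])
dot-linear w = record
  { +-homo = λ x y → cong (_∷ []) (dot-⊕ʳ w x y)
  ; *-homo = λ k x → cong (_∷ []) (dot-∙ʳ k w x)
  }

dot-InBox : ∀ {n M} (w : Vec ℕ n) {x : Vec ℤ n} → InBox M x →
  ∃[ m ] dot (map +_ w) x ≡ + m × m ≤ M * sum w
dot-InBox []      []                    = 0 , refl , z≤n
dot-InBox {M = M} (a ∷ w) ((b , refl , b≤) ∷ xs) =
  let (m , e , m≤) = dot-InBox w xs
  in a * b + m , cong₂ ℤ._+_ (sym (ℤ.pos-* a b)) e , (begin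
    a * b + m                ≤⟨ ℕ.+-mono-≤ (ℕ.*-monoʳ-≤ a b≤) m≤ ⟩
    a * M + M * sum w        ≡⟨ cong (_+ M * sum w) (ℕ.*-comm a M) ⟩
    M * a + M * sum w        ≡⟨ ℕ.*-distribˡ-+ M a (sum w) ⟨
    M * (a + sum w)          ∎)
  where open ℕ.≤-Reasoning

module _ {n : ℕ} (κ : ℕ) where

  box : Fin (suc κ ^ n) → Vec ℤ n
  box q = map (+_ ∘ toℕ) (digits n q)

  box-injective : ∀ {p q} → box p ≡ box q → p ≡ q
  box-injective e = digits-injective n
    (map-injective (Fin.toℕ-injective ∘ ℤ.+-injective) e)

  InBox-box : ∀ q → InBox κ (box q)
  InBox-box q = go (digits n q)
    where
    go : ∀ {m} (x : Vec (Fin (suc κ)) m) → InBox κ (map (+_ ∘ toℕ) x)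
    go []      = []
    go (i ∷ x) = (toℕ i , refl , s≤s⁻¹ (Fin.toℕ<n i)) ∷ go x

  -- A point of the box over t that depends on t only (junk if there is none).
  representative : ∀ {m} (τ : Vec ℤ n → Vec ℤ m) → Vec ℤ m → Vec ℤ n
  representative τ t with Fin.any? (λ q → τ (box q) ≟ⱽ t)
  ... | yes (q , _) = box q
  ... | no  _       = 𝟘

  representative-over : ∀ {m} (τ : Vec ℤ n → Vec ℤ m) q → τ (representative τ (τ (box q))) ≡ τ (box q)
  representative-over τ q with Fin.any? (λ p → τ (box p) ≟ⱽ τ (box q))
  ... | yes (_ , e) = e
  ... | no  none    = contradiction (q , refl) none

  InBox-representative : ∀ {m} (τ : Vec ℤ n → Vec ℤ m) t → InBox κ (representative τ t)
  InBox-representative τ t with Fin.any? (λ q → τ (box q) ≟ⱽ t)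
  ... | yes (q , _) = InBox-box q
  ... | no  _       = InBox-𝟘

module _ {n : ℕ} {φ : Vec ℤ n → Vec ℤ 1} where

  -- One factor λᵢ for each minimum, and λᵣ once more for the direction of ℤⁿ modulo Λ.
  size : ∀ {r τ s} → Flag φ r τ s → ℕ
  size {s = s} (last _)           = s
  size (step x _ _ _ _ _ _ _ F)   = norm x * size F

  top : ∀ {r τ s} → Flag φ r τ s → ℕ
  top {s = s} (last _)          = s
  top (step _ _ _ _ _ _ _ _ F)  = top F

  -- Mixed-radix digits, one below λᵢ for each direction of the flag, read in the coordinates
  -- adapted to the flag. They fill the gaps that multiplication by λᵢ leaves.
  undigits : ∀ {r τ s} (F : Flag φ r τ s) → Fin (size F) → Vec ℤ (suc r)
  undigits (last _)                    j = + toℕ j ∷ []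
  undigits (step x _ _ _ β _ _ _ F)    j =
    from β (+ toℕ (proj₁ (remQuot {norm x} (size F) j)) ∷ undigits F (proj₂ (remQuot {norm x} (size F) j)))

  module _ (κ : ℕ) where

    -- Modulo the span of the minima before the i-th one, this is multiplication by the i-th
    -- minimum on the box, up to terms depending only on the class modulo the i-th span.
    stretch : ∀ {r τ s} → Flag φ r τ s → Vec ℤ n → Vec ℤ n
    stretch                   (last _)                    y = 𝟘
    stretch {τ = τ} {s = s}   (step x _ _ _ _ _ _ _ F)    y =
      + (norm x ∸ s) ∙ representative κ τ (τ y) ⊕ stretch F y

    stretch-cong : ∀ {r τ s} (F : Flag φ r τ s) {y z} → τ y ≡ τ z → stretch F y ≡ stretch F z
    stretch-cong (last _) e = refl
    stretch-cong {τ = τ} {s} (step x _ _ _ β _ _ _ F) e =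
      cong₂ (λ t u → + (norm x ∸ s) ∙ representative κ τ t ⊕ u) e (stretch-cong F (cong (tail ∘ to β) e))

    grow : ∀ {s l} → s ≤ l → s * κ + (l ∸ s) * κ ≡ l * κ
    grow {s} {l} s≤l = trans (sym (ℕ.*-distribʳ-+ κ s (l ∸ s))) (cong (_* κ) (ℕ.m+[n∸m]≡n s≤l))

    InBox-stretch : ∀ {r τ s} (F : Flag φ r τ s) y {p} → InBox (s * κ) p → InBox (top F * κ) (p ⊕ stretch F y)
    InBox-stretch {s = s} (last _) y {p} P = subst (InBox (s * κ)) (sym (⊕-identityʳ p)) P
    InBox-stretch {τ = τ} {s} (step x s≤ _ _ _ _ _ _ F) y {p} P =
      subst (InBox (top F * κ)) (⊕-assoc p _ (stretch F y))
        (InBox-stretch F y (InBox-resp (grow s≤)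
          (InBox-⊕ P (InBox-∙ (norm x ∸ s) (InBox-representative κ τ (τ y))))))

    module _ {C K : ℕ} (K> : κ + (C + C) < K) where

      project : ∀ {m} {L : Vec ℤ n → Vec ℤ m} → IsLinear L → ∀ {p p′ ρ ρ′ η} →
        p ⊕ ρ ≡ (p′ ⊕ ρ′) ⊕ + K ∙ η → L η ≡ 𝟘 → L p ⊕ L ρ ≡ L p′ ⊕ L ρ′
      project {L = L} Λ {p} {p′} {ρ} {ρ′} {η} e Lη≡0 = begin
        L p ⊕ L ρ                          ≡⟨ +-homo Λ p ρ ⟨
        L (p ⊕ ρ)                          ≡⟨ cong L e ⟩
        L ((p′ ⊕ ρ′) ⊕ + K ∙ η)            ≡⟨ +-homo Λ _ _ ⟩
        L (p′ ⊕ ρ′) ⊕ L (+ K ∙ η)          ≡⟨ cong₂ _⊕_ (+-homo Λ p′ ρ′) (*-homo Λ (+ K) η) ⟩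
        (L p′ ⊕ L ρ′) ⊕ + K ∙ L η          ≡⟨ cong (λ u → (L p′ ⊕ L ρ′) ⊕ + K ∙ u) Lη≡0 ⟩
        (L p′ ⊕ L ρ′) ⊕ + K ∙ 𝟘            ≡⟨ cong ((L p′ ⊕ L ρ′) ⊕_) (∙-zeroʳ (+ K)) ⟩
        (L p′ ⊕ L ρ′) ⊕ 𝟘                  ≡⟨ ⊕-identityʳ _ ⟩
        L p′ ⊕ L ρ′                        ∎
        where open ≡-Reasoning

      -- Here `p` is what the earlier steps of the flag contribute, so `τ p` is `s` times `τ` of the
      -- box point. The induction works from the far end: agreement in the smaller quotient comes
      -- first, then agreement in the coordinate that `β` splits off, where the equation is one
      -- between quotient and remainder modulo λᵢ.
      stretch-injective : ∀ {r τ s} (F : Flag φ r τ s) → IsLinear τ → ∀ q q′ {p p′ ρ ρ′ η} j j′ →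
        InBox (s * κ) p → InBox (s * κ) p′ →
        τ p ≡ + s ∙ τ (box κ q) → τ p′ ≡ + s ∙ τ (box κ q′) →
        τ ρ ≡ undigits F j → τ ρ′ ≡ undigits F j′ → norm ρ ≤ C → norm ρ′ ≤ C → φ η ≡ 𝟘 →
        (p ⊕ stretch F (box κ q)) ⊕ ρ ≡ ((p′ ⊕ stretch F (box κ q′)) ⊕ ρ′) ⊕ + K ∙ η →
        τ (box κ q) ≡ τ (box κ q′) × j ≡ j′
      stretch-injective {τ = τ} {s} (last null) T q q′ {p} {p′} {ρ} {ρ′} {η} j j′ P P′ τp τp′ τρ τρ′ _ _ φη e =
        both (τ (box κ q)) (τ (box κ q′)) digit
        where
        digit : + s ∙ τ (box κ q) ⊕ (+ toℕ j ∷ []) ≡ + s ∙ τ (box κ q′) ⊕ (+ toℕ j′ ∷ [])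
        digit = trans (cong₂ _⊕_ (sym τp) (sym τρ))
          (trans (project T (⊕-cancel-middle p p′ 𝟘 ρ ρ′ (+ K ∙ η) e) (null η φη)) (cong₂ _⊕_ τp′ τρ′))
        both : (u u′ : Vec ℤ 1) → + s ∙ u ⊕ (+ toℕ j ∷ []) ≡ + s ∙ u′ ⊕ (+ toℕ j′ ∷ []) → u ≡ u′ × j ≡ j′
        both (a ∷ []) (a′ ∷ []) e =
          let (a≡a′ , j≡j′) = digit-unique j j′ a a′ (cong head e) in cong (_∷ []) a≡a′ , j≡j′
      stretch-injective {τ = τ} {s} (step x s≤ φx x-min β g g≢0 βτx F) T q q′ {p} {p′} {ρ} {ρ′} {η} j j′
        P P′ τp τp′ τρ τρ′ ρ≤ ρ′≤ φη e = τ-eq , remQuot-injective (norm x) (cong₂ _,_ (proj₂ heads) (proj₂ rec))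
        where
        λx = norm x
        y  = box κ q
        y′ = box κ q′
        L = to β ∘ τ
        Λ = to-linear β ∘ˡ T
        c : Vec ℤ n → Vec ℤ n
        c z = + (λx ∸ s) ∙ representative κ τ (τ z)
        j₀ = proj₁ (remQuot {λx} (size F) j)
        j₁ = proj₂ (remQuot {λx} (size F) j)
        j₀′ = proj₁ (remQuot {λx} (size F) j′)
        j₁′ = proj₂ (remQuot {λx} (size F) j′)
        prefix : ∀ {p} q → InBox (s * κ) p → InBox (λx * κ) (p ⊕ c (box κ q))
        prefix q P = InBox-resp (grow s≤)
          (InBox-⊕ P (InBox-∙ (λx ∸ s) (InBox-representative κ τ (τ (box κ q)))))
        τ-prefix : ∀ {p} q → τ p ≡ + s ∙ τ (box κ q) → τ (p ⊕ c (box κ q)) ≡ + λx ∙ τ (box κ q)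
        τ-prefix {p} q τp = begin
          τ (p ⊕ c z)                                   ≡⟨ +-homo T p (c z) ⟩
          τ p ⊕ τ (c z)                                 ≡⟨ cong₂ _⊕_ τp (*-homo T (+ (λx ∸ s)) _) ⟩
          + s ∙ τ z ⊕ + (λx ∸ s) ∙ τ (representative κ τ (τ z))
            ≡⟨ cong (λ u → + s ∙ τ z ⊕ + (λx ∸ s) ∙ u) (representative-over κ τ q) ⟩
          + s ∙ τ z ⊕ + (λx ∸ s) ∙ τ z                  ≡⟨ ∙-distribʳ-⊕ (+ s) (+ (λx ∸ s)) (τ z) ⟨
          + (s + (λx ∸ s)) ∙ τ z                        ≡⟨ cong (λ l → + l ∙ τ z) (ℕ.m+[n∸m]≡n s≤) ⟩
          + λx ∙ τ z                                    ∎
          where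
          open ≡-Reasoning
          z = box κ q
        L-prefix : ∀ {p} q → τ p ≡ + s ∙ τ (box κ q) → L (p ⊕ c (box κ q)) ≡ + λx ∙ L (box κ q)
        L-prefix q τp = trans (cong (to β) (τ-prefix q τp)) (*-homo (to-linear β) (+ λx) _)
        tail-∙ : ∀ {m} k (u : Vec ℤ (suc m)) → tail (k ∙ u) ≡ k ∙ tail u
        tail-∙ k (_ ∷ _) = refl
        e₁ : ((p ⊕ c y) ⊕ stretch F y) ⊕ ρ ≡ (((p′ ⊕ c y′) ⊕ stretch F y′) ⊕ ρ′) ⊕ + K ∙ η
        e₁ = trans (cong (_⊕ ρ) (⊕-assoc p (c y) _))
          (trans e (cong (λ u → (u ⊕ ρ′) ⊕ + K ∙ η) (sym (⊕-assoc p′ (c y′) _))))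
        L-ρ : ∀ {ρ} j → τ ρ ≡ undigits (step x s≤ φx x-min β g g≢0 βτx F) j →
          L ρ ≡ + toℕ (proj₁ (remQuot {λx} (size F) j)) ∷ undigits F (proj₂ (remQuot {λx} (size F) j))
        L-ρ j τρ = trans (cong (to β) τρ) (to∘from β _)
        rec : projection φ β τ y ≡ projection φ β τ y′ × j₁ ≡ j₁′
        rec = stretch-injective F (tail-linear ∘ˡ Λ) q q′ j₁ j₁′ (prefix q P) (prefix q′ P′)
          (trans (cong tail (L-prefix q τp)) (tail-∙ (+ λx) (L y)))
          (trans (cong tail (L-prefix q′ τp′)) (tail-∙ (+ λx) (L y′)))
          (cong tail (L-ρ j τρ)) (cong tail (L-ρ j′ τρ′)) ρ≤ ρ′≤ φη e₁
        -- Agreement in the smaller quotient makes the later terms of `stretch` equal. With these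
        -- cancelled only the prefixes remain, and they lie in a box of side λx κ.
        e₂ : (p ⊕ c y) ⊕ ρ ≡ ((p′ ⊕ c y′) ⊕ ρ′) ⊕ + K ∙ η
        e₂ = ⊕-cancel-middle (p ⊕ c y) (p′ ⊕ c y′) (stretch F y′) ρ ρ′ (+ K ∙ η)
          (trans (cong (λ u → ((p ⊕ c y) ⊕ u) ⊕ ρ) (sym (stretch-cong F (proj₁ rec)))) e₁)
        x≢𝟘 : norm x ≢ 0
        x≢𝟘 x≡0 = g≢0 (cong head (trans (sym βτx) (trans (cong L (norm≡0 x x≡0)) (0-homo Λ))))
        instance _ = ℕ.≢-nonZero x≢𝟘
        room : λx * κ + (C + C) < K * λx
        room = begin-strict
          λx * κ + (C + C)        ≤⟨ ℕ.+-monoʳ-≤ (λx * κ) (ℕ.m≤n*m (C + C) λx) ⟩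
          λx * κ + λx * (C + C)   ≡⟨ ℕ.*-distribˡ-+ λx κ (C + C) ⟨
          λx * (κ + (C + C))      <⟨ ℕ.*-monoʳ-< λx K> ⟩
          λx * K                  ≡⟨ ℕ.*-comm λx K ⟩
          K * λx                  ∎
          where open ℕ.≤-Reasoning
        -- So `η` is shorter than `x`, and the minimality of `x` puts it into the span of the
        -- earlier minima.
        τη≡0 : τ η ≡ 𝟘
        τη≡0 = x-min η φη
          (norm-small K (p ⊕ c y) (p′ ⊕ c y′) ρ ρ′ η (prefix q P) (prefix q′ P′) ρ≤ ρ′≤ e₂ room)
        digit : + λx ∙ L y ⊕ L ρ ≡ + λx ∙ L y′ ⊕ L ρ′
        digit = trans (cong (_⊕ L ρ) (sym (L-prefix q τp)))
          (trans (project Λ e₂ (trans (cong (to β) τη≡0) (0-homo (to-linear β))))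
            (cong (_⊕ L ρ′) (L-prefix q′ τp′)))
        head-digit : ∀ {m} (u w : Vec ℤ (suc m)) → head (+ λx ∙ u ⊕ w) ≡ + λx ℤ.* head u ℤ.+ head w
        head-digit (_ ∷ _) (_ ∷ _) = refl
        heads : head (L y) ≡ head (L y′) × j₀ ≡ j₀′
        heads = digit-unique j₀ j₀′ _ _ (begin
          + λx ℤ.* head (L y) ℤ.+ + toℕ j₀        ≡⟨ cong (λ u → + λx ℤ.* head (L y) ℤ.+ head u) (L-ρ j τρ) ⟨
          + λx ℤ.* head (L y) ℤ.+ head (L ρ)      ≡⟨ head-digit (L y) (L ρ) ⟨
          head (+ λx ∙ L y ⊕ L ρ)                 ≡⟨ cong head digit ⟩
          head (+ λx ∙ L y′ ⊕ L ρ′)               ≡⟨ head-digit (L y′) (L ρ′) ⟩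
          + λx ℤ.* head (L y′) ℤ.+ head (L ρ′)    ≡⟨ cong (λ u → + λx ℤ.* head (L y′) ℤ.+ head u) (L-ρ j′ τρ′) ⟩
          + λx ℤ.* head (L y′) ℤ.+ + toℕ j₀′      ∎)
          where open ≡-Reasoning
        ∷-ext : ∀ {m} (u w : Vec ℤ (suc m)) → head u ≡ head w → tail u ≡ tail w → u ≡ w
        ∷-ext (_ ∷ _) (_ ∷ _) = cong₂ _∷_
        τ-eq : τ y ≡ τ y′
        τ-eq = trans (sym (from∘to β (τ y)))
          (trans (cong (from β) (∷-ext (L y) (L y′) (proj₁ heads) (proj₁ rec))) (from∘to β (τ y′)))

module _ (C K : ℕ) .{{_ : NonZero K}} where

  -- The fixed vectors may have negative coordinates, but none below -C; the shift by `C` keeps all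
  -- quotients nonnegative.
  quot : ℤ → ℤ
  quot z = (z ℤ.+ + C) /ℕ K

  rem : ℤ → Fin K
  rem z = fromℕ< (ℤ.n%ℕd<d (z ℤ.+ + C) K)

  quot-rem : ∀ {n} (x y : Vec ℤ n) → map rem x ≡ map rem y → x ≡ y ⊕ + K ∙ (map quot x ⊖ map quot y)
  quot-rem []      []      _ = refl
  quot-rem (a ∷ x) (b ∷ y) e = cong₂ _∷_
    (begin
      a                                                     ≡⟨ unshift a (+ C) ⟩
      (a ℤ.+ + C) ℤ.- + C                                   ≡⟨ cong (ℤ._- + C) (ℤ.a≡a%ℕn+[a/ℕn]*n (a ℤ.+ + C) K) ⟩
      (r a ℤ.+ quot a ℤ.* + K) ℤ.- + C                      ≡⟨ cong (λ u → (u ℤ.+ quot a ℤ.* + K) ℤ.- + C) same ⟩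
      (r b ℤ.+ quot a ℤ.* + K) ℤ.- + C                      ≡⟨ exchange (r b) (quot a) (quot b) (+ K) (+ C) ⟩
      ((r b ℤ.+ quot b ℤ.* + K) ℤ.- + C) ℤ.+ δ
        ≡⟨ cong (λ u → (u ℤ.- + C) ℤ.+ δ) (ℤ.a≡a%ℕn+[a/ℕn]*n (b ℤ.+ + C) K) ⟨
      ((b ℤ.+ + C) ℤ.- + C) ℤ.+ δ                           ≡⟨ cong (ℤ._+ δ) (unshift b (+ C)) ⟨
      b ℤ.+ δ                                               ∎)
    (quot-rem x y (cong tail e))
    where
    open ≡-Reasoning
    r : ℤ → ℤ
    r a = + ((a ℤ.+ + C) %ℕ K)
    δ = + K ℤ.* (quot a ℤ.+ -1ℤ ℤ.* quot b)
    same : r a ≡ r b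
    same = cong +_ (Fin.fromℕ<-injective _ _ (ℤ.n%ℕd<d (a ℤ.+ + C) K) (ℤ.n%ℕd<d (b ℤ.+ + C) K) (cong head e))
    unshift : ∀ a c → a ≡ (a ℤ.+ c) ℤ.- c
    unshift = solve-∀
    exchange : ∀ r p q k c → (r ℤ.+ p ℤ.* k) ℤ.- c ≡
      ((r ℤ.+ q ℤ.* k) ℤ.- c) ℤ.+ k ℤ.* (p ℤ.+ -1ℤ ℤ.* q)
    exchange = solve-∀

  shift : ∀ c → ∣ c ∣ ≤ C → ∃[ m ] c ℤ.+ + C ≡ + m × m ≤ C + C
  shift (+ k)        k≤C = k + C , refl , ℕ.+-monoˡ-≤ C k≤C
  shift (ℤ.-[1+ k ]) k<C = C ∸ suc k , ℤ.⊖-≥ k<C , ℕ.≤-trans (ℕ.m∸n≤m C (suc k)) (ℕ.m≤m+n C C)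

  InBox-quot : ∀ {n M} t {x ρ : Vec ℤ n} → InBox M x → norm ρ ≤ C → M + (C + C) < t * K →
    InBox (t ∸ 1) (map quot (x ⊕ ρ))
  InBox-quot t {ρ = []} [] _ _ = []
  InBox-quot {M = M} t {ρ = c ∷ ρ} ((a , refl , a≤) ∷ xs) ρ≤ M< =
    let (m , e , m≤) = shift c (ℕ.m⊔n≤o⇒m≤o ∣ c ∣ (norm ρ) ρ≤)
    in ((a + m) ℕ./ K
       , cong (_/ℕ K) (trans (ℤ.+-assoc (+ a) c (+ C)) (cong (λ u → + a ℤ.+ u) e))
       , ℕ.<⇒≤pred (ℕ.m<n*o⇒m/o<n {n = t} (ℕ.≤-<-trans (ℕ.+-mono-≤ a≤ m≤) M<)))
       ∷ InBox-quot t xs (ℕ.m⊔n≤o⇒n≤o ∣ c ∣ (norm ρ) ρ≤) M<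

functional : ∀ {n} → Vec ℕ n → Vec ℤ n → Vec ℤ 1
functional w x = dot (map +_ w) x ∷ []

module _ {m : ℕ} (w : Vec ℕ (suc m)) (F : Flag (functional w) m id 0) (top>0 : 0 < top F) where

  private
    n = suc m
    C = proj₁ (bounded (norm ∘ undigits F))
    C≥ = proj₂ (bounded (norm ∘ undigits F))

  -- A class records the residues of the coordinates modulo `K` and the value of `w` at their
  -- quotients. Points of one class differ by Kη with w · η = 0, which `stretch-injective` excludes
  -- unless they come from the same index. The quotients lie in [0, λᵣ - 1], so `w` takes values
  -- from 0 to (λᵣ - 1) ∑ wⱼ; the outer `suc` counts the value 0.
  box-count : ∀ κ → suc κ ^ n * size F ≤ suc (κ + (C + C)) ^ n * suc ((top F ∸ 1) * sum w)
  box-count κ = Fin.injective⇒≤ {f = class} class-injective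
    where
    K = suc (κ + (C + C))
    q₁ : Fin (suc κ ^ n * size F) → Fin (suc κ ^ n)
    q₁ i = proj₁ (remQuot (size F) i)
    j₁ : Fin (suc κ ^ n * size F) → Fin (size F)
    j₁ i = proj₂ (remQuot {suc κ ^ n} (size F) i)
    stretched : Fin (suc κ ^ n * size F) → Vec ℤ n
    stretched i = 𝟘 ⊕ stretch κ F (box κ (q₁ i))
    point : Fin (suc κ ^ n * size F) → Vec ℤ n
    point i = stretched i ⊕ undigits F (j₁ i)
    room : top F * κ + (C + C) < top F * K
    room = begin-strict
      top F * κ + (C + C)             ≤⟨ ℕ.+-monoʳ-≤ (top F * κ) (ℕ.m≤n*m (C + C) (top F)) ⟩
      top F * κ + top F * (C + C)     ≡⟨ ℕ.*-distribˡ-+ (top F) κ (C + C) ⟨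
      top F * (κ + (C + C))           <⟨ ℕ.*-monoʳ-< (top F) (ℕ.n<1+n _) ⟩
      top F * K                       ∎
      where
      open ℕ.≤-Reasoning
      instance _ = ℕ.>-nonZero top>0
    quotients : Fin (suc κ ^ n * size F) → Vec ℤ n
    quotients i = map (quot C K) (point i)
    value : ∀ i → ∃[ k ] dot (map +_ w) (quotients i) ≡ + k × k ≤ (top F ∸ 1) * sum w
    value i = dot-InBox w (InBox-quot C K (top F) (InBox-stretch κ F _ InBox-𝟘) (C≥ (j₁ i)) room)
    class : Fin (suc κ ^ n * size F) → Fin (K ^ n * suc ((top F ∸ 1) * sum w))
    class i = combine (number (map (rem C K) (point i))) (fromℕ< (s≤s (proj₂ (proj₂ (value i)))))
    class-injective : ∀ {i i′} → class i ≡ class i′ → i ≡ i′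
    class-injective {i} {i′} e = remQuot-injective (suc κ ^ n)
      (cong₂ _,_ (box-injective κ (proj₁ same)) (proj₂ same))
      where
      parts = Fin.combine-injective (number (map (rem C K) (point i))) _ (number (map (rem C K) (point i′))) _ e
      η = quotients i ⊖ quotients i′
      equal-values : functional w (quotients i) ≡ functional w (quotients i′)
      equal-values = cong (_∷ []) (trans (proj₁ (proj₂ (value i)))
        (trans (cong +_ (Fin.fromℕ<-injective _ _ _ _ (proj₂ parts))) (sym (proj₁ (proj₂ (value i′))))))
      φη≡0 : functional w η ≡ 𝟘
      φη≡0 = trans (⊖-homo (dot-linear (map +_ w)) (quotients i) (quotients i′))
        (trans (cong (_⊖ functional w (quotients i′)) equal-values) (⊖-inverse (functional w (quotients i′))))
      same : box κ (q₁ i) ≡ box κ (q₁ i′) × j₁ i ≡ j₁ i′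
      same = stretch-injective κ (ℕ.n<1+n (κ + (C + C))) F id-linear (q₁ i) (q₁ i′) (j₁ i) (j₁ i′)
        InBox-𝟘 InBox-𝟘 (sym (∙-zeroˡ (box κ (q₁ i)))) (sym (∙-zeroˡ (box κ (q₁ i′)))) refl refl
        (C≥ (j₁ i)) (C≥ (j₁ i′)) φη≡0
        (quot-rem C K (point i) (point i′)
          (number-injective (map (rem C K) (point i)) (map (rem C K) (point i′)) (proj₁ parts)))

-- From the count to the bound for the product of the minima

^-distribʳ-* : ∀ a b n → (a * b) ^ n ≡ a ^ n * b ^ n
^-distribʳ-* a b zero    = refl
^-distribʳ-* a b (suc n) = trans (cong (a * b *_) (^-distribʳ-* a b n)) (lemma a b (a ^ n) (b ^ n))
  where
  lemma : ∀ a b p q → a * b * (p * q) ≡ a * p * (b * q)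
  lemma = ℕSolver.solve-∀

-- The mean value bound for t^(n+1) on [k, k + E].
power-growth : ∀ n k E → (k + E) ^ suc n ≤ k ^ suc n + suc n * E * (k + E) ^ n
power-growth zero k E = ℕ.≤-reflexive (lemma k E)
  where
  lemma : ∀ k E → (k + E) * 1 ≡ k * 1 + (E + 0) * 1
  lemma = ℕSolver.solve-∀
power-growth (suc n) k E = begin
  (k + E) * (k + E) ^ suc n                                      ≡⟨ ℕ.*-distribʳ-+ ((k + E) ^ suc n) k E ⟩
  k * (k + E) ^ suc n + E * (k + E) ^ suc n
    ≤⟨ ℕ.+-monoˡ-≤ _ (ℕ.*-monoʳ-≤ k (power-growth n k E)) ⟩
  k * (k ^ suc n + suc n * E * (k + E) ^ n) + E * (k + E) ^ suc n
    ≤⟨ ℕ.+-monoˡ-≤ (E * (k + E) ^ suc n) (ℕ.≤-trans (ℕ.≤-reflexive (ℕ.*-distribˡ-+ k _ _))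
         (ℕ.+-monoʳ-≤ (k * k ^ suc n) (ℕ.*-monoˡ-≤ _ (ℕ.m≤m+n k E)))) ⟩
  k * k ^ suc n + (k + E) * (suc n * E * (k + E) ^ n) + E * ((k + E) * (k + E) ^ n)
    ≡⟨ lemma (k * k ^ suc n) (k + E) (suc n) E ((k + E) ^ n) ⟩
  k * k ^ suc n + suc (suc n) * E * ((k + E) * (k + E) ^ n)      ∎
  where
  open ℕ.≤-Reasoning
  lemma : ∀ a s n E p → a + s * (n * E * p) + E * (s * p) ≡ a + (1 + n) * E * (s * p)
  lemma = ℕSolver.solve-∀

-- Let κ → ∞.
power-limit : ∀ n E X Y → (∀ κ → suc κ ^ suc n * Y ≤ suc (κ + E) ^ suc n * X) → Y ≤ X
power-limit n E X Y bound = ℕ.≮⇒≥ λ X<Y → ℕ.<⇒≱ (k>  X<Y) (small X<Y)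
  where
  open ℕ.≤-Reasoning
  -- The summand `E` ensures k + E ≤ 2k; the other one makes `k` exceed the bound that X < Y would
  -- force.
  κ = E + suc n * E * (2 ^ n * X)
  k = suc κ
  k> : X < Y → suc n * E * (2 ^ n * X) < k
  k> _ = s≤s (ℕ.m≤n+m _ E)
  k+E≤2k : k + E ≤ 2 * k
  k+E≤2k = ℕ.≤-trans (ℕ.+-monoʳ-≤ k (ℕ.≤-trans (ℕ.m≤m+n E _) (ℕ.n≤1+n κ)))
    (ℕ.≤-reflexive (cong (λ u → k + u) (sym (ℕ.+-identityʳ k))))
  -- Since X + 1 ≤ Y, the left side gains a full k^(n+1), which the right side has to absorb with a
  -- term of order k^n.
  small : X < Y → k ≤ suc n * E * (2 ^ n * X)
  small X<Y = ℕ.*-cancelʳ-≤ k _ (k ^ n) {{ℕ.m^n≢0 k n}} (ℕ.+-cancelˡ-≤ (k ^ suc n * X) _ _ (begin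
    k ^ suc n * X + k ^ suc n                              ≡⟨ ℕ.+-comm (k ^ suc n * X) _ ⟩
    k ^ suc n + k ^ suc n * X                              ≡⟨ ℕ.*-suc (k ^ suc n) X ⟨
    k ^ suc n * suc X                                      ≤⟨ ℕ.*-monoʳ-≤ (k ^ suc n) X<Y ⟩
    k ^ suc n * Y                                          ≤⟨ bound κ ⟩
    (k + E) ^ suc n * X                                    ≤⟨ ℕ.*-monoˡ-≤ X (power-growth n k E) ⟩
    (k ^ suc n + suc n * E * (k + E) ^ n) * X              ≤⟨ ℕ.*-monoˡ-≤ X (ℕ.+-monoʳ-≤ (k ^ suc n)
      (ℕ.*-monoʳ-≤ (suc n * E) (ℕ.≤-trans (ℕ.^-monoˡ-≤ n k+E≤2k) (ℕ.≤-reflexive (^-distribʳ-* 2 k n))))) ⟩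
    (k ^ suc n + suc n * E * (2 ^ n * k ^ n)) * X          ≡⟨ lemma (k ^ suc n) (suc n * E) (2 ^ n) (k ^ n) X ⟩
    k ^ suc n * X + suc n * E * (2 ^ n * X) * k ^ n        ∎))
    where
    lemma : ∀ a b c d x → (a + b * (c * d)) * x ≡ a * x + b * (c * x) * d
    lemma = ℕSolver.solve-∀

product : ∀ {n} → Vec ℕ n → ℕ
product = foldr′ _*_ 1

module _ {n : ℕ} {φ : Vec ℤ n → Vec ℤ 1} where

  size≡ : ∀ {r τ s} (F : Flag φ r τ s) → size F ≡ product (map norm (minima φ F)) * top F
  size≡ {s = s} (last _)          = sym (ℕ.*-identityˡ s)
  size≡ (step x _ _ _ _ _ _ _ F)  = trans (cong (norm x *_) (size≡ F)) (sym (ℕ.*-assoc (norm x) _ (top F)))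

  top-≥ : ∀ {r τ s} (F : Flag φ r τ s) → s ≤ top F
  top-≥ (last _)                   = ℕ.≤-refl
  top-≥ (step _ s≤ _ _ _ _ _ _ F)  = ℕ.≤-trans s≤ (top-≥ F)

  top-positive : ∀ {r τ s} (F : Flag φ (suc r) τ s) → IsLinear τ → 0 < top F
  top-positive {τ = τ} (step x _ _ _ β g g≢0 βτx F) T =
    ℕ.≤-trans (ℕ.n≢0⇒n>0 λ x≡0 → g≢0 (cong head (trans (sym βτx)
      (trans (cong (to β ∘ τ) (norm≡0 x x≡0)) (0-homo (to-linear β ∘ˡ T)))))) (top-≥ F)

-- With t = λᵣ and W = ∑ wⱼ ≥ 1, the number of values (t - 1) W + 1 is at most t W, and t cancels
-- against the extra factor of `size F`.
minkowski : ∀ {m} (w : Vec ℕ (suc (suc m))) (F : Flag (functional w) (suc m) id 0) → 0 < sum w →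
  product (map norm (minima (functional w) F)) ≤ sum w
minkowski {m} w F W>0 = ℕ.*-cancelʳ-≤ _ _ t (begin
  product (map norm (minima (functional w) F)) * t   ≡⟨ size≡ F ⟨
  size F                                             ≤⟨ power-limit (suc m) _ _ _ (box-count w F t>0) ⟩
  suc ((t ∸ 1) * W)                                  ≤⟨ ℕ.+-monoˡ-≤ ((t ∸ 1) * W) W>0 ⟩
  suc (t ∸ 1) * W                                    ≡⟨ cong (_* W) (ℕ.m+[n∸m]≡n t>0) ⟩
  t * W                                              ≡⟨ ℕ.*-comm t W ⟩
  W * t                                              ∎)
  where
  open ℕ.≤-Reasoning
  t = top F
  W = sum w
  t>0 = top-positive F id-linear
  instance _ = ℕ.>-nonZero t>0

-- Logarithms

fromℕ-suc : ∀ m → fromℕ (suc m) ≡ 1ℚ ℚ.+ fromℕ m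
fromℕ-suc m = ℚ.toℚᵘ-injective (ℚᵘ.≃-trans (ℚᵘ.*≡* (eq (+ m))) (ℚᵘ.≃-sym (ℚ.toℚᵘ-homo-+ 1ℚ (fromℕ m))))
  where
  eq : ∀ m → (1ℤ ℤ.+ m) ℤ.* (1ℤ ℤ.* 1ℤ) ≡ (1ℤ ℤ.* 1ℤ ℤ.+ m ℤ.* 1ℤ) ℤ.* 1ℤ
  eq = solve-∀

fromℕ-suc-* : ∀ m x → fromℕ (suc m) ℚ.* x ≡ x ℚ.+ fromℕ m ℚ.* x
fromℕ-suc-* m x = trans (cong (ℚ._* x) (fromℕ-suc m))
  (trans (ℚ.*-distribʳ-+ x 1ℚ (fromℕ m)) (cong (ℚ._+ fromℕ m ℚ.* x) (ℚ.*-identityˡ x)))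

∑<-const : ∀ n x → ∑< n (const x) ≡ fromℕ n ℚ.* x
∑<-const zero    x = sym (ℚ.*-zeroˡ x)
∑<-const (suc n) x = trans (cong (ℚ._+ x) (∑<-const n x))
  (trans (ℚ.+-comm (fromℕ n ℚ.* x) x) (sym (fromℕ-suc-* n x)))

log-riemann-monoˡ : ∀ {m n} k → m ≤ n → log-riemann m k ℚ.≤ log-riemann n k
log-riemann-monoˡ {m} {n} k m≤n = begin
  ∑< a f                                ≡⟨ ℚ.+-identityʳ _ ⟨
  ∑< a f ℚ.+ 0ℚ                         ≤⟨ ℚ.+-monoʳ-≤ (∑< a f) (nonneg (b ∸ a)) ⟩
  ∑< a f ℚ.+ ∑< (b ∸ a) (f ∘ (λ i → a + i)) ≡⟨ ∑<-+ a (b ∸ a) f ⟨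
  ∑< (a + (b ∸ a)) f
    ≡⟨ cong (λ t → ∑< t f) (ℕ.m+[n∸m]≡n (ℕ.*-monoˡ-≤ (suc k) (ℕ.∸-monoˡ-≤ 1 m≤n))) ⟩
  ∑< b f                                ∎
  where
  open ℚ.≤-Reasoning
  f : ℕ → ℚ
  f i = recip (suc k + i)
  a = (m ∸ 1) * suc k
  b = (n ∸ 1) * suc k
  nonneg : ∀ l → 0ℚ ℚ.≤ ∑< l (f ∘ (λ i → a + i))
  nonneg zero    = ℚ.≤-refl
  nonneg (suc l) = ℚ.+-mono-≤ (nonneg l) (ℚ.nonNegative⁻¹ (f (a + l)))

-- suc (refined k y) = (y + 1)(k + 1)
refined : ℕ → ℕ → ℕ
refined k y = k + y * suc k

-- Put X = `suc x` and Y = `suc y`. The sum over [1, XY] splits at Y, and scaling by 1/Y turns the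
-- part over [Y, XY] into a sum over [1, X] of mesh 1/(Y(k + 1)). The functional equation thus holds
-- exactly, up to a change of mesh.
log-riemann-* : ∀ x y k → log-riemann (suc x * suc y) k ≡
  log-riemann (suc y) k ℚ.+ log-riemann (suc x) (refined k y)
log-riemann-* x y k = trans (cong (λ t → ∑< t f) terms)
  (trans (∑<-+ (y * suc k) (x * suc (refined k y)) f)
    (cong (∑< (y * suc k) f ℚ.+_) (∑<-cong (x * suc (refined k y))
      λ i → cong recip (sym (ℕ.+-assoc (suc k) (y * suc k) i)))))
  where
  f : ℕ → ℚ
  f i = recip (suc k + i)
  terms : (y + x * suc y) * suc k ≡ y * suc k + x * (suc y * suc k)
  terms = trans (ℕ.*-distribʳ-+ (suc k) y (x * suc y))
    (cong (λ t → y * suc k + t) (ℕ.*-assoc x (suc y) (suc k)))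

-- Right-endpoint sums of the decreasing function 1/t grow under refinement.
log-riemann-refined : ∀ x k y → log-riemann x k ℚ.≤ log-riemann x (refined k y)
log-riemann-refined x k y = ℚ.≤-trans (refine-≥ k y ((x ∸ 1) * suc k)) (ℚ.≤-reflexive
  (trans (cong (λ t → ∑< t (λ i → recip (suc k * suc y + i))) terms)
    (∑<-cong ((x ∸ 1) * suc (refined k y)) λ i → cong (λ t → recip (t + i)) (ℕ.*-comm (suc k) (suc y)))))
  where
  terms : (x ∸ 1) * suc k * suc y ≡ (x ∸ 1) * (suc y * suc k)
  terms = trans (ℕ.*-assoc (x ∸ 1) (suc k) (suc y)) (cong (λ t → (x ∸ 1) * t) (ℕ.*-comm (suc k) (suc y)))

log-riemann-^-≥ : ∀ x j k → fromℕ j ℚ.* log-riemann (suc x) k ℚ.≤ log-riemann (suc x ^ j) k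
log-riemann-^-≥ x zero    k = ℚ.≤-reflexive (ℚ.*-zeroˡ (log-riemann (suc x) k))
-- The power is matched as a successor, the form that `log-riemann-*` applies to.
log-riemann-^-≥ x (suc j) k with suc x ^ j | log-riemann-^-≥ x j k | ℕ.m^n≢0 (suc x) j
... | zero  | _  | nz = contradiction refl (ℕ.≢-nonZero⁻¹ 0 {{nz}})
... | suc y | ih | _  = begin
  fromℕ (suc j) ℚ.* L                                   ≡⟨ fromℕ-suc-* j L ⟩
  L ℚ.+ fromℕ j ℚ.* L                                   ≤⟨ ℚ.+-mono-≤ (log-riemann-refined (suc x) k y) ih ⟩
  log-riemann (suc x) (refined k y) ℚ.+ log-riemann (suc y) k
    ≡⟨ ℚ.+-comm (log-riemann (suc x) (refined k y)) _ ⟩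
  log-riemann (suc y) k ℚ.+ log-riemann (suc x) (refined k y)  ≡⟨ log-riemann-* x y k ⟨
  log-riemann (suc x * suc y) k                         ∎
  where
  open ℚ.≤-Reasoning
  L = log-riemann (suc x) k

-- By `log-close`, each of the `j` refined sums exceeds the one of mesh 1/(k + 1) by at most that
-- mesh.
log-riemann-^-≤ : ∀ x j k →
  log-riemann (suc x ^ j) k ℚ.≤ fromℕ j ℚ.* (recip k ℚ.+ log-riemann (suc x) k)
log-riemann-^-≤ x zero    k = ℚ.≤-reflexive (sym (ℚ.*-zeroˡ (recip k ℚ.+ log-riemann (suc x) k)))
log-riemann-^-≤ x (suc j) k with suc x ^ j | log-riemann-^-≤ x j k | ℕ.m^n≢0 (suc x) j
... | zero  | _  | nz = contradiction refl (ℕ.≢-nonZero⁻¹ 0 {{nz}})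
... | suc y | ih | _  = begin
  log-riemann (suc x * suc y) k                         ≡⟨ log-riemann-* x y k ⟩
  log-riemann (suc y) k ℚ.+ log-riemann (suc x) (refined k y)
    ≤⟨ ℚ.+-mono-≤ ih (log-close (suc x) (refined k y) k) ⟩
  fromℕ j ℚ.* L ℚ.+ L                                   ≡⟨ ℚ.+-comm _ L ⟩
  L ℚ.+ fromℕ j ℚ.* L                                   ≡⟨ fromℕ-suc-* j L ⟨
  fromℕ (suc j) ℚ.* L                                   ∎
  where
  open ℚ.≤-Reasoning
  L = recip k ℚ.+ log-riemann (suc x) k

log-compare : ∀ {x y} A B → 0 < x → 0 < y → x ^ A ≤ y ^ B → A ·ℝ log x ≤ℝ B ·ℝ log y
log-compare {suc x} {suc y} A B _ _ x^A≤y^B ε 0<ε with archimedean ε 0<ε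
... | q , 1/q≤ε = N , λ k N≤k → begin
  fromℕ A ℚ.* log-riemann (suc x) k                             ≤⟨ log-riemann-^-≥ x A k ⟩
  log-riemann (suc x ^ A) k                                     ≤⟨ log-riemann-monoˡ k x^A≤y^B ⟩
  log-riemann (suc y ^ B) k                                     ≤⟨ log-riemann-^-≤ y B k ⟩
  fromℕ B ℚ.* (recip k ℚ.+ log-riemann (suc y) k)
    ≡⟨ ℚ.*-distribˡ-+ (fromℕ B) (recip k) (log-riemann (suc y) k) ⟩
  fromℕ B ℚ.* recip k ℚ.+ fromℕ B ℚ.* log-riemann (suc y) k     ≤⟨ ℚ.+-monoˡ-≤ _ (error N≤k) ⟩
  ε ℚ.+ fromℕ B ℚ.* log-riemann (suc y) k                       ≡⟨ ℚ.+-comm ε _ ⟩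
  fromℕ B ℚ.* log-riemann (suc y) k ℚ.+ ε                       ∎
  where
  open ℚ.≤-Reasoning
  -- Then N + 1 = (q + 1)(B + 1), so B + 1 copies of 1/(N + 1) add up to exactly 1/(q + 1) ≤ ε.
  N = B + q * suc B
  error : ∀ {k} → N ≤ k → fromℕ B ℚ.* recip k ℚ.≤ ε
  error {k} N≤k = begin
    fromℕ B ℚ.* recip k                ≡⟨ ∑<-const B (recip k) ⟨
    ∑< B (const (recip k))             ≤⟨ ∑<-mono B (λ _ _ → recip-antitone N≤k) ⟩
    ∑< B (const (recip N))             ≡⟨ ℚ.+-identityʳ _ ⟨
    ∑< B (const (recip N)) ℚ.+ 0ℚ      ≤⟨ ℚ.+-monoʳ-≤ (∑< B (const (recip N))) (ℚ.nonNegative⁻¹ (recip N)) ⟩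
    ∑< (suc B) (const (recip N))       ≡⟨ ∑<-const-block q B ⟩
    recip q                            ≤⟨ 1/q≤ε ⟩
    ε                                  ∎

-- Arithmetic derivatives

prime-divisor : ∀ {n} → 1 < n → ∃[ p ] Prime p × p ∣ n
prime-divisor {n@(suc _)} 1<n with factorise n
... | record { factors = [] ; isFactorisation = n≡1 } = contradiction n≡1 (ℕ.>⇒≢ 1<n)
... | record { factors = p ∷ ps ; isFactorisation = n≡ ; factorsPrime = pp ∷ _ } =
  p , pp , subst (p ∣_) (sym n≡) (m∣m*n _)

prime∣prime⇒≡ : ∀ {p q} → Prime p → Prime q → p ∣ q → p ≡ q
prime∣prime⇒≡ pp qq p∣q with prime⇒irreducible qq p∣q
... | inj₁ refl = contradiction pp ¬prime[1]
... | inj₂ p≡q  = p≡q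

prime∤1 : ∀ {p} → Prime p → ¬ p ∣ 1
prime∤1 pp p∣1 with ∣1⇒≡1 p∣1
... | refl = ¬prime[1] pp

prime∣^⇒∣ : ∀ {p} m k → Prime p → p ∣ m ^ k → p ∣ m
prime∣^⇒∣ m zero    pp p∣1 = contradiction p∣1 (prime∤1 pp)
prime∣^⇒∣ m (suc k) pp p∣ with euclidsLemma m (m ^ k) pp p∣
... | inj₁ p∣m = p∣m
... | inj₂ p∣m^k = prime∣^⇒∣ m k pp p∣m^k

module _ (p n : ℕ) where

  private
    divides-⊔ : ∀ {ks} → All (λ k → p ^ k ∣ n) ks → p ^ foldr _⊔_ 0 ks ∣ n
    divides-⊔ []                = 1∣ n
    divides-⊔ {k ∷ ks} (k∣ ∷ ks∣) with ℕ.⊔-sel k (foldr _⊔_ 0 ks)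
    ... | inj₁ e = subst (λ j → p ^ j ∣ n) (sym e) k∣
    ... | inj₂ e = subst (λ j → p ^ j ∣ n) (sym e) (divides-⊔ ks∣)

    ∈⇒≤⊔ : ∀ {k ks} → k ∈ ks → k ≤ foldr _⊔_ 0 ks
    ∈⇒≤⊔ (here refl) = ℕ.m≤m⊔n _ _
    ∈⇒≤⊔ (there k∈)  = ℕ.≤-trans (∈⇒≤⊔ k∈) (ℕ.m≤n⊔m _ _)

  p^v∣n : p ^ v p n ∣ n
  p^v∣n = divides-⊔ (All.all-filter (λ k → p ^ k ∣? n) (upTo (suc n)))

  ∣⇒v>0 : 0 < n → p ∣ n → 0 < v p n
  ∣⇒v>0 n>0 p∣n = ∈⇒≤⊔ (∈.∈-filter⁺ (λ k → p ^ k ∣? n) (∈.∈-upTo⁺ (s≤s n>0))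
    (subst (_∣ n) (sym (ℕ.^-identityʳ p)) p∣n))

  ∤⇒v≡0 : ¬ p ∣ n → v p n ≡ 0
  ∤⇒v≡0 p∤n with v p n | p^v∣n
  ... | zero  | _    = refl
  ... | suc k | p^∣n = contradiction (∣-trans (m∣m*n (p ^ k)) p^∣n) p∤n

∂ : ℕ → ℙ → ℕ
∂ m (p , p-prime) = (m * v p m) ℕ./ p
  where instance _ = prime⇒nonZero p-prime

∂/∂ξ≡∂ : ∀ m p → ∂/∂ξ (+ m) p ≡ + ∂ m p
∂/∂ξ≡∂ m (p , p-prime) = cong (ℤ._/ℕ p) (sym (ℤ.pos-* m (v p m)))
  where instance _ = prime⇒nonZero p-prime

p*∂ : ∀ m p → proj₁ p * ∂ m p ≡ m * v (proj₁ p) m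
p*∂ m (p , p-prime) = ℕ.m*[n/m]≡n p∣
  where
  instance _ = prime⇒nonZero p-prime
  p∣ : p ∣ m * v p m
  p∣ with v p m | p^v∣n p m
  ... | zero  | _    = subst (p ∣_) (sym (ℕ.*-zeroʳ m)) (p ∣0)
  ... | suc k | p^∣m = ∣m⇒∣m*n (suc k) (∣-trans (m∣m*n (p ^ k)) p^∣m)

∤⇒∂≡0 : ∀ m p → ¬ proj₁ p ∣ m → ∂ m p ≡ 0
∤⇒∂≡0 m (p , p-prime) p∤m = trans (cong (λ k → (m * k) ℕ./ p) (∤⇒v≡0 p m p∤m))
  (trans (cong (ℕ._/ p) (ℕ.*-zeroʳ m)) (ℕ.0/n≡0 p))
  where instance _ = prime⇒nonZero p-prime

∣⇒∂>0 : ∀ m p → 0 < m → proj₁ p ∣ m → 0 < ∂ m p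
∣⇒∂>0 m q@(p , _) m>0 p∣m = ℕ.n≢0⇒n>0 λ ∂≡0 → ℕ.<⇒≢ (ℕ.*-mono-< m>0 (∣⇒v>0 p m m>0 p∣m))
  (sym (trans (sym (p*∂ m q)) (trans (cong (p *_) ∂≡0) (ℕ.*-zeroʳ p))))

Distinct : List ℙ → Set
Distinct = AllPairs (_≢_ on proj₁)

-- Primality proofs are equal by definition.
ℙ-≡ : ∀ {p q : ℙ} → proj₁ p ≡ proj₁ q → p ≡ q
ℙ-≡ refl = refl

-- It will be used with the primes of abc and `m` one of a, b, c; primes not dividing `m` contribute
-- the factor 1.
primaryParts : ℕ → List ℙ → ℕ
primaryParts m []       = 1
primaryParts m (p ∷ ps) = proj₁ p ^ v (proj₁ p) m * primaryParts m ps

∣primaryParts⇒∈ : ∀ m ps (p : ℙ) → proj₁ p ∣ primaryParts m ps → p ∈ ps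
∣primaryParts⇒∈ m []       p p∣ = contradiction p∣ (prime∤1 (proj₂ p))
∣primaryParts⇒∈ m (q ∷ ps) p p∣
  with euclidsLemma (proj₁ q ^ v (proj₁ q) m) (primaryParts m ps) (proj₂ p) p∣
... | inj₁ p∣q^ = here (ℙ-≡ (prime∣prime⇒≡ (proj₂ p) (proj₂ q)
  (prime∣^⇒∣ (proj₁ q) (v (proj₁ q) m) (proj₂ p) p∣q^)))
... | inj₂ p∣ps = there (∣primaryParts⇒∈ m ps p p∣ps)

prime-power-cancel : ∀ {p} k b q → Prime p → ¬ p ∣ b → p ^ k ∣ q * b → p ^ k ∣ q
prime-power-cancel zero    b q pp p∤b _  = 1∣ q
prime-power-cancel {p} (suc k) b q pp p∤b p^∣ with euclidsLemma q b pp (∣-trans (m∣m*n (p ^ k)) p^∣)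
... | inj₂ p∣b = contradiction p∣b p∤b
... | inj₁ (divides q′ refl) = subst (p ^ suc k ∣_) (ℕ.*-comm p q′)
  (*-monoʳ-∣ p (prime-power-cancel k b q′ pp p∤b (*-cancelˡ-∣ p (subst (p * p ^ k ∣_) (lemma q′ p b) p^∣))))
  where
  instance _ = prime⇒nonZero pp
  lemma : ∀ q p b → q * p * b ≡ p * (q * b)
  lemma = ℕSolver.solve-∀

-- By induction `m` is a multiple of the product over the tail. That product is prime to the new
-- `p`, so p^vₚ(m) divides the cofactor.
primaryParts-∣ : ∀ m ps → Distinct ps → primaryParts m ps ∣ m
primaryParts-∣ m []       _        = 1∣ m
primaryParts-∣ m (p ∷ ps) (p∉ ∷ d) with primaryParts-∣ m ps d
... | divides q m≡ = subst (primaryParts m (p ∷ ps) ∣_) (sym m≡) (*-monoˡ-∣ (primaryParts m ps)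
  (prime-power-cancel (v (proj₁ p) m) (primaryParts m ps) q (proj₂ p)
    (λ p∣ → All.lookup p∉ (∣primaryParts⇒∈ m ps p p∣) refl)
    (subst (proj₁ p ^ v (proj₁ p) m ∣_) m≡ (p^v∣n (proj₁ p) m))))

total : (ℙ → ℕ) → List ℙ → ℕ
total f ps = Vec.sum (Vec.map f (fromList ps))

-- Equality holds at p = 2; this is the source of the factor 2 log 2.
4≤p^p : ∀ {p} → 2 ≤ p → 4 ≤ p ^ p
4≤p^p {p} 2≤p = ℕ.≤-trans (ℕ.^-monoˡ-≤ 2 2≤p) (ℕ.^-monoʳ-≤ p {{ℕ.>-nonZero (ℕ.<⇒≤ 2≤p)}} 2≤p)

-- 4^∂ₚ ≤ (p^p)^∂ₚ = (p^vₚ)^m since 4 ≤ p^p.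
4^total-∂ : ∀ m ps → 4 ^ total (∂ m) ps ≤ primaryParts m ps ^ m
4^total-∂ m []       = ℕ.≤-reflexive (sym (ℕ.^-zeroˡ m))
4^total-∂ m (p ∷ ps) = begin
  4 ^ (∂ m p + total (∂ m) ps)                  ≡⟨ ℕ.^-distribˡ-+-* 4 (∂ m p) _ ⟩
  4 ^ ∂ m p * 4 ^ total (∂ m) ps                ≤⟨ ℕ.*-mono-≤ local (4^total-∂ m ps) ⟩
  (π ^ k) ^ m * primaryParts m ps ^ m           ≡⟨ ^-distribʳ-* (π ^ k) _ m ⟨
  (π ^ k * primaryParts m ps) ^ m               ∎
  where
  open ℕ.≤-Reasoning
  π = proj₁ p
  k = v π m
  local : 4 ^ ∂ m p ≤ (π ^ k) ^ m
  local = begin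
    4 ^ ∂ m p           ≤⟨ ℕ.^-monoˡ-≤ (∂ m p) (4≤p^p (ℕ.nonTrivial⇒n>1 π {{prime⇒nonTrivial (proj₂ p)}})) ⟩
    (π ^ π) ^ ∂ m p     ≡⟨ ℕ.^-*-assoc π π (∂ m p) ⟩
    π ^ (π * ∂ m p)     ≡⟨ cong (π ^_) (trans (p*∂ m p) (ℕ.*-comm m k)) ⟩
    π ^ (k * m)         ≡⟨ ℕ.^-*-assoc π k m ⟨
    (π ^ k) ^ m         ∎

4^total-∂≤m^m : ∀ m ps → 0 < m → Distinct ps → 4 ^ total (∂ m) ps ≤ m ^ m
4^total-∂≤m^m m ps m>0 d = ℕ.≤-trans (4^total-∂ m ps)
  (ℕ.^-monoˡ-≤ m (∣⇒≤ {{ℕ.>-nonZero m>0}} (primaryParts-∣ m ps d)))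

map-proj₁-toList : ∀ {P : ℕ → Set} {xs} (pxs : All P xs) → List.map proj₁ (All.toList pxs) ≡ xs
map-proj₁-toList []         = refl
map-proj₁-toList (px ∷ pxs) = cong (_ ∷_) (map-proj₁-toList pxs)

primesUpTo≡ : ∀ n → List.map proj₁ (primesUpTo n) ≡ filter prime? (upTo (suc n))
primesUpTo≡ n = map-proj₁-toList (All.all-filter prime? (upTo (suc n)))

supp-distinct : ∀ n → Distinct (supp n)
supp-distinct n = AllPairs.filter⁺ _ (AllPairs.map⁻ (subst (AllPairs _≢_) (sym (primesUpTo≡ n))
  (Unique.filter⁺ prime? (Unique.upTo⁺ (suc n)))))

∈-primesUpTo : ∀ {n} (p : ℙ) → proj₁ p ≤ n → p ∈ primesUpTo n
∈-primesUpTo {n} p p≤n with ∈.∈-map⁻ proj₁ (subst (proj₁ p ∈_) (sym (primesUpTo≡ n))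
  (∈.∈-filter⁺ prime? (∈.∈-upTo⁺ (s≤s p≤n)) (proj₂ p)))
... | q , q∈ , p≡q = subst (_∈ primesUpTo n) (ℙ-≡ (sym p≡q)) q∈

∈-supp : ∀ {n} → 0 < n → (p : ℙ) → proj₁ p ∣ n → p ∈ supp n
∈-supp n>0 p p∣n = ∈.∈-filter⁺ _ (∈-primesUpTo p (∣⇒≤ {{ℕ.>-nonZero n>0}} p∣n)) p∣n

two-elements : ∀ {A : Set} {x y : A} {xs} → x ∈ xs → y ∈ xs → x ≢ y → 2 ≤ length xs
two-elements {xs = _ ∷ []}    (here refl) (here refl) x≢y = contradiction refl x≢y
two-elements {xs = _ ∷ _ ∷ _} _           _           _   = s≤s (s≤s z≤n)

coeff-cons : ∀ q k p xs → coeff q ((k , p) ∷ xs) ≡ k ℤ.* coeff q (ξ p) ℤ.+ coeff q xs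
coeff-cons q k (p , _) xs with q ℕ.≟ p
... | yes _ = cong (ℤ._+ coeff q xs) (sym (ℤ.*-identityʳ k))
... | no  _ = sym (trans (cong (ℤ._+ coeff q xs) (ℤ.*-zeroʳ k)) (ℤ.+-identityˡ _))

coeff-ξ-≢ : ∀ {q} (p : ℙ) → q ≢ proj₁ p → coeff q (ξ p) ≡ 0ℤ
coeff-ξ-≢ {q} p q≢p with q ℕ.≟ proj₁ p
... | yes q≡p = contradiction q≡p q≢p
... | no  _   = refl

coeff-ξ-≡ : ∀ (p : ℙ) → coeff (proj₁ p) (ξ p) ≡ 1ℤ
coeff-ξ-≡ p with proj₁ p ℕ.≟ proj₁ p
... | yes _   = refl
... | no  p≢p = contradiction refl p≢p

module _ (f : ℙ → ℤ) where

  formalSum : List ℙ → LeftModule.Carrierᴹ Ω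
  formalSum ps = foldr (LeftModule._+ᴹ_ Ω) (LeftModule.0ᴹ Ω)
    (List.map (λ p → LeftModule._*ₗ_ Ω (f p) (ξ p)) ps)

  coeff-formalSum-∉ : ∀ {ps} (q : ℙ) → q ∉ ps → coeff (proj₁ q) (formalSum ps) ≡ 0ℤ
  coeff-formalSum-∉ {[]}     q _ = refl
  coeff-formalSum-∉ {p ∷ ps} q q∉ = trans (coeff-cons (proj₁ q) (f p ℤ.* 1ℤ) p (formalSum ps))
    (trans (cong₂ (λ a b → f p ℤ.* 1ℤ ℤ.* a ℤ.+ b) (coeff-ξ-≢ p (λ e → q∉ (here (ℙ-≡ e))))
      (coeff-formalSum-∉ q (q∉ ∘ there))) (trans (ℤ.+-identityʳ _) (ℤ.*-zeroʳ (f p ℤ.* 1ℤ))))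

  coeff-formalSum-∈ : ∀ {ps} (q : ℙ) → Distinct ps → q ∈ ps → coeff (proj₁ q) (formalSum ps) ≡ f q
  coeff-formalSum-∈ {p ∷ ps} q (p∉ ∷ _) (here refl) = trans (coeff-cons (proj₁ p) (f p ℤ.* 1ℤ) p (formalSum ps))
    (trans (cong₂ (λ a b → f p ℤ.* 1ℤ ℤ.* a ℤ.+ b) (coeff-ξ-≡ p)
      (coeff-formalSum-∉ p λ p∈ → All.lookup p∉ p∈ refl))
      (trans (ℤ.+-identityʳ _) (trans (ℤ.*-identityʳ _) (ℤ.*-identityʳ (f p)))))
  coeff-formalSum-∈ {p ∷ ps} q (p∉ ∷ d) (there q∈) = trans (coeff-cons (proj₁ q) (f p ℤ.* 1ℤ) p (formalSum ps))
    (trans (cong₂ (λ a b → f p ℤ.* 1ℤ ℤ.* a ℤ.+ b) (coeff-ξ-≢ p (≢-sym (All.lookup p∉ q∈)))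
      (coeff-formalSum-∈ q d q∈)) (trans (cong (ℤ._+ f q) (ℤ.*-zeroʳ (f p ℤ.* 1ℤ))) (ℤ.+-identityˡ (f q))))

-- It covers every prime: off the support of `m` both sides are 0.
coeff-d : ∀ m (q : ℙ) → 0 < m → coeff (proj₁ q) (d (+ m)) ≡ + ∂ m q
coeff-d m@(suc _) q m>0 with proj₁ q ∣? m
... | yes q∣m = trans (coeff-formalSum-∈ (∂/∂ξ (+ m)) q (supp-distinct m) (∈-supp m>0 q q∣m)) (∂/∂ξ≡∂ m q)
... | no  q∤m = trans (coeff-formalSum-∉ (∂/∂ξ (+ m)) q λ q∈ → q∤m (proj₂ (∈.∈-filter⁻ _ {xs = primesUpTo m} q∈)))
  (cong +_ (sym (∤⇒∂≡0 m q q∤m)))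

-- Derivations as vectors

dot-comm : ∀ {n} (x y : Vec ℤ n) → dot x y ≡ dot y x
dot-comm []      []      = refl
dot-comm (a ∷ x) (b ∷ y) = cong₂ ℤ._+_ (ℤ.*-comm a b) (dot-comm x y)

dot-𝟘ʳ : ∀ {n} (x : Vec ℤ n) → dot x 𝟘 ≡ 0ℤ
dot-𝟘ʳ x = cong head (0-homo (dot-linear x))

dot-𝟙 : ∀ {n} (w : Vec ℕ n) → dot (map +_ w) (replicate n 1ℤ) ≡ + sum w
dot-𝟙 []      = refl
dot-𝟙 (a ∷ w) = cong₂ ℤ._+_ (ℤ.*-identityʳ (+ a)) (dot-𝟙 w)

∣lookup∣≤norm : ∀ {n} (x : Vec ℤ n) i → ∣ lookup x i ∣ ≤ norm x
∣lookup∣≤norm (a ∷ x) zero    = ℕ.m≤m⊔n _ _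
∣lookup∣≤norm (a ∷ x) (suc i) = ℕ.≤-trans (∣lookup∣≤norm x i) (ℕ.m≤n⊔m _ _)

combination-linear : ∀ {n r} (xs : Vec (Vec ℤ n) r) → IsLinear (λ c → combination c xs)
combination-linear xs = record { +-homo = add xs ; *-homo = mul xs }
  where
  open import Algebra.Properties.CommutativeSemigroup ℤ.+-commutativeSemigroup using (interchange)
  ⊕-interchange : ∀ {n} (x y z w : Vec ℤ n) → (x ⊕ y) ⊕ (z ⊕ w) ≡ (x ⊕ z) ⊕ (y ⊕ w)
  ⊕-interchange []      []      []      []      = refl
  ⊕-interchange (a ∷ x) (b ∷ y) (c ∷ z) (d ∷ w) = cong₂ _∷_ (interchange a b c d) (⊕-interchange x y z w)
  add : ∀ {n r} (xs : Vec (Vec ℤ n) r) c d → combination (c ⊕ d) xs ≡ combination c xs ⊕ combination d xs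
  add []       []      []      = sym (⊕-identityˡ 𝟘)
  add (x ∷ xs) (a ∷ c) (b ∷ d) = trans (cong₂ _⊕_ (∙-distribʳ-⊕ a b x) (add xs c d))
    (⊕-interchange (a ∙ x) (b ∙ x) (combination c xs) (combination d xs))
  mul : ∀ {n r} (xs : Vec (Vec ℤ n) r) k c → combination (k ∙ c) xs ≡ k ∙ combination c xs
  mul []       k []      = sym (∙-zeroʳ k)
  mul (x ∷ xs) k (a ∷ c) = trans (cong₂ _⊕_ (∙-assoc k a x) (mul xs k c))
    (sym (∙-distribˡ-⊕ k (a ∙ x) (combination c xs)))

dot-combination : ∀ {n r} (w : Vec ℤ n) c (xs : Vec (Vec ℤ n) r) →
  dot w (combination c xs) ≡ dot c (map (dot w) xs)
dot-combination w []      []       = dot-𝟘ʳ w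
dot-combination w (k ∷ c) (x ∷ xs) = trans (dot-⊕ʳ w (k ∙ x) (combination c xs))
  (cong₂ ℤ._+_ (dot-∙ʳ k w x) (dot-combination w c xs))

-- Together with 𝟙 ∉ w^⊥ the vectors would be independent in ℤⁿ.
hyperplane-dependent : ∀ {n k} (w : Vec ℕ n) → 0 < sum w → n ≤ k → (xs : Vec (Vec ℤ n) k) →
  (∀ i → dot (map +_ w) (lookup xs i) ≡ 0ℤ) → ∃[ c ] c ≢ 𝟘 × combination c xs ≡ 𝟘
hyperplane-dependent {n} w w>0 n≤k xs xs⊥
  with kernel-nontrivial (s≤s n≤k) _ (combination-linear (replicate n 1ℤ ∷ xs))
... | t ∷ c , tc≢0 , e = c , (λ c≡0 → tc≢0 (cong₂ _∷_ t≡0 c≡0)) , (begin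
  combination c xs                               ≡⟨ ⊕-identityˡ _ ⟨
  𝟘 ⊕ combination c xs                           ≡⟨ cong (_⊕ combination c xs) (∙-zeroˡ 𝟙) ⟨
  0ℤ ∙ 𝟙 ⊕ combination c xs                      ≡⟨ cong (λ t → t ∙ 𝟙 ⊕ combination c xs) t≡0 ⟨
  t ∙ 𝟙 ⊕ combination c xs                       ≡⟨ e ⟩
  𝟘                                              ∎)
  where
  open ≡-Reasoning
  𝟙 = replicate n 1ℤ
  W = map +_ w
  dots-0 : ∀ {k} (c : Vec ℤ k) (xs : Vec (Vec ℤ n) k) → (∀ i → dot W (lookup xs i) ≡ 0ℤ) →
    dot c (map (dot W) xs) ≡ 0ℤ
  dots-0 []      []       _   = refl
  dots-0 (a ∷ c) (x ∷ xs) xs⊥ = cong₂ ℤ._+_ (trans (cong (a ℤ.*_) (xs⊥ zero)) (ℤ.*-zeroʳ a))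
    (dots-0 c xs (xs⊥ ∘ suc))
  -- Pairing the relation with `w` kills all of `xs` and leaves t ∑ wⱼ.
  t*sum : t ℤ.* + sum w ≡ 0ℤ
  t*sum = begin
    t ℤ.* + sum w                                       ≡⟨ ℤ.+-identityʳ _ ⟨
    t ℤ.* + sum w ℤ.+ 0ℤ
      ≡⟨ cong₂ (λ a b → t ℤ.* a ℤ.+ b) (dot-𝟙 w) (dots-0 c xs xs⊥) ⟨
    dot (t ∷ c) (map (dot W) (𝟙 ∷ xs))                  ≡⟨ dot-combination W (t ∷ c) (𝟙 ∷ xs) ⟨
    dot W (combination (t ∷ c) (𝟙 ∷ xs))                ≡⟨ cong (dot W) e ⟩
    dot W 𝟘                                             ≡⟨ dot-𝟘ʳ W ⟩
    0ℤ                                                  ∎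
  t≡0 : t ≡ 0ℤ
  t≡0 with ℤ.i*j≡0⇒i≡0∨j≡0 t t*sum
  ... | inj₁ t≡0 = t≡0
  ... | inj₂ w≡0 = contradiction (ℤ.+-injective w≡0) (ℕ.n>0⇒n≢0 w>0)

minima-kernel : ∀ {n} {φ : Vec ℤ n → Vec ℤ 1} {r τ s} (F : Flag φ r τ s) i → φ (lookup (minima φ F) i) ≡ 𝟘
minima-kernel (step x _ φx _ _ _ _ _ F) zero    = φx
minima-kernel (step x _ φx _ _ _ _ _ F) (suc i) = minima-kernel F i

∏-lookup : ∀ {n r} (xs : Vec (Vec ℤ n) r) → ∏ (λ i → norm (lookup xs i)) ≡ product (map norm xs)
∏-lookup []       = refl
∏-lookup (x ∷ xs) = cong (norm x *_) (∏-lookup xs)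

open LeftModuleMorphisms (LeftModule.rawLeftModule Ω) (LeftModule.rawLeftModule ℤ¹)
  using (module IsLeftModuleHomomorphism)

∣Ω∣ : Set
∣Ω∣ = LeftModule.Carrierᴹ Ω

module Coordinates (ε : ℙ → ℤ) (ε-unit : ∀ p → ε p ≡ 1ℤ ⊎ ε p ≡ -1ℤ) where

  ∣ε*∣ : ∀ p z → ∣ ε p ℤ.* z ∣ ≡ ∣ z ∣
  ∣ε*∣ p z with ε p | ε-unit p
  ... | _ | inj₁ refl = cong ∣_∣ (ℤ.*-identityˡ z)
  ... | _ | inj₂ refl = trans (cong ∣_∣ (ℤ.-1*i≡-i z)) (ℤ.∣-i∣≡∣i∣ z)

  ε*ε* : ∀ p z → ε p ℤ.* (ε p ℤ.* z) ≡ z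
  ε*ε* p z with ε p | ε-unit p
  ... | _ | inj₁ refl = trans (ℤ.*-identityˡ _) (ℤ.*-identityˡ z)
  ... | _ | inj₂ refl = trans (ℤ.-1*i≡-i _) (trans (cong ℤ.-_ (ℤ.-1*i≡-i z)) (ℤ.neg-involutive z))

  -- A vector x will stand for the linear map z ↦ x · `coords ps z`, whose value at ξₚ is εₚ xₚ. The
  -- signs are those that make the coefficients of the equation nonnegative.
  coords : ∀ ps → ∣Ω∣ → Vec ℤ (length ps)
  coords ps z = map (λ p → ε p ℤ.* coeff (proj₁ p) z) (fromList ps)

  coords-cong : ∀ ps {y z} → (∀ q → coeff q y ≡ coeff q z) → coords ps y ≡ coords ps z
  coords-cong ps e = Vec.map-cong (λ p → cong (ε p ℤ.*_) (e (proj₁ p))) (fromList ps)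

  coords-++ : ∀ ps y z → coords ps (y List.++ z) ≡ coords ps y ⊕ coords ps z
  coords-++ []       y z = refl
  coords-++ (p ∷ ps) y z = cong₂ _∷_
    (trans (cong (ε p ℤ.*_) (coeff-++ (proj₁ p) y z)) (ℤ.*-distribˡ-+ (ε p) _ _)) (coords-++ ps y z)

  coords-scale : ∀ ps k z → coords ps (scale k z) ≡ k ∙ coords ps z
  coords-scale []       k z = refl
  coords-scale (p ∷ ps) k z = cong₂ _∷_
    (trans (cong (ε p ℤ.*_) (coeff-scale (proj₁ p) k z)) (swap (ε p) k (coeff (proj₁ p) z))) (coords-scale ps k z)
    where
    swap : ∀ a b c → a ℤ.* (b ℤ.* c) ≡ b ℤ.* (a ℤ.* c)
    swap = solve-∀

  coords-[] : ∀ ps → coords ps [] ≡ 𝟘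
  coords-[] []       = refl
  coords-[] (p ∷ ps) = cong₂ _∷_ (ℤ.*-zeroʳ (ε p)) (coords-[] ps)

  coords-ξ-∉ : ∀ ps (p : ℙ) → p ∉ ps → coords ps (ξ p) ≡ 𝟘
  coords-ξ-∉ []       p _  = refl
  coords-ξ-∉ (q ∷ ps) p p∉ = cong₂ _∷_
    (trans (cong (ε q ℤ.*_) (coeff-ξ-≢ p λ q≡p → p∉ (here (ℙ-≡ (sym q≡p))))) (ℤ.*-zeroʳ (ε q)))
    (coords-ξ-∉ ps p (p∉ ∘ there))

  dot-ξ-∉ : ∀ ps x p → p ∉ ps → dot x (coords ps (ξ p)) ≡ 0ℤ
  dot-ξ-∉ ps x p p∉ = trans (cong (dot x) (coords-ξ-∉ ps p p∉)) (dot-𝟘ʳ x)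

  dot-ξ-∈ : ∀ {ps} → Distinct ps → ∀ x {p} (p∈ : p ∈ ps) →
    dot x (coords ps (ξ p)) ≡ ε p ℤ.* lookup x (Any.index p∈)
  dot-ξ-∈ {p ∷ ps} (p∉ ∷ _) (a ∷ x) (here refl) = trans
    (cong₂ (λ b c → a ℤ.* (ε p ℤ.* b) ℤ.+ c) (coeff-ξ-≡ p) (dot-ξ-∉ ps x p λ p∈ → All.lookup p∉ p∈ refl))
    (lemma a (ε p))
    where
    lemma : ∀ a e → a ℤ.* (e ℤ.* 1ℤ) ℤ.+ 0ℤ ≡ e ℤ.* a
    lemma = solve-∀
  dot-ξ-∈ {q ∷ ps} (q∉ ∷ d) (a ∷ x) {p} (there p∈) = trans
    (cong₂ (λ b c → a ℤ.* (ε q ℤ.* b) ℤ.+ c) (coeff-ξ-≢ p (All.lookup q∉ p∈)) (dot-ξ-∈ d x p∈))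
    (lemma a (ε q) _)
    where
    lemma : ∀ a e z → a ℤ.* (e ℤ.* 0ℤ) ℤ.+ z ≡ z
    lemma = solve-∀

  _∈?_ : ∀ (p : ℙ) ps → Dec (p ∈ ps)
  p ∈? ps with Any.any? (λ q → proj₁ p ℕ.≟ proj₁ q) ps
  ... | yes p∈ = yes (Any.map ℙ-≡ p∈)
  ... | no  p∉ = no (p∉ ∘ Any.map (cong proj₁))

  ∣dot-ξ∣≤norm : ∀ {ps} → Distinct ps → ∀ x p → ∣ dot x (coords ps (ξ p)) ∣ ≤ norm x
  ∣dot-ξ∣≤norm {ps} d x p with p ∈? ps
  ... | yes p∈ = ℕ.≤-trans (ℕ.≤-reflexive (trans (cong ∣_∣ (dot-ξ-∈ d x p∈)) (∣ε*∣ p _))) (∣lookup∣≤norm x _)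
  ... | no  p∉ = ℕ.≤-trans (ℕ.≤-reflexive (cong ∣_∣ (dot-ξ-∉ ps x p p∉))) z≤n

  -- Every coordinate of `x` is, up to sign, a value at some ξₚ. With `∣dot-ξ∣≤norm`, this
  -- identifies the norm of the derivation with that of its vector.
  norm≤ : ∀ {ps} → Distinct ps → ∀ x u → (∀ p → ∣ dot x (coords ps (ξ p)) ∣ ≤ u) → norm x ≤ u
  norm≤ {ps} d x u bound = go ps x λ {p} p∈ →
    ℕ.≤-trans (ℕ.≤-reflexive (sym (trans (cong ∣_∣ (dot-ξ-∈ d x p∈)) (∣ε*∣ p _)))) (bound p)
    where
    go : ∀ ps (x : Vec ℤ (length ps)) → (∀ {p} (p∈ : p ∈ ps) → ∣ lookup x (Any.index p∈) ∣ ≤ u) → norm x ≤ u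
    go []       []      _     = z≤n
    go (p ∷ ps) (a ∷ x) bound = ℕ.⊔-lub (bound (here refl)) (go ps x (bound ∘ there))

  derivation : ∀ {ps} → Distinct ps → Vec ℤ (length ps) → Derivation
  derivation {ps} D x = ((λ z → dot x (coords ps z)) , linear Ω
      (λ {y} {z} e → cong (dot x) (coords-cong ps {y} {z} e))
      (λ y z → trans (cong (dot x) (coords-++ ps y z)) (dot-⊕ʳ x _ _))
      (trans (cong (dot x) (coords-[] ps)) (dot-𝟘ʳ x))
      (λ z → trans (scaled -1ℤ z) (ℤ.-1*i≡-i _))
      scaled)
    , norm x , ∣dot-ξ∣≤norm D x
    where
    scaled : ∀ k z → dot x (coords ps (scale k z)) ≡ k ℤ.* dot x (coords ps z)
    scaled k z = trans (cong (dot x) (coords-scale ps k z)) (dot-∙ʳ k x _)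

  values : ∀ ps → (∣Ω∣ → ℤ) → Vec ℤ (length ps)
  values ps f = map (λ p → ε p ℤ.* f (ξ p)) (fromList ps)

  lookup-values : ∀ {ps} f {p} (p∈ : p ∈ ps) → lookup (values ps f) (Any.index p∈) ≡ ε p ℤ.* f (ξ p)
  lookup-values f (here refl) = refl
  lookup-values f (there p∈)  = lookup-values f p∈

  linear≡dot : ∀ {ps f} → Distinct ps → Linear Ω f → (∀ p → p ∉ ps → f (ξ p) ≡ 0ℤ) →
    ∀ z → f z ≡ dot (values ps f) (coords ps z)
  linear≡dot {ps} {f} D L off [] = trans (IsLeftModuleHomomorphism.0ᴹ-homo L)
    (sym (trans (cong (dot (values ps f)) (coords-[] ps)) (dot-𝟘ʳ (values ps f))))
  linear≡dot {ps} {f} D L off ((k , p) ∷ z) = begin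
    f ((k , p) ∷ z)                              ≡⟨ H.⟦⟧-cong {(k , p) ∷ z} {scale k (ξ p) List.++ z} split ⟩
    f (scale k (ξ p) List.++ z)                  ≡⟨ H.+ᴹ-homo (scale k (ξ p)) z ⟩
    f (scale k (ξ p)) ℤ.+ f z                    ≡⟨ cong (ℤ._+ f z) (H.*ₗ-homo k (ξ p)) ⟩
    k ℤ.* f (ξ p) ℤ.+ f z                        ≡⟨ cong₂ (λ a b → k ℤ.* a ℤ.+ b) at-ξ (linear≡dot D L off z) ⟩
    k ℤ.* dot x (c (ξ p)) ℤ.+ dot x (c z)        ≡⟨ cong (ℤ._+ dot x (c z)) (dot-∙ʳ k x (c (ξ p))) ⟨
    dot x (k ∙ c (ξ p)) ℤ.+ dot x (c z)          ≡⟨ dot-⊕ʳ x (k ∙ c (ξ p)) (c z) ⟨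
    dot x (k ∙ c (ξ p) ⊕ c z)                    ≡⟨ cong (λ u → dot x (u ⊕ c z)) (coords-scale ps k (ξ p)) ⟨
    dot x (c (scale k (ξ p)) ⊕ c z)              ≡⟨ cong (dot x) (coords-++ ps (scale k (ξ p)) z) ⟨
    dot x (c (scale k (ξ p) List.++ z))
      ≡⟨ cong (dot x) (coords-cong ps {(k , p) ∷ z} {scale k (ξ p) List.++ z} split) ⟨
    dot x (c ((k , p) ∷ z))                      ∎
    where
    open ≡-Reasoning
    module H = IsLeftModuleHomomorphism L
    x = values ps f
    c = coords ps
    -- The two sides agree in Ω but not as lists: the scaled symbol has the coefficient `k ℤ.* 1ℤ`.
    split : ∀ q → coeff q ((k , p) ∷ z) ≡ coeff q (scale k (ξ p) List.++ z)
    split q = trans (coeff-cons q k p z)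
      (sym (trans (coeff-cons q (k ℤ.* 1ℤ) p z)
        (cong (λ a → a ℤ.* coeff q (ξ p) ℤ.+ coeff q z) (ℤ.*-identityʳ k))))
    at-ξ : f (ξ p) ≡ dot x (c (ξ p))
    at-ξ with p ∈? ps
    ... | yes p∈ = sym (trans (dot-ξ-∈ D x p∈) (trans (cong (ε p ℤ.*_) (lookup-values f p∈)) (ε*ε* p (f (ξ p)))))
    ... | no  p∉ = trans (off p p∉) (sym (dot-ξ-∉ ps x p p∉))

module _ {a b : ℕ} where

  private
    M = 𝒯⟨ a , b ⟩
  open LeftModule M using (Carrierᴹ; _*ₗ_; +ᴹ-rawMonoid)

  eval : Carrierᴹ → ∣Ω∣ → ℤ
  eval ψ z = proj₁ ψ · z

  eval-∑ : ∀ {n r} (C : ∣Ω∣ → Vec ℤ n) (c : Fin r → ℤ) (ψ : Fin r → Carrierᴹ) (xs : Vec (Vec ℤ n) r) →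
    (∀ i z → eval (ψ i) z ≡ dot (lookup xs i) (C z)) →
    ∀ z → eval (∑ +ᴹ-rawMonoid (λ i → c i *ₗ ψ i)) z ≡ dot (combination (tabulate c) xs) (C z)
  eval-∑ C c ψ []       ψ≡ z = sym (trans (dot-comm 𝟘 (C z)) (dot-𝟘ʳ (C z)))
  eval-∑ C c ψ (x ∷ xs) ψ≡ z = begin
    c zero ℤ.* eval (ψ zero) z ℤ.+ eval (∑ +ᴹ-rawMonoid (λ i → c (suc i) *ₗ ψ (suc i))) z
      ≡⟨ cong₂ (λ u w → c zero ℤ.* u ℤ.+ w) (trans (ψ≡ zero z) (dot-comm x (C z)))
           (trans (eval-∑ C (c ∘ suc) (ψ ∘ suc) xs (ψ≡ ∘ suc) z) (dot-comm y (C z))) ⟩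
    c zero ℤ.* dot (C z) x ℤ.+ dot (C z) y          ≡⟨ cong (ℤ._+ dot (C z) y) (dot-∙ʳ (c zero) (C z) x) ⟨
    dot (C z) (c zero ∙ x) ℤ.+ dot (C z) y          ≡⟨ dot-⊕ʳ (C z) (c zero ∙ x) y ⟨
    dot (C z) (c zero ∙ x ⊕ y)                      ≡⟨ dot-comm (C z) _ ⟩
    dot (c zero ∙ x ⊕ y) (C z)                      ∎
    where
    open ≡-Reasoning
    y = combination (tabulate (c ∘ suc)) xs

lookup-𝟘 : ∀ {n} (x : Vec ℤ n) → (∀ i → lookup x i ≡ 0ℤ) → x ≡ 𝟘
lookup-𝟘 []      _ = refl
lookup-𝟘 (a ∷ x) e = cong₂ _∷_ (e zero) (lookup-𝟘 x (e ∘ suc))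

reduced-basis : ∀ {m} (w : Vec ℕ (suc (suc m))) → 0 < sum w →
  ∃[ xs ] (∀ i → dot (map +_ w) (lookup xs i) ≡ 0ℤ) ×
    (∀ c → combination {r = suc m} c xs ≡ 𝟘 → c ≡ 𝟘) × product (map norm xs) ≤ sum w
reduced-basis {m} w W>0 =
  minima φ F , (λ i → cong head (minima-kernel F i)) , minima-independent φ F id-linear , minkowski w F W>0
  where
  φ = functional w
  F : Flag φ (suc m) id 0
  F = flag φ id 0 φ id id-linear (dot-linear (map +_ w)) (λ _ → refl) (λ _ → refl)
    -- The all-ones vector shows that `φ` is nonzero, its value being ∑ wⱼ; and no norm is below the
    -- initial s = 0.
    (replicate _ 1ℤ , λ e → ℕ.n>0⇒n≢0 W>0 (ℤ.+-injective (trans (sym (dot-𝟙 w)) (cong head e)))) λ _ _ ()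

-- The linear equation attached to a + b = c

coprime⇒disjoint : ∀ {m n} → Coprime m n → ∀ (p : ℙ) → proj₁ p ∣ m → ¬ proj₁ p ∣ n
coprime⇒disjoint coprime (p , p-prime) p∣m p∣n with coprime (p∣m , p∣n)
... | refl = ¬prime[1] p-prime

total-+ : ∀ (f g : ℙ → ℕ) ps → total (λ p → f p + g p) ps ≡ total f ps + total g ps
total-+ f g []       = refl
total-+ f g (p ∷ ps) = trans (cong (λ t → f p + g p + t) (total-+ f g ps))
  (interchange (f p) (g p) (total f ps) (total g ps))
  where open import Algebra.Properties.CommutativeSemigroup ℕ.+-commutativeSemigroup using (interchange)

∈⇒≤total : ∀ f {p ps} → p ∈ ps → f p ≤ total f ps
∈⇒≤total f (here refl) = ℕ.m≤m+n _ _
∈⇒≤total f (there p∈)  = ℕ.≤-trans (∈⇒≤total f p∈) (ℕ.m≤n+m _ _)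

module Sum (a b : ℕ) (a>0 : 0 < a) (b>0 : 0 < b) (coprime : Coprime a b) where

  c = a + b
  abc = a * b * c

  c>0 : 0 < c
  c>0 = ℕ.≤-trans a>0 (ℕ.m≤m+n a b)

  abc>0 : 0 < abc
  abc>0 = ℕ.*-mono-< (ℕ.*-mono-< a>0 b>0) c>0

  a-coprime-c : Coprime a c
  a-coprime-c (d∣a , d∣c) = coprime (d∣a , ∣m+n∣m⇒∣n d∣c d∣a)

  b-coprime-c : Coprime b c
  b-coprime-c {k} (d∣b , d∣c) = coprime (∣m+n∣m⇒∣n (subst (λ n → k ∣ n) (ℕ.+-comm a b) d∣c) d∣b , d∣b)

  -- For `p` dividing abc, the sign of the coefficient of ξₚ in dc - da - db; for other primes -1 is
  -- a default.
  sign : ℙ → ℤ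
  sign p with proj₁ p ∣? c
  ... | yes _ = 1ℤ
  ... | no  _ = -1ℤ

  sign-unit : ∀ p → sign p ≡ 1ℤ ⊎ sign p ≡ -1ℤ
  sign-unit p with proj₁ p ∣? c
  ... | yes _ = inj₁ refl
  ... | no  _ = inj₂ refl

  -- At most one of the three terms is nonzero, so the sum selects it without a case distinction.
  weight : ℙ → ℕ
  weight p = ∂ c p + (∂ a p + ∂ b p)

  -- p divides at most one of a, b, c.
  sign-∂ : ∀ p → sign p ℤ.* + ∂ c p ≡ (sign p ℤ.* + ∂ a p ℤ.+ sign p ℤ.* + ∂ b p) ℤ.+ + weight p
  sign-∂ p with proj₁ p ∣? c
  ... | yes p∣c rewrite ∤⇒∂≡0 a p (λ p∣a → coprime⇒disjoint a-coprime-c p p∣a p∣c)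
                      | ∤⇒∂≡0 b p (λ p∣b → coprime⇒disjoint b-coprime-c p p∣b p∣c) = lemma (+ ∂ c p)
    where
    lemma : ∀ z → 1ℤ ℤ.* z ≡ 0ℤ ℤ.+ (z ℤ.+ 0ℤ)
    lemma = solve-∀
  ... | no  p∤c rewrite ∤⇒∂≡0 c p p∤c = lemma (+ ∂ a p) (+ ∂ b p)
    where
    lemma : ∀ x y → 0ℤ ≡ (-1ℤ ℤ.* x ℤ.+ -1ℤ ℤ.* y) ℤ.+ (x ℤ.+ y)
    lemma = solve-∀

  open Coordinates sign sign-unit

  weights : ∀ ps → Vec ℕ (length ps)
  weights ps = map weight (fromList ps)

  coords-d : ∀ ps → coords ps (d (+ c)) ≡
    (coords ps (d (+ a)) ⊕ coords ps (d (+ b))) ⊕ map +_ (weights ps)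
  coords-d []       = refl
  coords-d (p ∷ ps) = cong₂ _∷_
    (begin
      sign p ℤ.* coeff (proj₁ p) (d (+ c))     ≡⟨ cong (sign p ℤ.*_) (coeff-d c p c>0) ⟩
      sign p ℤ.* + ∂ c p                       ≡⟨ sign-∂ p ⟩
      (sign p ℤ.* + ∂ a p ℤ.+ sign p ℤ.* + ∂ b p) ℤ.+ + weight p
        ≡⟨ cong₂ (λ x y → (sign p ℤ.* x ℤ.+ sign p ℤ.* y) ℤ.+ + weight p) (coeff-d a p a>0) (coeff-d b p b>0) ⟨
      (sign p ℤ.* coeff (proj₁ p) (d (+ a)) ℤ.+ sign p ℤ.* coeff (proj₁ p) (d (+ b))) ℤ.+ + weight p  ∎)
    (coords-d ps)
    where open ≡-Reasoning

  -- Hence the derivation of `x` is additive on a + b = c exactly when the weights are orthogonal to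
  -- `x`. `solution` uses one direction, `values⊥` the other.
  dot-coords-d : ∀ ps x → dot x (coords ps (d (+ c))) ≡
    (dot x (coords ps (d (+ a))) ℤ.+ dot x (coords ps (d (+ b)))) ℤ.+ dot (map +_ (weights ps)) x
  dot-coords-d ps x = trans (cong (dot x) (coords-d ps))
    (trans (dot-⊕ʳ x (coords ps (d (+ a)) ⊕ coords ps (d (+ b))) _)
      (cong₂ ℤ._+_ (dot-⊕ʳ x _ _) (dot-comm x (map +_ (weights ps)))))

  -- The bounds a^a ≤ c^a and b^b ≤ c^b combine to c^c because a + b = c.
  4^weights : ∀ ps → Distinct ps → 4 ^ sum (weights ps) ≤ c ^ (2 * c)
  4^weights ps D = begin
    4 ^ total weight ps
      ≡⟨ cong (4 ^_) (trans (total-+ (∂ c) _ ps)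
           (cong (λ t → C + t) (total-+ (∂ a) (∂ b) ps))) ⟩
    4 ^ (C + (A + B))
      ≡⟨ trans (ℕ.^-distribˡ-+-* 4 C (A + B))
           (cong (λ t → 4 ^ C * t) (ℕ.^-distribˡ-+-* 4 A B)) ⟩
    4 ^ C * (4 ^ A * 4 ^ B)                          ≤⟨ ℕ.*-mono-≤ (4^total-∂≤m^m c ps c>0 D)
      (ℕ.*-mono-≤ (ℕ.≤-trans (4^total-∂≤m^m a ps a>0 D) (ℕ.^-monoˡ-≤ a (ℕ.m≤m+n a b)))
                  (ℕ.≤-trans (4^total-∂≤m^m b ps b>0 D) (ℕ.^-monoˡ-≤ b (ℕ.m≤n+m b a)))) ⟩
    c ^ c * (c ^ a * c ^ b)                          ≡⟨ cong (c ^ c *_) (ℕ.^-distribˡ-+-* c a b) ⟨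
    c ^ c * c ^ c                                    ≡⟨ ℕ.^-distribˡ-+-* c c c ⟨
    c ^ (c + c)                                      ≡⟨ cong (λ t → c ^ (c + t)) (ℕ.+-identityʳ c) ⟨
    c ^ (2 * c)                                      ∎
    where
    open ℕ.≤-Reasoning
    A = total (∂ a) ps
    B = total (∂ b) ps
    C = total (∂ c) ps

  module _ (ps : List ℙ) (D : Distinct ps) (complete : ∀ p → proj₁ p ∣ abc → p ∈ ps)
           (sound : ∀ p → p ∈ ps → proj₁ p ∣ abc) where

    private
      W = map +_ (weights ps)

    solution : ∀ x → dot W x ≡ 0ℤ → LeftModule.Carrierᴹ 𝒯⟨ a , b ⟩
    solution x W⊥x = derivation D x , record
      { supp⊆  = λ p ≢0 → sound p (decidable-stable (p ∈? ps) λ p∉ → ≢0 (dot-ξ-∉ ps x p p∉))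
      ; d^-add = trans (dot-coords-d ps x) (trans (cong (λ t → rhs ℤ.+ t) W⊥x) (ℤ.+-identityʳ rhs))
      }
      where
      rhs = dot x (coords ps (d (+ a))) ℤ.+ dot x (coords ps (d (+ b)))

    module _ (ψ : LeftModule.Carrierᴹ 𝒯⟨ a , b ⟩) where

      private
        f = eval ψ
        open In𝒯⟨_,_⟩ (proj₂ ψ)

      eval≡dot : ∀ z → f z ≡ dot (values ps f) (coords ps z)
      eval≡dot = linear≡dot D (proj₂ (proj₁ (proj₁ ψ)))
        λ p p∉ → decidable-stable (f (ξ p) ℤ.≟ 0ℤ) λ ≢0 → p∉ (complete p (supp⊆ p ≢0))

      values⊥ : dot W (values ps f) ≡ 0ℤ
      values⊥ = identityʳ-unique _ _ (begin
        (dot x (coords ps (d (+ a))) ℤ.+ dot x (coords ps (d (+ b)))) ℤ.+ dot W x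
          ≡⟨ dot-coords-d ps x ⟨
        dot x (coords ps (d (+ c)))                                   ≡⟨ eval≡dot (d (+ c)) ⟨
        f (d (+ c))                                                   ≡⟨ d^-add ⟩
        f (d (+ a)) ℤ.+ f (d (+ b))
          ≡⟨ cong₂ ℤ._+_ (eval≡dot (d (+ a))) (eval≡dot (d (+ b))) ⟩
        dot x (coords ps (d (+ a))) ℤ.+ dot x (coords ps (d (+ b)))   ∎)
        where
        open ≡-Reasoning
        open ℤ+ using (identityʳ-unique)
        x = values ps f

    -- The vectors of values lie in a hyperplane of dimension `length ps` - 1, and by `eval≡dot` a
    -- relation between them is one between the derivations.
    rank-≤ : 0 < sum (weights ps) → ∀ {k} (ψ : Fin k → LeftModule.Carrierᴹ 𝒯⟨ a , b ⟩) →
      LinearlyIndependent 𝒯⟨ a , b ⟩ ψ → k < length ps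
    rank-≤ W>0 {k} ψ independent = ℕ.≰⇒> λ n≤k →
      let xs = tabulate (λ i → values ps (eval (ψ i)))
          (y , y≢0 , dependent) = hyperplane-dependent (weights ps) W>0 n≤k xs λ i →
            trans (cong (dot W) (Vec.lookup∘tabulate _ i)) (values⊥ (ψ i))
          zero-coefficients = independent (lookup y) λ z → begin
            eval (∑ +ᴹ-rawMonoid (λ i → lookup y i *ₗ ψ i)) z
              ≡⟨ eval-∑ (coords ps) (lookup y) ψ xs (λ i z → trans (eval≡dot (ψ i) z)
                   (cong (λ x → dot x (coords ps z)) (sym (Vec.lookup∘tabulate _ i)))) z ⟩
            dot (combination (tabulate (lookup y)) xs) (coords ps z)
              ≡⟨ cong (λ c → dot (combination c xs) (coords ps z)) (Vec.tabulate∘lookup y) ⟩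
            dot (combination y xs) (coords ps z)   ≡⟨ cong (λ u → dot u (coords ps z)) dependent ⟩
            dot 𝟘 (coords ps z)                    ≡⟨ trans (dot-comm 𝟘 (coords ps z)) (dot-𝟘ʳ (coords ps z)) ⟩
            0ℤ                                     ∎
      in y≢0 (lookup-𝟘 y zero-coefficients)
      where
      open ≡-Reasoning
      open LeftModule 𝒯⟨ a , b ⟩ using (_*ₗ_; +ᴹ-rawMonoid)

    solutions-independent : ∀ {r} (xs : Vec (Vec ℤ (length ps)) r) (xs⊥ : ∀ i → dot W (lookup xs i) ≡ 0ℤ) →
      (∀ c → combination c xs ≡ 𝟘 → c ≡ 𝟘) →
      LinearlyIndependent 𝒯⟨ a , b ⟩ (λ i → solution (lookup xs i) (xs⊥ i))
    solutions-independent xs xs⊥ independent k ∑≈0 i = begin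
      k i                         ≡⟨ Vec.lookup∘tabulate k i ⟨
      lookup (tabulate k) i       ≡⟨ cong (λ c → lookup c i) k≡0 ⟩
      lookup 𝟘 i                  ≡⟨ Vec.lookup-replicate i 0ℤ ⟩
      0ℤ                          ∎
      where
      open ≡-Reasoning
      y = combination (tabulate k) xs
      -- A relation between the derivations makes all values of the combined vector at the ξₚ zero,
      -- hence its norm.
      vanishes : ∀ p → ∣ dot y (coords ps (ξ p)) ∣ ≤ 0
      vanishes p = ℕ.≤-reflexive (cong ∣_∣ (trans
        (sym (eval-∑ (coords ps) k (λ i → solution (lookup xs i) (xs⊥ i)) xs (λ _ _ → refl) (ξ p)))
        (∑≈0 (ξ p))))
      k≡0 : tabulate k ≡ 𝟘
      k≡0 = independent (tabulate k) (norm≡0 y (ℕ.n≤0⇒n≡0 (norm≤ D y 0 vanishes)))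

    short-solutions : ∀ {r} (xs : Vec (Vec ℤ (length ps)) r) → (∀ i → dot W (lookup xs i) ≡ 0ℤ) →
      (∀ c → combination c xs ≡ 𝟘 → c ≡ 𝟘) → product (map norm xs) ≤ sum (weights ps) → 2 ≤ length ps →
      Σ[ ψ ∈ (Fin r → LeftModule.Carrierᴹ 𝒯⟨ a , b ⟩) ]
      Σ[ s ∈ (Fin r → ℕ) ]
        LinearlyIndependent 𝒯⟨ a , b ⟩ ψ ×
        (∀ i → ‖ proj₁ (ψ i) ‖≡ s i) ×
        (2 * ∏ s) ·ℝ log 2 ≤ℝ (length ps * c) ·ℝ log c
    short-solutions {r} xs xs⊥ independent short 2≤n =
      (λ i → solution (lookup xs i) (xs⊥ i)) , s , solutions-independent xs xs⊥ independent ,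
      (λ i → ∣dot-ξ∣≤norm D (lookup xs i) , norm≤ D (lookup xs i)) ,
      log-compare (2 * ∏ s) (length ps * c) (s≤s z≤n) c>0 size-bound
      where
      s : Fin r → ℕ
      s i = norm (lookup xs i)
      size-bound : 2 ^ (2 * ∏ s) ≤ c ^ (length ps * c)
      size-bound = begin
        2 ^ (2 * ∏ s)               ≡⟨ ℕ.^-*-assoc 2 2 (∏ s) ⟨
        4 ^ ∏ s                     ≡⟨ cong (4 ^_) (∏-lookup xs) ⟩
        4 ^ product (map norm xs)   ≤⟨ ℕ.^-monoʳ-≤ 4 short ⟩
        4 ^ sum (weights ps)        ≤⟨ 4^weights ps D ⟩
        c ^ (2 * c)                 ≤⟨ ℕ.^-monoʳ-≤ c {{ℕ.>-nonZero c>0}} (ℕ.*-monoˡ-≤ c 2≤n) ⟩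
        c ^ (length ps * c)         ∎
        where open ℕ.≤-Reasoning

  -- Stated for an arbitrary list so that matching on it exhibits its length as `suc (suc m)`, the
  -- dimension that `reduced-basis` asks for.
  rank-and-short-solutions : ∀ ps → Distinct ps → (∀ p → proj₁ p ∣ abc → p ∈ ps) →
    (∀ p → p ∈ ps → proj₁ p ∣ abc) → 0 < sum (weights ps) → 2 ≤ length ps →
    let r = length ps ∸ 1 in
    1 ≤ r ×
    HasRank 𝒯⟨ a , b ⟩ r ×
    (Σ[ ψ ∈ (Fin r → LeftModule.Carrierᴹ 𝒯⟨ a , b ⟩) ]
     Σ[ s ∈ (Fin r → ℕ) ]
       LinearlyIndependent 𝒯⟨ a , b ⟩ ψ ×
       (∀ i → ‖ proj₁ (ψ i) ‖≡ s i) ×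
       (2 * ∏ s) ·ℝ log 2 ≤ℝ (length ps * c) ·ℝ log c)
  rank-and-short-solutions (_ ∷ []) _ _ _ _ (s≤s ())
  rank-and-short-solutions ps@(_ ∷ _ ∷ _) D complete sound W>0 2≤n =
    let (xs , xs⊥ , xs-independent , xs-short) = reduced-basis (weights ps) W>0
        (ψ , s , independent , rest) = short-solutions ps D complete sound xs xs⊥ xs-independent xs-short 2≤n
    in s≤s z≤n ,
       ((ψ , independent) , λ φ φ-independent → s≤s⁻¹ (rank-≤ ps D complete sound W>0 φ φ-independent)) ,
       ψ , s , independent , rest

theorem2p6 : ∀ (a b : ℕ) → 0 < a → 0 < b → Coprime a b → 2 < a + b →
    let c = a + b
        r = ω (a * b * c) ∸ 1
    in 1 ≤ r ×
       HasRank 𝒯⟨ a , b ⟩ r ×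
       (Σ[ ψ ∈ (Fin r → LeftModule.Carrierᴹ 𝒯⟨ a , b ⟩) ]
        Σ[ s ∈ (Fin r → ℕ) ]
          LinearlyIndependent 𝒯⟨ a , b ⟩ ψ ×
          (∀ i → ‖ proj₁ (ψ i) ‖≡ s i) ×
          -- ∏ ‖ψᵢ‖ ≤ ω(abc) / (2 log 2) · c log c, multiplied by 2 log 2 > 0
          (2 * ∏ s) ·ℝ log 2 ≤ℝ (ω (a * b * c) * c) ·ℝ log c)
theorem2p6 a b a>0 b>0 coprime c>2 =
  rank-and-short-solutions (supp abc) (supp-distinct abc) (λ p → ∈-supp abc>0 p)
    (λ p p∈ → proj₂ (∈.∈-filter⁻ _ {xs = primesUpTo abc} p∈)) weights>0 two-primes
  where
  open Sum a b a>0 b>0 coprime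
  c-divisor : Σ[ q ∈ ℙ ] proj₁ q ∣ c
  c-divisor = let (q , q-prime , q∣c) = prime-divisor (ℕ.<⇒≤ c>2) in (q , q-prime) , q∣c
  q = proj₁ c-divisor
  q∣c = proj₂ c-divisor
  q∈ : q ∈ supp abc
  q∈ = ∈-supp abc>0 q (∣n⇒∣m*n (a * b) q∣c)
  weights>0 : 0 < sum (weights (supp abc))
  weights>0 = ℕ.≤-trans (ℕ.≤-trans (∣⇒∂>0 c q c>0 q∣c) (ℕ.m≤m+n (∂ c q) _)) (∈⇒≤total weight q∈)
  -- As c > 2, one of a, b exceeds 1. It is coprime to c, so it supplies a prime different from `q`.
  another : ∀ m → Coprime m c → m ∣ abc → 1 < m → 2 ≤ length (supp abc)
  another m m-coprime-c m∣abc 1<m =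
    let (p , p-prime , p∣m) = prime-divisor 1<m
    in two-elements (∈-supp abc>0 (p , p-prime) (∣-trans p∣m m∣abc)) q∈
         λ p≡q → coprime⇒disjoint m-coprime-c (p , p-prime) p∣m (subst (λ p → proj₁ p ∣ c) (sym p≡q) q∣c)
  two-primes : 2 ≤ length (supp abc)
  two-primes with 1 ℕ.<? a | 1 ℕ.<? b
  ... | yes 1<a | _       = another a a-coprime-c (∣m⇒∣m*n c (m∣m*n b)) 1<a
  ... | no  _   | yes 1<b = another b b-coprime-c (∣m⇒∣m*n c (n∣m*n a)) 1<b
  ... | no  a≤1 | no  b≤1 = contradiction c>2 (ℕ.≤⇒≯ (ℕ.+-mono-≤ (ℕ.≮⇒≥ a≤1) (ℕ.≮⇒≥ b≤1)))
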